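{- Let $d \geq 2$ and $n \geq d+1$ be integers. Then $$\min\{a(X) \mid X \subset \mathbb{R}^d,\ \operatorname{aff} X = \mathbb{R}^d,\ X \text{ is in convex position},\ |X| = n\} = n + \frac{d(d-1)}{2} - 1 .$$
   Context: Let $X=\{x_1,\dots,x_n\}\subset\mathbb{R}^d$ be a finite set (with $x_i\neq x_j$ for $i\ne j$) whose affine hull is $\mathbb{R}^d$, and let $P=\operatorname{conv}X$. Two distinct points $x_i,x_j\in X$ are called antipodal (in $X$) if there are different parallel supporting hyperplanes $H',H''$ of $P$ with $x_i\in H'$ and $x_j\in H''$. $a(X)$ denotes the number of (unordered) antipodal pairs $\{x_i,x_j\}$ of $X$. $X$ is in convex position if $X\subset \operatorname{bd}P$ (so points of $X$ need not be vertices of $P$). -}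

module Defs where

open import Algebra.Bundles using (CommutativeRing)
import Algebra.Definitions as AlgebraDefs
import Algebra.Properties.Monoid.Sum as Sum
open import Axiom.ExcludedMiddle using (ExcludedMiddle)
open import Data.Fin.Base as Fin using (Fin)
open import Data.List.Base using (length; filter; cartesianProduct; allFin)
open import Data.Nat.Base as ℕ using (ℕ)
open import Data.Product.Base using (Σ; ∃; ∃-syntax; _×_; _,_)
open import Data.Sum.Base using (_⊎_)
open import Data.Vec.Functional using (Vector)
import Data.Vec.Functional.Relation.Binary.Equality.Setoid as VecEq
open import Function.Bundles using (_⇔_)
open import Function.Definitions using (Injective)
open import Level using (0ℓ; suc)
open import Relation.Binary.Core using (Rel)
open import Relation.Binary.PropositionalEquality.Core using (_≡_)
open import Relation.Binary.Structures using (IsTotalOrder)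
open import Relation.Nullary.Negation.Core using (¬_)
open import Relation.Unary using (Pred; _∈_)

-- The real numbers, given by their axioms: an ordered field in which every
-- nonempty set that is bounded above has a least upper bound.  Classically
-- such a field exists and is unique up to isomorphism.

record RealNumbers : Set (suc 0ℓ) where
  field
    commutativeRing : CommutativeRing 0ℓ 0ℓ

  open CommutativeRing commutativeRing public

  infix 4 _≤_ _<_

  field
    _≤_          : Rel Carrier 0ℓ
    isTotalOrder : IsTotalOrder _≈_ _≤_
    +-monoˡ-≤    : ∀ {x y} z → x ≤ y → x + z ≤ y + z
    *-nonNeg     : ∀ {x y} → 0# ≤ x → 0# ≤ y → 0# ≤ x * y
    0≉1          : ¬ 0# ≈ 1#
    ≉0⇒invertible : ∀ x → ¬ x ≈ 0# → AlgebraDefs.Invertible _≈_ 1# _*_ x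

  _<_ : Rel Carrier 0ℓ
  x < y = x ≤ y × ¬ x ≈ y

  UpperBound : Pred Carrier 0ℓ → Pred Carrier 0ℓ
  UpperBound S b = ∀ x → x ∈ S → x ≤ b

  field
    supremum : (S : Pred Carrier 0ℓ) → ∃ S → ∃ (UpperBound S) →
               ∃[ s ] UpperBound S s × (∀ b → UpperBound S b → s ≤ b)

module Geometry (ℝ : RealNumbers) where

  open RealNumbers ℝ
  open Sum +-monoid using (sum)
  open VecEq setoid using (_≋_)

  Point : ℕ → Set
  Point d = Vector Carrier d

  ⟨_,_⟩ : ∀ {d} → Point d → Point d → Carrier
  ⟨ u , v ⟩ = sum (λ k → u k * v k)

  dist² : ∀ {d} → Point d → Point d → Carrier
  dist² x y = ⟨ (λ k → x k - y k) , (λ k → x k - y k) ⟩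

  combination : ∀ {d n} → Vector Carrier n → Vector (Point d) n → Point d
  combination t X k = sum (λ i → t i * X i k)

  aff : ∀ {d n} → Vector (Point d) n → Pred (Point d) 0ℓ
  aff X y = ∃[ t ] sum t ≈ 1# × combination t X ≋ y

  conv : ∀ {d n} → Vector (Point d) n → Pred (Point d) 0ℓ
  conv X y = ∃[ t ] (∀ i → 0# ≤ t i) × sum t ≈ 1# × combination t X ≋ y

  -- The open Euclidean ball of radius ε, for ε > 0.
  Ball : ∀ {d} → Point d → Carrier → Pred (Point d) 0ℓ
  Ball x ε y = dist² x y < ε * ε

  -- The topological boundary: every ball around x meets both S and its
  -- complement.
  bd : ∀ {d} → Pred (Point d) 0ℓ → Pred (Point d) 0ℓ
  bd S x = ∀ ε → 0# < ε →
           (∃[ y ] y ∈ Ball x ε × y ∈ S) × (∃[ y ] y ∈ Ball x ε × ¬ y ∈ S)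

  -- The hyperplane { x ∣ ⟨ normal , x ⟩ = offset }.
  record Hyperplane (d : ℕ) : Set where
    field
      normal   : Point d
      offset   : Carrier
      normal≉0 : ¬ normal ≋ (λ _ → 0#)

  open Hyperplane public

  _on_ : ∀ {d} → Point d → Hyperplane d → Set
  x on H = ⟨ normal H , x ⟩ ≈ offset H

  -- Different as sets of points: a hyperplane has many equations.
  Different : ∀ {d} → Hyperplane d → Hyperplane d → Set
  Different H H′ = ¬ (∀ x → x on H ⇔ x on H′)

  -- The factor c is nonzero because normals are nonzero.
  Parallel : ∀ {d} → Hyperplane d → Hyperplane d → Set
  Parallel H H′ = ∃[ c ] normal H′ ≋ (λ k → c * normal H k)

  Supports : ∀ {d} → Hyperplane d → Pred (Point d) 0ℓ → Set
  Supports H P =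
    (∃[ y ] y ∈ P × y on H) ×
    ((∀ y → y ∈ P → ⟨ normal H , y ⟩ ≤ offset H) ⊎
     (∀ y → y ∈ P → offset H ≤ ⟨ normal H , y ⟩))

  Antipodal : ∀ {d n} → Vector (Point d) n → Fin n → Fin n → Set
  Antipodal {d} X i j =
    ¬ X i ≋ X j ×
    Σ (Hyperplane d) λ H′ → Σ (Hyperplane d) λ H″ →
      Different H′ H″ × Parallel H′ H″ ×
      Supports H′ (conv X) × Supports H″ (conv X) ×
      X i on H′ × X j on H″

  -- An unordered pair of indices is represented by (i , j) with i < j.
  AntipodalPair : ∀ {d n} → Vector (Point d) n → Pred (Fin n × Fin n) 0ℓ
  AntipodalPair X (i , j) = i Fin.< j × Antipodal X i j

  -- Counting a set of pairs that is not given with a decision procedure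
  -- uses excluded middle.
  a : ExcludedMiddle 0ℓ → ∀ {d n} → Vector (Point d) n → ℕ
  a em {n = n} X =
    length (filter (λ p → em {AntipodalPair X p})
                   (cartesianProduct (allFin n) (allFin n)))

  AffinelySpanning : ∀ {d n} → Vector (Point d) n → Set
  AffinelySpanning X = ∀ y → y ∈ aff X

  InConvexPosition : ∀ {d n} → Vector (Point d) n → Set
  InConvexPosition X = ∀ i → X i ∈ bd (conv X)

  -- The set { a(X) ∣ X ⊂ ℝᵈ, aff X = ℝᵈ, X in convex position, |X| = n };
  -- a set X with n elements is given by an injective enumeration.
  AntipodalCounts : ExcludedMiddle 0ℓ → (d n : ℕ) → Pred ℕ 0ℓ
  AntipodalCounts em d n m =
    Σ (Vector (Point d) n) λ X →
      Injective _≡_ _≋_ X × AffinelySpanning X × InConvexPosition X ×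
      a em X ≡ m

IsMinimum : Pred ℕ 0ℓ → ℕ → Set
IsMinimum S m = m ∈ S × (∀ k → k ∈ S → m ℕ.≤ k)

{-# OPTIONS --safe #-}
module Submission where

-- Lower bound.  If there were fewer than n + d(d-1)/2 - 1 antipodal pairs, then
-- linear algebra would give a function f on X, vanishing at one point, and an
-- alternating bilinear form ω, not both zero, such that ω(y, x) = f x - f y for
-- all antipodal x, y.  For T inside conv X let M T be the maximum over x in X of
-- f x - ω(T, x).  Complementary slackness, for a linear program on the normal
-- cone of a maximiser x, shows M T + ω(T, S) ≤ M S for all T, S inside conv X:
-- pairing the optimality identity with ω(Z, ·), where Z is the part of the
-- identity that comes from the points opposite to x, leaves only values
-- of ω at antipodal pairs.  Adding this around a triangle T, S, R bounds
-- ω(S - T, R - T) by 0 for both orientations, so ω = 0.  Then f is constant on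
-- antipodal pairs.  Antipodality is connected, because the colour of the faces
-- with outer normals u and -u cannot change while u runs through a segment that
-- avoids 0.  Hence f = 0, a contradiction.
--
-- Upper bound.  A simplex with n - d - 1 further points in the relative interior
-- of one facet: each of these is antipodal to the opposite vertex only.

open import Defs
open import Algebra.Bundles using (RawRing)
import Algebra.Properties.AbelianGroup
import Algebra.Properties.Monoid.Mult
import Algebra.Properties.Monoid.Mult.TCOptimised
import Algebra.Properties.Ring
import Algebra.Properties.Semiring.Mult
import Algebra.Properties.Semiring.Sum
import Algebra.Solver.Ring
open import Algebra.Solver.Ring.AlmostCommutativeRing using (_-Raw-AlmostCommutative⟶_; fromCommutativeRing)
open import Axiom.ExcludedMiddle using (ExcludedMiddle)
open import Data.Empty using (⊥; ⊥-elim)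
open import Data.Fin.Base as Fin using (Fin; zero; suc; splitAt; _↑ˡ_; _↑ʳ_; combine; remQuot; punchIn)
import Data.Fin.Properties as Finₚ
open import Data.Integer.Base as ℤ using (ℤ; -[1+_])
import Data.Integer.Properties as ℤₚ
open import Data.List.Base as List using (List; []; length; lookup; filter; cartesianProduct; allFin)
open import Data.List.Membership.Propositional using (_∈_)
open import Data.List.Membership.Propositional.Properties
  using (∈-filter⁺; ∈-filter⁻; ∈-cartesianProduct⁺; ∈-allFin; ∈-map⁺; ∈-++⁺ˡ; ∈-++⁺ʳ; ∈-lookup)
open import Data.List.Properties using (length-map; length-++; length-tabulate)
import Data.List.Relation.Unary.All as All
import Data.List.Relation.Unary.AllPairs.Core as AllPairs
open import Data.List.Relation.Unary.Any using (index)
open import Data.List.Relation.Unary.Any.Properties using (lookup-index)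
open import Data.List.Relation.Unary.Unique.Propositional using (Unique)
import Data.List.Relation.Unary.Unique.Propositional.Properties as Uniqueₚ
open import Data.Maybe.Base using (Maybe; just; nothing)
open import Data.Nat.Base as ℕ using (ℕ; zero; suc; s≤s)
open import Data.Nat.DivMod using (m*n/n≡m)
import Data.Nat.Properties as ℕₚ
open import Data.Product.Base using (Σ; ∃-syntax; _×_; _,_; proj₁; proj₂; map)
open import Data.Sum.Base using (_⊎_; inj₁; inj₂)
open import Data.Unit.Base using (⊤; tt)
open import Data.Vec.Functional using (Vector; tail; _∷_; _++_; insertAt)
open import Data.Vec.Functional.Properties using (insertAt-lookup; insertAt-punchIn; lookup-++ˡ; lookup-++ʳ)
open import Function.Base using (_∘_)
open import Function.Bundles using (Equivalence)
open import Level using (0ℓ)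
open import Relation.Binary.Definitions using (tri<; tri≈; tri>)
import Relation.Binary.PropositionalEquality as ≡
open ≡ using (_≡_; _≢_)
import Relation.Binary.Reasoning.Setoid
open import Relation.Binary.Structures using (IsTotalOrder)
open import Relation.Nullary using (¬_; Dec; yes; no)

-- The lower bound is a rank count. The unknowns are the n values of f and the d(d-1)/2 coefficients
-- of ω; the equations are one per antipodal pair and one normalisation. The normalisation is the
-- source of the -1: a constant f with ω = 0 solves every pair equation. The obstacle is to find
-- enough antipodal pairs, since the hypotheses exhibit none. Duality produces them: in an optimal
-- direction u, the rows with positive multipliers belong to points of the top and bottom faces of
-- u, and these are the pairs at which ω is known. For this u must not be 0, which is where convex
-- position is used: a supporting functional at the maximiser forces some bottom multiplier to be
-- positive. Taking T and S with strictly positive weights gives the strictness in that argument and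
-- a dual feasible point. Optima come from finitely many Fourier-Motzkin certificates rather than
-- from compactness. Suprema of real sets enter once, in the sweep along a segment that proves
-- connectedness.

-- Ring identities with integer coefficients.

module IntegerCoefficients (ℝ : RealNumbers) where
  open RealNumbers ℝ hiding (_≤_; _<_)
  open Algebra.Properties.Ring ring using (-‿distribˡ-*; -‿distribʳ-*; -0#≈0#; -‿involutive)
  open Algebra.Properties.AbelianGroup +-abelianGroup using (⁻¹-∙-comm)
  open Algebra.Properties.Monoid.Mult +-monoid using () renaming (_×_ to _·_; ×-homo-+ to ·-homo-+)
  open Algebra.Properties.Semiring.Mult semiring using () renaming (×1-homo-* to ·1-homo-*)
  open Algebra.Properties.Monoid.Mult.TCOptimised +-monoid using () renaming (_×_ to _·′_; ×ᵤ≈× to ·≈·′)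
  open Relation.Binary.Reasoning.Setoid setoid

  -- The optimised multiple `_·′_` sends 1 to `1#` itself rather than to `1# + 0#`. Hence `1-homo`
  -- is `refl`, and `:1` stands for `1#` in solver goals.
  ⟦_⟧ℤ : ℤ → Carrier
  ⟦ ℤ.+ n ⟧ℤ    = n ·′ 1#
  ⟦ -[1+ n ] ⟧ℤ = - (suc n ·′ 1#)

  ⟦+⟧ : ∀ n → ⟦ ℤ.+ n ⟧ℤ ≈ n · 1#
  ⟦+⟧ n = sym (·≈·′ n 1#)

  -‿homo : ∀ i → ⟦ ℤ.- i ⟧ℤ ≈ - ⟦ i ⟧ℤ
  -‿homo (ℤ.+ zero)  = sym -0#≈0#
  -‿homo (ℤ.+ suc n) = refl
  -‿homo -[1+ n ]    = sym (-‿involutive _)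

  ⊖-homo : ∀ m n → ⟦ m ℤ.⊖ n ⟧ℤ ≈ m · 1# - n · 1#
  ⊖-homo m zero = begin
    ⟦ ℤ.+ m ⟧ℤ      ≈⟨ ⟦+⟧ m ⟩
    m · 1#          ≈⟨ +-identityʳ _ ⟨
    m · 1# + 0#     ≈⟨ +-congˡ -0#≈0# ⟨
    m · 1# - 0#     ∎
  ⊖-homo zero (suc n) = begin
    - (suc n ·′ 1#)     ≈⟨ -‿cong (⟦+⟧ (suc n)) ⟩
    - (suc n · 1#)      ≈⟨ +-identityˡ _ ⟨
    0# - (suc n · 1#)   ∎
  ⊖-homo (suc m) (suc n) = begin
    ⟦ suc m ℤ.⊖ suc n ⟧ℤ                ≡⟨ ≡.cong ⟦_⟧ℤ (ℤₚ.[1+m]⊖[1+n]≡m⊖n m n) ⟩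
    ⟦ m ℤ.⊖ n ⟧ℤ                        ≈⟨ ⊖-homo m n ⟩
    m · 1# - n · 1#                     ≈⟨ +-congʳ (+-identityˡ _) ⟨
    0# + m · 1# - n · 1#                ≈⟨ +-congʳ (+-congʳ (-‿inverseʳ 1#)) ⟨
    1# - 1# + m · 1# - n · 1#           ≈⟨ +-congʳ (+-assoc _ _ _) ⟩
    1# + (- 1# + m · 1#) - n · 1#       ≈⟨ +-congʳ (+-congˡ (+-comm _ _)) ⟩
    1# + (m · 1# - 1#) - n · 1#         ≈⟨ +-congʳ (+-assoc _ _ _) ⟨
    1# + m · 1# - 1# - n · 1#           ≈⟨ +-assoc _ _ _ ⟩
    1# + m · 1# + (- 1# - n · 1#)       ≈⟨ +-congˡ (⁻¹-∙-comm _ _) ⟩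
    1# + m · 1# - (1# + n · 1#)         ∎

  +-homo : ∀ i j → ⟦ i ℤ.+ j ⟧ℤ ≈ ⟦ i ⟧ℤ + ⟦ j ⟧ℤ
  +-homo (ℤ.+ m) (ℤ.+ n) = begin
    ⟦ ℤ.+ (m ℕ.+ n) ⟧ℤ         ≈⟨ ⟦+⟧ (m ℕ.+ n) ⟩
    (m ℕ.+ n) · 1#             ≈⟨ ·-homo-+ 1# m n ⟩
    m · 1# + n · 1#            ≈⟨ +-cong (⟦+⟧ m) (⟦+⟧ n) ⟨
    ⟦ ℤ.+ m ⟧ℤ + ⟦ ℤ.+ n ⟧ℤ    ∎
  +-homo (ℤ.+ m) -[1+ n ] = trans (⊖-homo m (suc n)) (+-cong (sym (⟦+⟧ m)) (-‿cong (sym (⟦+⟧ (suc n)))))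
  +-homo -[1+ m ] (ℤ.+ n) = begin
    ⟦ n ℤ.⊖ suc m ⟧ℤ                   ≈⟨ ⊖-homo n (suc m) ⟩
    n · 1# - suc m · 1#                ≈⟨ +-comm _ _ ⟩
    - (suc m · 1#) + n · 1#            ≈⟨ +-cong (-‿cong (⟦+⟧ (suc m))) (⟦+⟧ n) ⟨
    ⟦ -[1+ m ] ⟧ℤ + ⟦ ℤ.+ n ⟧ℤ         ∎
  +-homo -[1+ m ] -[1+ n ] = begin
    - ⟦ ℤ.+ suc (suc (m ℕ.+ n)) ⟧ℤ     ≡⟨ ≡.cong (λ k → - ⟦ ℤ.+ suc k ⟧ℤ) (≡.sym (ℕ+suc m n)) ⟩
    - ⟦ ℤ.+ (suc m ℕ.+ suc n) ⟧ℤ       ≈⟨ -‿cong (+-homo (ℤ.+ suc m) (ℤ.+ suc n)) ⟩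
    - (⟦ ℤ.+ suc m ⟧ℤ + ⟦ ℤ.+ suc n ⟧ℤ) ≈⟨ ⁻¹-∙-comm _ _ ⟨
    ⟦ -[1+ m ] ⟧ℤ + ⟦ -[1+ n ] ⟧ℤ      ∎
    where
    ℕ+suc : ∀ m n → m ℕ.+ suc n ≡ suc (m ℕ.+ n)
    ℕ+suc zero    n = ≡.refl
    ℕ+suc (suc m) n = ≡.cong suc (ℕ+suc m n)

  +*-homo : ∀ m j → ⟦ ℤ.+ m ℤ.* j ⟧ℤ ≈ ⟦ ℤ.+ m ⟧ℤ * ⟦ j ⟧ℤ
  +*-homo m (ℤ.+ n) = begin
    ⟦ ℤ.+ m ℤ.* ℤ.+ n ⟧ℤ         ≡⟨ ≡.cong ⟦_⟧ℤ (≡.sym (ℤₚ.pos-* m n)) ⟩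
    ⟦ ℤ.+ (m ℕ.* n) ⟧ℤ           ≈⟨ ⟦+⟧ (m ℕ.* n) ⟩
    (m ℕ.* n) · 1#               ≈⟨ ·1-homo-* m n ⟩
    (m · 1#) * (n · 1#)          ≈⟨ *-cong (⟦+⟧ m) (⟦+⟧ n) ⟨
    ⟦ ℤ.+ m ⟧ℤ * ⟦ ℤ.+ n ⟧ℤ      ∎
  +*-homo m -[1+ n ] = begin
    ⟦ ℤ.+ m ℤ.* (ℤ.- ℤ.+ suc n) ⟧ℤ       ≡⟨ ≡.cong ⟦_⟧ℤ (≡.sym (ℤₚ.neg-distribʳ-* (ℤ.+ m) (ℤ.+ suc n))) ⟩
    ⟦ ℤ.- (ℤ.+ m ℤ.* ℤ.+ suc n) ⟧ℤ       ≈⟨ -‿homo (ℤ.+ m ℤ.* ℤ.+ suc n) ⟩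
    - ⟦ ℤ.+ m ℤ.* ℤ.+ suc n ⟧ℤ           ≈⟨ -‿cong (+*-homo m (ℤ.+ suc n)) ⟩
    - (⟦ ℤ.+ m ⟧ℤ * ⟦ ℤ.+ suc n ⟧ℤ)      ≈⟨ -‿distribʳ-* _ _ ⟩
    ⟦ ℤ.+ m ⟧ℤ * ⟦ -[1+ n ] ⟧ℤ           ∎

  *-homo : ∀ i j → ⟦ i ℤ.* j ⟧ℤ ≈ ⟦ i ⟧ℤ * ⟦ j ⟧ℤ
  *-homo (ℤ.+ m) j = +*-homo m j
  *-homo -[1+ m ] j = begin
    ⟦ (ℤ.- ℤ.+ suc m) ℤ.* j ⟧ℤ        ≡⟨ ≡.cong ⟦_⟧ℤ (≡.sym (ℤₚ.neg-distribˡ-* (ℤ.+ suc m) j)) ⟩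
    ⟦ ℤ.- (ℤ.+ suc m ℤ.* j) ⟧ℤ        ≈⟨ -‿homo (ℤ.+ suc m ℤ.* j) ⟩
    - ⟦ ℤ.+ suc m ℤ.* j ⟧ℤ            ≈⟨ -‿cong (+*-homo (suc m) j) ⟩
    - (⟦ ℤ.+ suc m ⟧ℤ * ⟦ j ⟧ℤ)       ≈⟨ -‿distribˡ-* _ _ ⟩
    ⟦ -[1+ m ] ⟧ℤ * ⟦ j ⟧ℤ            ∎

  ℤ-rawRing : RawRing 0ℓ 0ℓ
  ℤ-rawRing = record
    { Carrier = ℤ ; _≈_ = _≡_ ; _+_ = ℤ._+_ ; _*_ = ℤ._*_ ; -_ = ℤ.-_ ; 0# = ℤ.0ℤ ; 1# = ℤ.1ℤ }

  morphism : ℤ-rawRing -Raw-AlmostCommutative⟶ fromCommutativeRing commutativeRing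
  morphism = record
    { ⟦_⟧ = ⟦_⟧ℤ ; +-homo = +-homo ; *-homo = *-homo ; -‿homo = -‿homo ; 0-homo = refl ; 1-homo = refl }

  _coeff≟_ : ∀ i j → Maybe (⟦ i ⟧ℤ ≈ ⟦ j ⟧ℤ)
  i coeff≟ j with i ℤₚ.≟ j
  ... | yes i≡j = just (reflexive (≡.cong ⟦_⟧ℤ i≡j))
  ... | no  _   = nothing

  open Algebra.Solver.Ring ℤ-rawRing (fromCommutativeRing commutativeRing) morphism _coeff≟_ public
    using (Polynomial; solve; _:=_; _:+_; _:*_; _:-_; :-_; con)

  :0 :1 : ∀ {n} → Polynomial n
  :0 = con ℤ.0ℤ
  :1 = con ℤ.1ℤ

-- Order and division in the field.

module OrderedField (ℝ : RealNumbers) (em : ExcludedMiddle 0ℓ) where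
  open RealNumbers ℝ public hiding (zero)
  open IntegerCoefficients ℝ public using (solve; _:=_; _:+_; _:*_; _:-_; :-_; :0; :1)
  open IsTotalOrder isTotalOrder public
    using (total; antisym)
    renaming (refl to ≤-refl; reflexive to ≤-reflexive; trans to ≤-trans; ≤-respˡ-≈ to ≤-congˡ; ≤-respʳ-≈ to ≤-congʳ)

  module ≈-Reasoning = Relation.Binary.Reasoning.Setoid setoid

  ≰⇒> : ∀ {x y} → ¬ x ≤ y → y < x
  ≰⇒> {x} {y} x≰y with total x y
  ... | inj₁ x≤y = ⊥-elim (x≰y x≤y)
  ... | inj₂ y≤x = y≤x , λ y≈x → x≰y (≤-reflexive (sym y≈x))

  <⇒≱ : ∀ {x y} → x < y → ¬ y ≤ x
  <⇒≱ (x≤y , x≉y) y≤x = x≉y (antisym x≤y y≤x)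

  <-≤-dichotomy : ∀ x y → x < y ⊎ y ≤ x
  <-≤-dichotomy x y with em {y ≤ x}
  ... | yes y≤x = inj₂ y≤x
  ... | no  y≰x = inj₁ (≰⇒> y≰x)

  ≮⇒≥ : ∀ {x y} → ¬ x < y → y ≤ x
  ≮⇒≥ {x} {y} x≮y with <-≤-dichotomy x y
  ... | inj₁ x<y = ⊥-elim (x≮y x<y)
  ... | inj₂ y≤x = y≤x

  <-resp-≈ : ∀ {x x′ y y′} → x ≈ x′ → y ≈ y′ → x < y → x′ < y′
  <-resp-≈ x≈ y≈ (x≤y , x≉y) =
    ≤-congˡ x≈ (≤-congʳ y≈ x≤y) , λ x′≈y′ → x≉y (trans x≈ (trans x′≈y′ (sym y≈)))

  <-≤-trans : ∀ {x y z} → x < y → y ≤ z → x < z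
  <-≤-trans x<y y≤z = ≤-trans (proj₁ x<y) y≤z , λ x≈z → <⇒≱ x<y (≤-congʳ (sym x≈z) y≤z)

  ≤-<-trans : ∀ {x y z} → x ≤ y → y < z → x < z
  ≤-<-trans x≤y y<z = ≤-trans x≤y (proj₁ y<z) , λ x≈z → <⇒≱ y<z (≤-congˡ x≈z x≤y)

  x≤y⇒0≤y-x : ∀ {x y} → x ≤ y → 0# ≤ y - x
  x≤y⇒0≤y-x {x} x≤y = ≤-congˡ (-‿inverseʳ x) (+-monoˡ-≤ (- x) x≤y)

  0≤y-x⇒x≤y : ∀ {x y} → 0# ≤ y - x → x ≤ y
  0≤y-x⇒x≤y {x} {y} p =
    ≤-congˡ (+-identityˡ x) (≤-congʳ (solve 2 (λ x y → y :- x :+ x := y) refl x y) (+-monoˡ-≤ x p))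

  x<y⇒0<y-x : ∀ {x y} → x < y → 0# < y - x
  x<y⇒0<y-x {x} {y} (x≤y , x≉y) = x≤y⇒0≤y-x x≤y , λ 0≈ → x≉y
    (trans (sym (+-identityˡ x)) (trans (+-congʳ 0≈) (solve 2 (λ x y → y :- x :+ x := y) refl x y)))

  0<y-x⇒x<y : ∀ {x y} → 0# < y - x → x < y
  0<y-x⇒x<y {x} {y} (p , q) = 0≤y-x⇒x≤y p , λ x≈y → q (sym (trans (+-congˡ (-‿cong x≈y)) (-‿inverseʳ y)))

  +-mono-≤ : ∀ {x y u v} → x ≤ y → u ≤ v → x + u ≤ y + v
  +-mono-≤ {x} {y} {u} {v} x≤y u≤v =
    ≤-trans (+-monoˡ-≤ u x≤y) (≤-congˡ (+-comm u y) (≤-congʳ (+-comm v y) (+-monoˡ-≤ y u≤v)))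

  +-nonNeg : ∀ {x y} → 0# ≤ x → 0# ≤ y → 0# ≤ x + y
  +-nonNeg p q = ≤-congˡ (+-identityˡ 0#) (+-mono-≤ p q)

  +-pos-nonNeg : ∀ {x y} → 0# < x → 0# ≤ y → 0# < x + y
  +-pos-nonNeg {x} 0<x 0≤y = <-≤-trans 0<x (≤-congˡ (+-identityʳ x) (+-mono-≤ ≤-refl 0≤y))

  neg-antimono-≤ : ∀ {x y} → x ≤ y → - y ≤ - x
  neg-antimono-≤ {x} {y} x≤y = 0≤y-x⇒x≤y
    (≤-congʳ (solve 2 (λ x y → y :- x := :- x :- (:- y)) refl x y) (x≤y⇒0≤y-x x≤y))

  x≤0⇒0≤-x : ∀ {x} → x ≤ 0# → 0# ≤ - x
  x≤0⇒0≤-x {x} p = ≤-congʳ (+-identityˡ (- x)) (x≤y⇒0≤y-x p)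

  *-monoˡ-≤ : ∀ {c x y} → 0# ≤ c → x ≤ y → c * x ≤ c * y
  *-monoˡ-≤ {c} {x} {y} 0≤c x≤y = 0≤y-x⇒x≤y
    (≤-congʳ (solve 3 (λ c x y → c :* (y :- x) := c :* y :- c :* x) refl c x y)
             (*-nonNeg 0≤c (x≤y⇒0≤y-x x≤y)))

  *-nonPos : ∀ {c x} → 0# ≤ c → x ≤ 0# → c * x ≤ 0#
  *-nonPos {c} 0≤c x≤0 = ≤-congʳ (zeroʳ c) (*-monoˡ-≤ 0≤c x≤0)

  x*x-nonNeg : ∀ x → 0# ≤ x * x
  x*x-nonNeg x with total 0# x
  ... | inj₁ p = *-nonNeg p p
  ... | inj₂ p = ≤-congʳ (solve 1 (λ x → :- x :* :- x := x :* x) refl x) (*-nonNeg (x≤0⇒0≤-x p) (x≤0⇒0≤-x p))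

  0<1 : 0# < 1#
  0<1 = ≤-congʳ (*-identityˡ 1#) (x*x-nonNeg 1#) , 0≉1

  inverse : ∀ x → ¬ x ≈ 0# → ∃[ x⁻¹ ] x * x⁻¹ ≈ 1#
  inverse x x≉0 with ≉0⇒invertible x x≉0
  ... | x⁻¹ , _ , p = x⁻¹ , p

  *-cancel-0 : ∀ {x y} → ¬ x ≈ 0# → x * y ≈ 0# → y ≈ 0#
  *-cancel-0 {x} {y} x≉0 xy≈0 with ≉0⇒invertible x x≉0
  ... | x⁻¹ , p , _ = begin
    y               ≈⟨ *-identityˡ y ⟨
    1# * y          ≈⟨ *-congʳ p ⟨
    x⁻¹ * x * y     ≈⟨ *-assoc x⁻¹ x y ⟩
    x⁻¹ * (x * y)   ≈⟨ *-congˡ xy≈0 ⟩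
    x⁻¹ * 0#        ≈⟨ zeroʳ x⁻¹ ⟩
    0#              ∎
    where open ≈-Reasoning

  *-pos : ∀ {x y} → 0# < x → 0# < y → 0# < x * y
  *-pos (0≤x , 0≉x) (0≤y , 0≉y) =
    *-nonNeg 0≤x 0≤y , λ 0≈xy → 0≉y (sym (*-cancel-0 (λ x≈0 → 0≉x (sym x≈0)) (sym 0≈xy)))

  >⇒≉ : ∀ {x} → 0# < x → ¬ x ≈ 0#
  >⇒≉ (_ , 0≉x) x≈0 = 0≉x (sym x≈0)

  *-cancel-pos : ∀ {x y} → 0# ≤ x → 0# < x * y → 0# < y
  *-cancel-pos {x} 0≤x 0<xy = ≰⇒> λ y≤0 → <⇒≱ 0<xy (*-nonPos 0≤x y≤0)

  posInverse : ∀ {x} → 0# < x → ∃[ x⁻¹ ] 0# < x⁻¹ × x * x⁻¹ ≈ 1#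
  posInverse {x} 0<x with inverse x (>⇒≉ 0<x)
  ... | x⁻¹ , p = x⁻¹ , *-cancel-pos (proj₁ 0<x) (<-resp-≈ refl (sym p) 0<1) , p

  *-cancelˡ-≤ : ∀ {c x y} → 0# < c → c * x ≤ c * y → x ≤ y
  *-cancelˡ-≤ {c} {x} {y} 0<c p = ≮⇒≥ λ y<x →
    <⇒≱ (*-pos 0<c (x<y⇒0<y-x y<x))
        (≤-congˡ (solve 3 (λ c x y → c :* x :- c :* y := c :* (x :- y)) refl c x y)
          (≤-congʳ (-‿inverseʳ (c * y)) (+-monoˡ-≤ (- (c * y)) p)))

  x-y≈0⇒x≈y : ∀ {x y} → x - y ≈ 0# → x ≈ y
  x-y≈0⇒x≈y {x} {y} p = begin
    x           ≈⟨ solve 2 (λ x y → x := x :- y :+ y) refl x y ⟩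
    x - y + y   ≈⟨ +-congʳ p ⟩
    0# + y      ≈⟨ +-identityˡ y ⟩
    y           ∎
    where open ≈-Reasoning

  x≈y⇒x-y≈0 : ∀ {x y} → x ≈ y → x - y ≈ 0#
  x≈y⇒x-y≈0 {x} {y} x≈y = trans (+-congʳ x≈y) (-‿inverseʳ y)

-- Finite sums, unit vectors and maxima.

module FiniteSums (ℝ : RealNumbers) (em : ExcludedMiddle 0ℓ) where
  open OrderedField ℝ em public
  open Algebra.Properties.Semiring.Sum semiring public
    using (sum; sum-cong-≋; ∑-distrib-+; ∑-comm; *-distribˡ-sum; *-distribʳ-sum; sum-remove; sum-replicate-zero)

  sum-zero : ∀ {n} {f : Vector Carrier n} → (∀ i → f i ≈ 0#) → sum f ≈ 0#
  sum-zero {n} f≈0 = trans (sum-cong-≋ f≈0) (sum-replicate-zero n)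

  sum-nonNeg : ∀ {n} {f : Vector Carrier n} → (∀ i → 0# ≤ f i) → 0# ≤ sum f
  sum-nonNeg {zero}  0≤f = ≤-refl
  sum-nonNeg {suc n} 0≤f = +-nonNeg (0≤f zero) (sum-nonNeg (0≤f ∘ suc))

  sum-mono-≤ : ∀ {n} {f g : Vector Carrier n} → (∀ i → f i ≤ g i) → sum f ≤ sum g
  sum-mono-≤ {zero}  f≤g = ≤-refl
  sum-mono-≤ {suc n} f≤g = +-mono-≤ (f≤g zero) (sum-mono-≤ (f≤g ∘ suc))

  sum-nonPos : ∀ {n} {f : Vector Carrier n} → (∀ i → f i ≤ 0#) → sum f ≤ 0#
  sum-nonPos {n} f≤0 = ≤-congʳ (sum-replicate-zero n) (sum-mono-≤ f≤0)

  term≤sum : ∀ {n} {f : Vector Carrier n} → (∀ i → 0# ≤ f i) → ∀ i → f i ≤ sum f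
  term≤sum {suc n} {f} 0≤f zero    = ≤-congˡ (+-identityʳ _) (+-mono-≤ ≤-refl (sum-nonNeg (0≤f ∘ suc)))
  term≤sum {suc n} {f} 0≤f (suc i) = ≤-congˡ (+-identityˡ _) (+-mono-≤ (0≤f zero) (term≤sum (0≤f ∘ suc) i))

  sum-nonNeg-≤0 : ∀ {n} {f : Vector Carrier n} → (∀ i → 0# ≤ f i) → sum f ≤ 0# → ∀ i → f i ≈ 0#
  sum-nonNeg-≤0 0≤f s≤0 i = antisym (≤-trans (term≤sum 0≤f i) s≤0) (0≤f i)

  sum-neg : ∀ {n} (f : Vector Carrier n) → sum (λ i → - f i) ≈ - sum f
  sum-neg {zero}  f = solve 0 (:0 := :- :0) refl
  sum-neg {suc n} f = trans (+-congˡ (sum-neg (f ∘ suc)))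
    (solve 2 (λ x y → :- x :+ :- y := :- (x :+ y)) refl (f zero) (sum (f ∘ suc)))

  sum-sub : ∀ {n} (f g : Vector Carrier n) → sum (λ i → f i - g i) ≈ sum f - sum g
  sum-sub f g = trans (∑-distrib-+ f (λ i → - g i)) (+-congˡ (sum-neg g))

  sum-split : ∀ m {n} (f : Vector Carrier (m ℕ.+ n)) →
              sum f ≈ sum (λ i → f (i ↑ˡ n)) + sum (λ j → f (m ↑ʳ j))
  sum-split zero    f = sym (+-identityˡ _)
  sum-split (suc m) f = trans (+-congˡ (sum-split m (f ∘ suc))) (sym (+-assoc _ _ _))

  ++-elim : ∀ {m n} (P : Fin (m ℕ.+ n) → Set) → (∀ i → P (i ↑ˡ n)) → (∀ j → P (m ↑ʳ j)) → ∀ k → P k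
  ++-elim {m} {n} P l r k with splitAt m k in eq
  ... | inj₁ i = ≡.subst P (Finₚ.splitAt⁻¹-↑ˡ eq) (l i)
  ... | inj₂ j = ≡.subst P (Finₚ.splitAt⁻¹-↑ʳ eq) (r j)

  unit : ∀ {n} → Fin n → Vector Carrier n
  unit zero    = 1# ∷ λ _ → 0#
  unit (suc i) = 0# ∷ unit i

  unit-nonNeg : ∀ {n} (i j : Fin n) → 0# ≤ unit i j
  unit-nonNeg zero    zero    = proj₁ 0<1
  unit-nonNeg zero    (suc j) = ≤-refl
  unit-nonNeg (suc i) zero    = ≤-refl
  unit-nonNeg (suc i) (suc j) = unit-nonNeg i j

  unit-≤1 : ∀ {n} (i j : Fin n) → unit i j ≤ 1#
  unit-≤1 zero    zero    = ≤-refl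
  unit-≤1 zero    (suc j) = proj₁ 0<1
  unit-≤1 (suc i) zero    = proj₁ 0<1
  unit-≤1 (suc i) (suc j) = unit-≤1 i j

  unit-diag : ∀ {n} (i : Fin n) → unit i i ≡ 1#
  unit-diag zero    = ≡.refl
  unit-diag (suc i) = unit-diag i

  unit-off : ∀ {n} {i j : Fin n} → i ≢ j → unit i j ≡ 0#
  unit-off {i = zero}  {zero}  i≢j = ⊥-elim (i≢j ≡.refl)
  unit-off {i = zero}  {suc j} i≢j = ≡.refl
  unit-off {i = suc i} {zero}  i≢j = ≡.refl
  unit-off {i = suc i} {suc j} i≢j = unit-off (i≢j ∘ ≡.cong suc)

  unit-sym : ∀ {n} (i j : Fin n) → unit i j ≡ unit j i
  unit-sym zero    zero    = ≡.refl
  unit-sym zero    (suc j) = ≡.refl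
  unit-sym (suc i) zero    = ≡.refl
  unit-sym (suc i) (suc j) = unit-sym i j

  sum-unit-* : ∀ {n} (i : Fin n) (f : Vector Carrier n) → sum (λ j → unit i j * f j) ≈ f i
  sum-unit-* zero    f = trans (+-cong (*-identityˡ _) (sum-zero λ j → zeroˡ (f (suc j)))) (+-identityʳ _)
  sum-unit-* (suc i) f = trans (+-cong (zeroˡ _) (sum-unit-* i (f ∘ suc))) (+-identityˡ _)

  sum-unit : ∀ {n} (i : Fin n) → sum (unit i) ≈ 1#
  sum-unit i = trans (sum-cong-≋ (λ j → sym (*-identityʳ (unit i j)))) (sum-unit-* i (λ _ → 1#))

  -- Restricting to `P` allows maxima over the rows whose coefficient has a given sign, a set that
  -- may be empty. Minima are obtained by negating `v`.
  argmax : ∀ {n} (P : Fin n → Set) (v : Vector Carrier n) →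
           (∀ i → ¬ P i) ⊎ (∃[ i ] P i × ∀ j → P j → v j ≤ v i)
  argmax {zero}  P v = inj₁ λ ()
  argmax {suc n} P v with em {P zero} | argmax (P ∘ suc) (v ∘ suc)
  ... | no ¬p | inj₁ none = inj₁ λ { zero → ¬p ; (suc i) → none i }
  ... | no ¬p | inj₂ (i , pi , max) = inj₂ (suc i , pi , λ { zero p → ⊥-elim (¬p p) ; (suc j) → max j })
  ... | yes p | inj₁ none = inj₂ (zero , p , λ { zero _ → ≤-refl ; (suc j) q → ⊥-elim (none j q) })
  ... | yes p | inj₂ (i , pi , max) with total (v (suc i)) (v zero)
  ...   | inj₁ ≤0 = inj₂ (zero , p , λ { zero _ → ≤-refl ; (suc j) q → ≤-trans (max j q) ≤0 })
  ...   | inj₂ 0≤ = inj₂ (suc i , pi , λ { zero _ → 0≤ ; (suc j) → max j })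

-- Fourier-Motzkin elimination.

module LinearInequalities (ℝ : RealNumbers) (em : ExcludedMiddle 0ℓ) where
  open FiniteSums ℝ em public
  open Geometry ℝ public

  ⟨,⟩-congʳ : ∀ {d} {u v w : Point d} → (∀ k → v k ≈ w k) → ⟨ u , v ⟩ ≈ ⟨ u , w ⟩
  ⟨,⟩-congʳ v≋w = sum-cong-≋ λ k → *-congˡ (v≋w k)

  ⟨,⟩-congˡ : ∀ {d} {u v w : Point d} → (∀ k → u k ≈ v k) → ⟨ u , w ⟩ ≈ ⟨ v , w ⟩
  ⟨,⟩-congˡ u≋v = sum-cong-≋ λ k → *-congʳ (u≋v k)

  ⟨,⟩-comm : ∀ {d} (u v : Point d) → ⟨ u , v ⟩ ≈ ⟨ v , u ⟩
  ⟨,⟩-comm u v = sum-cong-≋ λ k → *-comm (u k) (v k)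

  ⟨combination,⟩ : ∀ {d n} (t : Vector Carrier n) (X : Vector (Point d) n) (u : Point d) →
                   ⟨ combination t X , u ⟩ ≈ sum (λ i → t i * ⟨ X i , u ⟩)
  ⟨combination,⟩ t X u = begin
    sum (λ k → sum (λ i → t i * X i k) * u k)      ≈⟨ sum-cong-≋ (λ k → *-distribʳ-sum (u k) (λ i → t i * X i k)) ⟩
    sum (λ k → sum (λ i → t i * X i k * u k))      ≈⟨ ∑-comm (λ k i → t i * X i k * u k) ⟩
    sum (λ i → sum (λ k → t i * X i k * u k))      ≈⟨ sum-cong-≋ (λ i → sum-cong-≋ λ k → *-assoc (t i) (X i k) (u k)) ⟩
    sum (λ i → sum (λ k → t i * (X i k * u k)))    ≈⟨ sum-cong-≋ (λ i → *-distribˡ-sum (t i) (λ k → X i k * u k)) ⟨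
    sum (λ i → t i * ⟨ X i , u ⟩)                  ∎
    where open ≈-Reasoning

  -- The vectors `Y j` are fixed before the right-hand side `b`. This uniformity turns them into a
  -- finite list of candidate dual solutions, among which a best one is found by comparison.
  FeasibilityCertificates : ∀ {d m} → (Fin m → Point d) → Set
  FeasibilityCertificates {m = m} a = ∃[ k ] Σ (Fin k → Vector Carrier m) λ Y →
    (∀ j i → 0# ≤ Y j i) × (∀ j c → combination (Y j) a c ≈ 0#) ×
    (∀ b → (∀ j → 0# ≤ ⟨ Y j , b ⟩) → ∃[ u ] ∀ i → ⟨ a i , u ⟩ ≤ b i)

  module _ {m} (c : Vector Carrier m) where

    -- Nonnegative combinations of the rows p and q in which the coefficients
    -- c of the variable to be eliminated cancel.
    eliminate : ∀ p q → Σ (Vector Carrier m) λ z → (∀ i → 0# ≤ z i) × ⟨ z , c ⟩ ≈ 0# ×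
      (c p ≈ 0# → ∀ b → ⟨ z , b ⟩ ≈ b p) ×
      (0# < c p → c q < 0# → ∀ b → ⟨ z , b ⟩ ≈ c p * b q - c q * b p)
    eliminate p q with em {c p ≈ 0#}
    ... | yes cp≈0 = unit p , unit-nonNeg p , trans (sum-unit-* p c) cp≈0 , (λ _ → sum-unit-* p) ,
                     λ 0<cp → ⊥-elim (>⇒≉ 0<cp cp≈0)
    ... | no cp≉0 with em {0# < c p × c q < 0#}
    -- A pair with nothing to eliminate gets the zero row, so that the new system can be indexed by
    -- all pairs.
    ...   | no ¬pq = (λ _ → 0#) , (λ _ → ≤-refl) , sum-zero (λ i → zeroˡ (c i)) ,
                     (λ cp≈0 → ⊥-elim (cp≉0 cp≈0)) , λ 0<cp cq<0 → ⊥-elim (¬pq (0<cp , cq<0))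
    ...   | yes (0<cp , cq<0) = z , z-nonNeg , trans (⟨z,⟩ c) cancel , (λ cp≈0 → ⊥-elim (cp≉0 cp≈0)) , λ _ _ → ⟨z,⟩
      where
      z : Vector Carrier m
      z i = c p * unit q i - c q * unit p i
      z-nonNeg : ∀ i → 0# ≤ z i
      z-nonNeg i = ≤-congʳ (solve 4 (λ x y u v → x :* u :+ (:- y) :* v := x :* u :- y :* v) refl (c p) (c q) (unit q i) (unit p i))
        (+-nonNeg (*-nonNeg (proj₁ 0<cp) (unit-nonNeg q i))
                  (*-nonNeg (x≤0⇒0≤-x (proj₁ cq<0)) (unit-nonNeg p i)))
      ⟨z,⟩ : ∀ b → ⟨ z , b ⟩ ≈ c p * b q - c q * b p
      ⟨z,⟩ b = begin
        sum (λ i → (c p * unit q i - c q * unit p i) * b i)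
          ≈⟨ sum-cong-≋ (λ i → solve 5 (λ x y u v b → (x :* u :- y :* v) :* b := x :* (u :* b) :- y :* (v :* b)) refl (c p) (c q) (unit q i) (unit p i) (b i)) ⟩
        sum (λ i → c p * (unit q i * b i) - c q * (unit p i * b i))
          ≈⟨ sum-sub (λ i → c p * (unit q i * b i)) (λ i → c q * (unit p i * b i)) ⟩
        sum (λ i → c p * (unit q i * b i)) - sum (λ i → c q * (unit p i * b i))
          ≈⟨ +-cong (*-distribˡ-sum (c p) (λ i → unit q i * b i)) (-‿cong (*-distribˡ-sum (c q) (λ i → unit p i * b i))) ⟨
        c p * ⟨ unit q , b ⟩ - c q * ⟨ unit p , b ⟩
          ≈⟨ +-cong (*-congˡ (sum-unit-* q b)) (-‿cong (*-congˡ (sum-unit-* p b))) ⟩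
        c p * b q - c q * b p ∎
        where open ≈-Reasoning
      cancel : c p * c q - c q * c p ≈ 0#
      cancel = solve 2 (λ x y → x :* y :- y :* x := :0) refl (c p) (c q)

  -- Total, with default 0, so that quotients can be defined for all rows before their coefficients
  -- are known to be nonzero.
  pseudoInverse : ∀ x → ∃[ y ] (¬ x ≈ 0# → x * y ≈ 1#)
  pseudoInverse x with em {x ≈ 0#}
  ... | yes x≈0 = 0# , λ x≉0 → ⊥-elim (x≉0 x≈0)
  ... | no  x≉0 = proj₁ (inverse x x≉0) , λ _ → proj₂ (inverse x x≉0)

  -- A row with negative coefficient bounds x from below by `L i`, one with positive coefficient
  -- bounds it from above. The largest lower bound is a solution if there is one, else the smallest
  -- upper bound, else 0.
  solve-one-variable : ∀ {m} (c r : Vector Carrier m) →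
    (∀ i → c i ≈ 0# → 0# ≤ r i) →
    (∀ p q → 0# < c p → c q < 0# → 0# ≤ c p * r q - c q * r p) →
    ∃[ x ] ∀ i → c i * x ≤ r i
  solve-one-variable {m} c r zeros pairs = bound (argmax (λ i → c i < 0#) L) (argmax (λ i → 0# < c i) (λ i → - L i))
    where
    L : Vector Carrier m
    L i = r i * proj₁ (pseudoInverse (c i))
    cL : ∀ i → ¬ c i ≈ 0# → c i * L i ≈ r i
    cL i ci≉0 = begin
      c i * (r i * y)   ≈⟨ solve 3 (λ c r y → c :* (r :* y) := r :* (c :* y)) refl (c i) (r i) y ⟩
      r i * (c i * y)   ≈⟨ *-congˡ (proj₂ (pseudoInverse (c i)) ci≉0) ⟩
      r i * 1#          ≈⟨ *-identityʳ (r i) ⟩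
      r i               ∎
      where open ≈-Reasoning
            y = proj₁ (pseudoInverse (c i))
    zero-case : ∀ i x → c i ≈ 0# → c i * x ≤ r i
    zero-case i x ci≈0 = ≤-congˡ (sym (trans (*-congʳ ci≈0) (zeroˡ x))) (zeros i ci≈0)
    bound : (∀ i → ¬ c i < 0#) ⊎ (∃[ i ] c i < 0# × ∀ j → c j < 0# → L j ≤ L i) →
            (∀ i → ¬ 0# < c i) ⊎ (∃[ i ] 0# < c i × ∀ j → 0# < c j → - L j ≤ - L i) →
            ∃[ x ] ∀ i → c i * x ≤ r i
    bound (inj₂ (q , cq<0 , max)) _ = L q , check
      where
      check : ∀ i → c i * L q ≤ r i
      check i with em {c i ≈ 0#}
      ... | yes ci≈0 = zero-case i (L q) ci≈0
      ... | no ci≉0 with total (c i) 0#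
      ...   | inj₁ ci≤0 = ≤-congʳ (cL i ci≉0) (0≤y-x⇒x≤y
                (≤-congʳ (solve 3 (λ c x y → (:- c) :* (x :- y) := c :* y :- c :* x) refl (c i) (L q) (L i))
                  (*-nonNeg (x≤0⇒0≤-x ci≤0) (x≤y⇒0≤y-x (max i (ci≤0 , ci≉0))))))
      ...   | inj₂ 0≤ci = 0≤y-x⇒x≤y (*-cancelˡ-≤ {c = - c q} 0<-cq
                (≤-congˡ (sym (zeroʳ (- c q))) (≤-congʳ rearranged (pairs i q (0≤ci , λ 0≈ → ci≉0 (sym 0≈)) cq<0))))
        where
        0<-cq : 0# < - c q
        0<-cq = <-resp-≈ refl (+-identityˡ _) (x<y⇒0<y-x cq<0)
        rearranged : c i * r q - c q * r i ≈ - c q * (r i - c i * L q)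
        rearranged = trans (+-congʳ (*-congˡ (sym (cL q (proj₂ cq<0)))))
          (solve 4 (λ ci cq Lq ri → ci :* (cq :* Lq) :- cq :* ri := (:- cq) :* (ri :- ci :* Lq)) refl (c i) (c q) (L q) (r i))
    bound (inj₁ none) (inj₂ (q , 0<cq , min)) = L q , check
      where
      check : ∀ i → c i * L q ≤ r i
      check i with em {c i ≈ 0#}
      ... | yes ci≈0 = zero-case i (L q) ci≈0
      ... | no ci≉0 with total (c i) 0#
      ...   | inj₁ ci≤0 = ⊥-elim (none i (ci≤0 , ci≉0))
      ...   | inj₂ 0≤ci = ≤-congʳ (cL i ci≉0) (*-monoˡ-≤ 0≤ci (0≤y-x⇒x≤y
                (≤-congʳ (solve 2 (λ x y → :- x :- (:- y) := y :- x) refl (L q) (L i))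
                  (x≤y⇒0≤y-x (min i (0≤ci , λ 0≈ → ci≉0 (sym 0≈)))))))
    bound (inj₁ none) (inj₁ none′) = 0# , λ i → zero-case i 0# (antisym (≮⇒≥ (none′ i)) (≮⇒≥ (none i)))

  -- Induction on the dimension. The rows `z` eliminate the first coordinate, the recursion
  -- certifies the remaining system, and composing the two layers of weights certifies the original
  -- one.
  fourier-motzkin : ∀ {d m} (a : Fin m → Point d) → FeasibilityCertificates a
  -- In dimension 0 the system says 0 ≤ `b i`, which the unit vectors test.
  fourier-motzkin {zero}  {m} a = m , unit , unit-nonNeg , (λ _ ()) ,
    λ b 0≤ → (λ ()) , λ i → ≤-congʳ (sum-unit-* i b) (0≤ i)
  fourier-motzkin {suc d} {m} a = k , Y , Y-nonNeg , Y-kills , feasible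
    where
    c : Vector Carrier m
    c i = a i zero
    row : (pq : Fin (m ℕ.* m)) → _
    row pq = eliminate c (proj₁ (remQuot {m} m pq)) (proj₂ (remQuot {m} m pq))
    z : Fin (m ℕ.* m) → Vector Carrier m
    z pq = proj₁ (row pq)
    eliminate-combine : ∀ p q → z (combine p q) ≡ proj₁ (eliminate c p q)
    eliminate-combine p q = ≡.cong (λ pq → proj₁ (eliminate c (proj₁ pq) (proj₂ pq))) (Finₚ.remQuot-combine {m} {m} p q)
    a′ : Fin (m ℕ.* m) → Point d
    a′ pq = combination (z pq) (λ i → tail (a i))
    recursive = fourier-motzkin a′
    k = proj₁ recursive
    Y′ = proj₁ (proj₂ recursive)
    Y : Fin k → Vector Carrier m
    Y j = combination (Y′ j) z
    Y-nonNeg : ∀ j i → 0# ≤ Y j i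
    Y-nonNeg j i = sum-nonNeg λ pq → *-nonNeg (proj₁ (proj₂ (proj₂ recursive)) j pq)
      (proj₁ (proj₂ (row pq)) i)
    Y-kills : ∀ j x → combination (Y j) a x ≈ 0#
    Y-kills j zero = trans (⟨combination,⟩ (Y′ j) z c) (sum-zero λ pq → trans
      (*-congˡ (proj₁ (proj₂ (proj₂ (row pq))))) (zeroʳ (Y′ j pq)))
    Y-kills j (suc x) = trans (⟨combination,⟩ (Y′ j) z (λ i → a i (suc x))) (proj₁ (proj₂ (proj₂ (proj₂ recursive))) j x)
    feasible : ∀ b → (∀ j → 0# ≤ ⟨ Y j , b ⟩) → ∃[ u ] ∀ i → ⟨ a i , u ⟩ ≤ b i
    feasible b 0≤Yb = x ∷ u , λ i → 0≤y-x⇒x≤y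
        (≤-congʳ (solve 3 (λ b t y → b :- t :- y := b :- (y :+ t)) refl (b i) ⟨ tail (a i) , u ⟩ (c i * x))
          (x≤y⇒0≤y-x (proj₂ solution i)))
      where
      inner = proj₂ (proj₂ (proj₂ (proj₂ recursive))) (λ pq → ⟨ z pq , b ⟩)
        (λ j → ≤-congʳ (⟨combination,⟩ (Y′ j) z b) (0≤Yb j))
      u = proj₁ inner
      r : Vector Carrier m
      r i = b i - ⟨ tail (a i) , u ⟩
      0≤⟨z,r⟩ : ∀ p q → 0# ≤ ⟨ proj₁ (eliminate c p q) , r ⟩
      0≤⟨z,r⟩ p q = ≤-congʳ zr (x≤y⇒0≤y-x (≡.subst
        (λ y → ⟨ combination y (λ i → tail (a i)) , u ⟩ ≤ ⟨ y , b ⟩) (eliminate-combine p q) (proj₂ inner (combine p q))))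
        where
        y = proj₁ (eliminate c p q)
        zr : ⟨ y , b ⟩ - ⟨ combination y (λ i → tail (a i)) , u ⟩ ≈ ⟨ y , r ⟩
        zr = begin
          ⟨ y , b ⟩ - ⟨ combination y (λ i → tail (a i)) , u ⟩
            ≈⟨ +-congˡ (-‿cong (⟨combination,⟩ y (λ i → tail (a i)) u)) ⟩
          ⟨ y , b ⟩ - sum (λ i → y i * ⟨ tail (a i) , u ⟩)
            ≈⟨ sum-sub (λ i → y i * b i) (λ i → y i * ⟨ tail (a i) , u ⟩) ⟨
          sum (λ i → y i * b i - y i * ⟨ tail (a i) , u ⟩)
            ≈⟨ sum-cong-≋ (λ i → solve 3 (λ y b t → y :* b :- y :* t := y :* (b :- t)) refl (y i) (b i) ⟨ tail (a i) , u ⟩) ⟩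
          ⟨ y , r ⟩ ∎
          where open ≈-Reasoning
      solution = solve-one-variable c r
        (λ i ci≈0 → ≤-congʳ (proj₁ (proj₂ (proj₂ (proj₂ (eliminate c i i)))) ci≈0 r) (0≤⟨z,r⟩ i i))
        (λ p q 0<cp cq<0 → ≤-congʳ (proj₂ (proj₂ (proj₂ (proj₂ (eliminate c p q)))) 0<cp cq<0 r) (0≤⟨z,r⟩ p q))
      x = proj₁ solution

-- Kernels of underdetermined systems, Farkas' lemma, linear programming duality.

module LinearProgramming (ℝ : RealNumbers) (em : ExcludedMiddle 0ℓ) where
  open LinearInequalities ℝ em public

  ¬∀⇒∃ : ∀ {n} {P : Fin n → Set} → ¬ (∀ i → P i) → ∃[ i ] ¬ P i
  ¬∀⇒∃ {P = P} ¬∀ with em {∃[ i ] ¬ P i}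
  ... | yes ∃¬ = ∃¬
  ... | no ¬∃ = ⊥-elim (¬∀ λ i → decide i em)
    where
    decide : ∀ i → Dec (P i) → P i
    decide i (yes p) = p
    decide i (no ¬p) = ⊥-elim (¬∃ (i , ¬p))

  ⟨⟩-neg : ∀ {d} (w u : Point d) → ⟨ (λ c → - w c) , u ⟩ ≈ - ⟨ w , u ⟩
  ⟨⟩-neg w u = trans (sum-cong-≋ λ c → solve 2 (λ w u → (:- w) :* u := :- (w :* u)) refl (w c) (u c))
    (sum-neg (λ c → w c * u c))

  -- Gaussian elimination: a zero first row is dropped; otherwise a pivot column is removed from the
  -- other rows, and the first row determines the missing coordinate of the recursive solution.
  nontrivial-kernel : ∀ m {k} → m ℕ.< k → (A : Fin m → Point k) →
                      ∃[ v ] ¬ (∀ c → v c ≈ 0#) × ∀ r → ⟨ A r , v ⟩ ≈ 0#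
  nontrivial-kernel zero    {suc k} _ A = (λ _ → 1#) , (λ 1≈0 → 0≉1 (sym (1≈0 zero))) , λ ()
  nontrivial-kernel (suc m) {suc k} (s≤s m<k) A with em {∀ c → A zero c ≈ 0#}
  ... | yes A₀≈0 with nontrivial-kernel m (ℕₚ.m≤n⇒m≤1+n m<k) (A ∘ suc)
  ...   | v , v≉0 , Av≈0 = v , v≉0 ,
          λ { zero → sum-zero (λ c → trans (*-congʳ (A₀≈0 c)) (zeroˡ (v c))) ; (suc r) → Av≈0 r }
  nontrivial-kernel (suc m) {suc k} (s≤s m<k) A | no A₀≉0 with ¬∀⇒∃ A₀≉0
  ... | j , pivot≉0 = v , (λ v≈0 → v′≉0 λ l → trans (sym (v-punchIn l)) (v≈0 (punchIn j l))) , kernel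
    where
    p⁻¹ = proj₁ (inverse (A zero j) pivot≉0)
    reduced : Fin m → Point k
    reduced r l = A (suc r) (punchIn j l) - A (suc r) j * p⁻¹ * A zero (punchIn j l)
    recursive = nontrivial-kernel m m<k reduced
    v′ = proj₁ recursive
    v′≉0 = proj₁ (proj₂ recursive)
    rest : Fin (suc m) → Carrier
    rest r = sum (λ l → A r (punchIn j l) * v′ l)
    v : Point (suc k)
    v = insertAt v′ j (- (p⁻¹ * rest zero))
    v-punchIn : ∀ l → v (punchIn j l) ≈ v′ l
    v-punchIn l = reflexive (insertAt-punchIn v′ j _ l)
    split : ∀ r → ⟨ A r , v ⟩ ≈ A r j * - (p⁻¹ * rest zero) + rest r
    split r = trans (sum-remove {i = j} (λ c → A r c * v c))
      (+-cong (*-congˡ (reflexive (insertAt-lookup v′ j _))) (sum-cong-≋ λ l → *-congˡ (v-punchIn l)))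
    kernel : ∀ r → ⟨ A r , v ⟩ ≈ 0#
    kernel zero = begin
      ⟨ A zero , v ⟩                                      ≈⟨ split zero ⟩
      A zero j * - (p⁻¹ * rest zero) + rest zero
        ≈⟨ solve 3 (λ p q s → p :* (:- (q :* s)) :+ s := (:1 :- p :* q) :* s) refl (A zero j) p⁻¹ (rest zero) ⟩
      (1# - A zero j * p⁻¹) * rest zero                   ≈⟨ *-congʳ (x≈y⇒x-y≈0 (sym (proj₂ (inverse (A zero j) pivot≉0)))) ⟩
      0# * rest zero                                      ≈⟨ zeroˡ (rest zero) ⟩
      0#                                                  ∎
      where open ≈-Reasoning
    kernel (suc r) = begin
      ⟨ A (suc r) , v ⟩                                          ≈⟨ split (suc r) ⟩
      b * - (p⁻¹ * rest zero) + rest (suc r)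
        ≈⟨ solve 4 (λ b q s t → b :* (:- (q :* s)) :+ t := t :- b :* q :* s) refl b p⁻¹ (rest zero) (rest (suc r)) ⟩
      rest (suc r) - b * p⁻¹ * rest zero                         ≈⟨ +-congˡ (-‿cong (*-distribˡ-sum (b * p⁻¹) (λ l → A zero (punchIn j l) * v′ l))) ⟩
      rest (suc r) - sum (λ l → b * p⁻¹ * (A zero (punchIn j l) * v′ l))
        ≈⟨ sum-sub (λ l → A (suc r) (punchIn j l) * v′ l) (λ l → b * p⁻¹ * (A zero (punchIn j l) * v′ l)) ⟨
      sum (λ l → A (suc r) (punchIn j l) * v′ l - b * p⁻¹ * (A zero (punchIn j l) * v′ l))
        ≈⟨ sum-cong-≋ (λ l → solve 4 (λ x c y v → x :* v :- c :* (y :* v) := (x :- c :* y) :* v) refl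
             (A (suc r) (punchIn j l)) (b * p⁻¹) (A zero (punchIn j l)) (v′ l)) ⟩
      ⟨ reduced r , v′ ⟩                                         ≈⟨ proj₂ (proj₂ recursive) r ⟩
      0#                                                         ∎
      where open ≈-Reasoning
            b = A (suc r) j

  module _ {d m} (a : Fin m → Point d) where

    -- The extra row `- w` encodes a demand τ ≤ `⟨ w , u ⟩`. In a certificate, `α` is the weight of
    -- this row and `y` the weights of the constraints; if 0 < `α`, then `y` divided by `α` is a
    -- dual solution.
    module Objective (w : Point d) where

      certificates : FeasibilityCertificates ((λ c → - w c) ∷ a)
      certificates = fourier-motzkin ((λ c → - w c) ∷ a)

      Y = proj₁ (proj₂ certificates)

      α : Fin (proj₁ certificates) → Carrier
      α j = Y j zero

      y : Fin (proj₁ certificates) → Vector Carrier m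
      y j = tail (Y j)

      α-nonNeg : ∀ j → 0# ≤ α j
      α-nonNeg j = proj₁ (proj₂ (proj₂ certificates)) j zero

      y-nonNeg : ∀ j i → 0# ≤ y j i
      y-nonNeg j i = proj₁ (proj₂ (proj₂ certificates)) j (suc i)

      y-combination : ∀ j c → combination (y j) a c ≈ α j * w c
      y-combination j c = begin
        combination (y j) a c
          ≈⟨ solve 3 (λ s α w → s := (α :* (:- w) :+ s) :+ α :* w) refl (combination (y j) a c) (α j) (w c) ⟩
        (α j * - w c + combination (y j) a c) + α j * w c
          ≈⟨ +-congʳ (proj₁ (proj₂ (proj₂ (proj₂ certificates))) j c) ⟩
        0# + α j * w c   ≈⟨ +-identityˡ _ ⟩
        α j * w c        ∎
        where open ≈-Reasoning

      ⟨y,⟩ : ∀ j u → sum (λ i → y j i * ⟨ a i , u ⟩) ≈ α j * ⟨ w , u ⟩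
      ⟨y,⟩ j u = begin
        sum (λ i → y j i * ⟨ a i , u ⟩)    ≈⟨ ⟨combination,⟩ (y j) a u ⟨
        ⟨ combination (y j) a , u ⟩        ≈⟨ ⟨,⟩-congˡ (y-combination j) ⟩
        sum (λ c → α j * w c * u c)        ≈⟨ sum-cong-≋ (λ c → *-assoc (α j) (w c) (u c)) ⟩
        sum (λ c → α j * (w c * u c))      ≈⟨ *-distribˡ-sum (α j) (λ c → w c * u c) ⟨
        α j * ⟨ w , u ⟩                    ∎
        where open ≈-Reasoning

      feasible : ∀ b τ → (∀ j → α j * τ ≤ ⟨ y j , b ⟩) → ∃[ u ] τ ≤ ⟨ w , u ⟩ × ∀ i → ⟨ a i , u ⟩ ≤ b i
      feasible b τ ατ≤ with proj₂ (proj₂ (proj₂ (proj₂ certificates))) ((- τ) ∷ b) (λ j →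
        ≤-congʳ (solve 3 (λ α τ s → s :- α :* τ := α :* (:- τ) :+ s) refl (α j) τ ⟨ y j , b ⟩) (x≤y⇒0≤y-x (ατ≤ j)))
      ... | u , au≤ = u , 0≤y-x⇒x≤y (≤-congʳ (solve 2 (λ w τ → :- τ :- (:- w) := w :- τ) refl ⟨ w , u ⟩ τ)
                            (x≤y⇒0≤y-x (≤-congˡ (⟨⟩-neg w u) (au≤ zero)))) , au≤ ∘ suc

    module Normalised (w : Point d) (j : Fin (proj₁ (Objective.certificates w))) (0<α : 0# < Objective.α w j) where
      open Objective w

      α⁻¹ : Carrier
      α⁻¹ = proj₁ (posInverse 0<α)

      0≤α⁻¹ : 0# ≤ α⁻¹
      0≤α⁻¹ = proj₁ (proj₁ (proj₂ (posInverse 0<α)))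

      ν : Vector Carrier m
      ν i = α⁻¹ * y j i

      ν-nonNeg : ∀ i → 0# ≤ ν i
      ν-nonNeg i = *-nonNeg 0≤α⁻¹ (y-nonNeg j i)

      ν-combination : ∀ c → combination ν a c ≈ w c
      ν-combination c = begin
        sum (λ i → α⁻¹ * y j i * a i c)     ≈⟨ sum-cong-≋ (λ i → *-assoc α⁻¹ (y j i) (a i c)) ⟩
        sum (λ i → α⁻¹ * (y j i * a i c))   ≈⟨ *-distribˡ-sum α⁻¹ (λ i → y j i * a i c) ⟨
        α⁻¹ * combination (y j) a c         ≈⟨ *-congˡ (y-combination j c) ⟩
        α⁻¹ * (α j * w c)                   ≈⟨ solve 3 (λ x y z → x :* (y :* z) := (y :* x) :* z) refl α⁻¹ (α j) (w c) ⟩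
        α j * α⁻¹ * w c                     ≈⟨ *-congʳ (proj₂ (proj₂ (posInverse 0<α))) ⟩
        1# * w c                            ≈⟨ *-identityˡ (w c) ⟩
        w c                                 ∎
        where open ≈-Reasoning

    -- The demand 1 is made on the objective with right-hand side 0. Either all certificates permit
    -- it, or a violated one has 0 < `α` and its normalisation represents `w`.
    farkas : ∀ w → (∃[ u ] 0# < ⟨ w , u ⟩ × ∀ i → ⟨ a i , u ⟩ ≤ 0#) ⊎
                   (∃[ ρ ] (∀ i → 0# ≤ ρ i) × ∀ c → combination ρ a c ≈ w c)
    farkas w = decide em
      where
      open Objective w
      Alternatives : Set
      Alternatives = (∃[ u ] 0# < ⟨ w , u ⟩ × ∀ i → ⟨ a i , u ⟩ ≤ 0#) ⊎
                     (∃[ ρ ] (∀ i → 0# ≤ ρ i) × ∀ c → combination ρ a c ≈ w c)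
      certified : ∀ j → ¬ α j * 1# ≤ ⟨ y j , (λ _ → 0#) ⟩ → Alternatives
      certified j ¬αj≤ = inj₂ (ν , ν-nonNeg , ν-combination)
        where
        open Normalised w j (<-resp-≈ (sum-zero (λ i → zeroʳ (y j i))) (*-identityʳ (α j)) (≰⇒> ¬αj≤))
      decide : Dec (∀ j → α j * 1# ≤ ⟨ y j , (λ _ → 0#) ⟩) → Alternatives
      decide (yes α≤) = inj₁ (proj₁ feasible-u , <-≤-trans 0<1 (proj₁ (proj₂ feasible-u)) , proj₂ (proj₂ feasible-u))
        where feasible-u = feasible (λ _ → 0#) 1# α≤
      decide (no ¬α≤) = certified (proj₁ (¬∀⇒∃ ¬α≤)) (proj₂ (¬∀⇒∃ ¬α≤))

    -- The primal problem is to maximise ⟨ combination μ a , u ⟩ subject to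
    -- ⟨ a i , u ⟩ ≤ b i; the nonnegative vector μ is a dual feasible point.
    complementary-slackness : ∀ b μ (u₀ : Point d) → (∀ i → 0# ≤ μ i) → (∀ i → ⟨ a i , u₀ ⟩ ≤ b i) →
      ∃[ u ] ∃[ ν ] (∀ i → ⟨ a i , u ⟩ ≤ b i) × (∀ i → 0# ≤ ν i) ×
        (∀ c → combination ν a c ≈ combination μ a c) × (∀ i → 0# < ν i → ⟨ a i , u ⟩ ≈ b i)
    complementary-slackness b μ u₀ 0≤μ au₀≤b = optimum (argmax (λ j → 0# < α j) (λ j → - value j))
      where
      w : Point d
      w = combination μ a
      open Objective w
      Optimum = ∃[ u ] ∃[ ν ] (∀ i → ⟨ a i , u ⟩ ≤ b i) × (∀ i → 0# ≤ ν i) ×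
        (∀ c → combination ν a c ≈ combination μ a c) × (∀ i → 0# < ν i → ⟨ a i , u ⟩ ≈ b i)
      -- The upper bound that certificate `j` puts on the objective. The optimum is the least of
      -- these over 0 < `α j`.
      value : Fin _ → Carrier
      value j = proj₁ (pseudoInverse (α j)) * ⟨ y j , b ⟩
      α*value : ∀ j → 0# < α j → α j * value j ≈ ⟨ y j , b ⟩
      α*value j 0<α = trans (sym (*-assoc _ _ _))
        (trans (*-congʳ (proj₂ (pseudoInverse (α j)) (>⇒≉ 0<α))) (*-identityˡ _))
      -- A certificate of weight 0 on the objective concerns the constraints alone, and `u₀`
      -- satisfies them.
      α≈0-bound : ∀ j τ → ¬ 0# < α j → α j * τ ≤ ⟨ y j , b ⟩
      α≈0-bound j τ ¬0<α = ≤-congˡ (trans (⟨y,⟩ j u₀) (trans (trans (*-congʳ α≈0) (zeroˡ ⟨ w , u₀ ⟩)) (sym (trans (*-congʳ α≈0) (zeroˡ τ)))))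
        (sum-mono-≤ λ i → *-monoˡ-≤ (y-nonNeg j i) (au₀≤b i))
        where
        α≈0 : α j ≈ 0#
        α≈0 = antisym (≮⇒≥ ¬0<α) (α-nonNeg j)
      optimum : (∀ j → ¬ 0# < α j) ⊎ (∃[ j ] 0# < α j × ∀ k → 0# < α k → - value k ≤ - value j) → Optimum
      -- With no such certificate every demand could be met, even one that exceeds the bound
      -- `⟨ μ , b ⟩` of weak duality by 1.
      optimum (inj₁ none) = contra (feasible b (⟨ μ , b ⟩ + 1#) (λ j → α≈0-bound j (⟨ μ , b ⟩ + 1#) (none j)))
        where
        contra : (∃[ u ] ⟨ μ , b ⟩ + 1# ≤ ⟨ w , u ⟩ × ∀ i → ⟨ a i , u ⟩ ≤ b i) → Optimum
        contra (u , τ≤wu , au≤b) = ⊥-elim (<⇒≱ 0<1 (0≤y-x⇒x≤y (≤-congʳ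
          (solve 1 (λ x → x :- (x :+ :1) := :0 :- :1) refl ⟨ μ , b ⟩) (x≤y⇒0≤y-x
          (≤-trans τ≤wu (≤-congˡ (sym (⟨combination,⟩ μ a u)) (sum-mono-≤ λ i → *-monoˡ-≤ (0≤μ i) (au≤b i))))))))
      optimum (inj₂ (j , 0<α , min)) = conclude (feasible b (value j) bound)
        where
        bound : ∀ k → α k * value j ≤ ⟨ y k , b ⟩
        bound k with em {0# < α k}
        ... | no ¬0<α = α≈0-bound k (value j) ¬0<α
        ... | yes 0<αk = ≤-congʳ (α*value k 0<αk) (*-monoˡ-≤ (α-nonNeg k) (0≤y-x⇒x≤y
                (≤-congʳ (solve 2 (λ x y → :- x :- (:- y) := y :- x) refl (value j) (value k)) (x≤y⇒0≤y-x (min k 0<αk)))))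
        conclude : (∃[ u ] value j ≤ ⟨ w , u ⟩ × ∀ i → ⟨ a i , u ⟩ ≤ b i) → Optimum
        conclude (u , value≤wu , au≤b) = u , ν , au≤b , ν-nonNeg , ν-combination , tight
          where
          open Normalised w j 0<α
          slack : Vector Carrier m
          slack i = y j i * (b i - ⟨ a i , u ⟩)
          -- The total slack is `α j` times the dual value minus the primal value. As no term is
          -- negative, each of them vanishes, which gives `tight`.
          slack-sum : sum slack ≤ 0#
          slack-sum = ≤-congˡ (sym (begin
            sum slack                                            ≈⟨ sum-cong-≋ (λ i → solve 3 (λ y b t → y :* (b :- t) := y :* b :- y :* t) refl (y j i) (b i) ⟨ a i , u ⟩) ⟩
            sum (λ i → y j i * b i - y j i * ⟨ a i , u ⟩)        ≈⟨ sum-sub (λ i → y j i * b i) (λ i → y j i * ⟨ a i , u ⟩) ⟩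
            ⟨ y j , b ⟩ - sum (λ i → y j i * ⟨ a i , u ⟩)        ≈⟨ +-cong (sym (α*value j 0<α)) (-‿cong (⟨y,⟩ j u)) ⟩
            α j * value j - α j * ⟨ w , u ⟩                      ≈⟨ solve 3 (λ α v w → α :* v :- α :* w := α :* (v :- w)) refl (α j) (value j) ⟨ w , u ⟩ ⟩
            α j * (value j - ⟨ w , u ⟩)                          ∎))
            (*-nonPos (α-nonNeg j) (≤-congʳ (-‿inverseʳ ⟨ w , u ⟩) (+-monoˡ-≤ (- ⟨ w , u ⟩) value≤wu)))
            where open ≈-Reasoning
          tight : ∀ i → 0# < ν i → ⟨ a i , u ⟩ ≈ b i
          tight i 0<νi = sym (x-y≈0⇒x≈y (*-cancel-0 (>⇒≉ (*-cancel-pos 0≤α⁻¹ 0<νi))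
            (sum-nonNeg-≤0 (λ k → *-nonNeg (y-nonNeg j k) (x≤y⇒0≤y-x (au≤b k))) slack-sum i)))

-- Linear functionals on convex hulls, supporting directions, antipodal pairs.

module ConvexGeometry (ℝ : RealNumbers) (em : ExcludedMiddle 0ℓ) where
  open LinearProgramming ℝ em public

  -- Complementary slackness gives information only at indices of positive weight; this is the
  -- matching form of positivity.
  weighted-nonNeg : ∀ {n} {ν x : Vector Carrier n} → (∀ i → 0# ≤ ν i) → (∀ i → 0# < ν i → 0# ≤ x i) →
                    0# ≤ sum (λ i → ν i * x i)
  weighted-nonNeg {ν = ν} {x} 0≤ν 0≤x = sum-nonNeg λ i → term i em
    where
    term : ∀ i → Dec (0# < ν i) → 0# ≤ ν i * x i
    term i (yes 0<νi) = *-nonNeg (0≤ν i) (0≤x i 0<νi)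
    term i (no ¬0<νi) = ≤-reflexive (sym (trans (*-congʳ (antisym (≮⇒≥ ¬0<νi) (0≤ν i))) (zeroˡ (x i))))

  -- A property of functions rather than a coordinate vector, so that an identity between points can
  -- be paired both with `⟨ u ,_⟩` and with `ω Z`.
  record Linear {d} (φ : Point d → Carrier) : Set where
    field
      φ-cong : ∀ {x y} → (∀ k → x k ≈ y k) → φ x ≈ φ y
      φ-+    : ∀ x y → φ (λ k → x k + y k) ≈ φ x + φ y
      φ-*    : ∀ c x → φ (λ k → c * x k) ≈ c * φ x

    φ-0 : φ (λ _ → 0#) ≈ 0#
    φ-0 = trans (φ-cong λ _ → sym (zeroˡ 0#)) (trans (φ-* 0# (λ _ → 0#)) (zeroˡ _))

    φ-sub : ∀ x y → φ (λ k → x k - y k) ≈ φ x - φ y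
    φ-sub x y = trans (φ-cong λ k → solve 2 (λ x y → x :- y := x :+ (:- :1) :* y) refl (x k) (y k))
      (trans (φ-+ x (λ k → - 1# * y k)) (trans (+-congˡ (φ-* (- 1#) y))
        (solve 2 (λ x y → x :+ (:- :1) :* y := x :- y) refl (φ x) (φ y))))

    φ-combination : ∀ {n} (t : Vector Carrier n) (X : Vector (Point d) n) →
                    φ (combination t X) ≈ sum (λ i → t i * φ (X i))
    φ-combination {zero}  t X = φ-0
    φ-combination {suc n} t X = trans (φ-+ (λ k → t zero * X zero k) (combination (tail t) (tail X)))
      (+-cong (φ-* (t zero) (X zero)) (φ-combination (tail t) (tail X)))

  open Linear public

  ⟨_,⟩-linear : ∀ {d} (u : Point d) → Linear ⟨ u ,_⟩
  ⟨ u ,⟩-linear = record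
    { φ-cong = ⟨,⟩-congʳ
    ; φ-+    = λ x y → trans (sum-cong-≋ λ k → distribˡ (u k) (x k) (y k)) (∑-distrib-+ (λ k → u k * x k) (λ k → u k * y k))
    ; φ-*    = λ c x → trans (sum-cong-≋ λ k → solve 3 (λ u c x → u :* (c :* x) := c :* (u :* x)) refl (u k) c (x k))
                             (sym (*-distribˡ-sum c (λ k → u k * x k)))
    }

  IsZero : ∀ {d} → Point d → Set
  IsZero u = ∀ k → u k ≈ 0#

  module _ {d n} {X : Vector (Point d) n} where

    ∈conv : ∀ i → conv X (X i)
    ∈conv i = unit i , unit-nonNeg i , sum-unit i , λ k → sum-unit-* i (λ j → X j k)

    conv-bound : ∀ {φ κ} → Linear φ → (∀ i → φ (X i) ≤ κ) → ∀ y → conv X y → φ y ≤ κ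
    conv-bound {φ} {κ} lin ≤κ y (t , 0≤t , sum≈1 , t≋y) = ≤-congˡ (trans (sym (φ-combination lin t X)) (φ-cong lin t≋y))
      (≤-congʳ (trans (sym (*-distribʳ-sum κ t)) (trans (*-congʳ sum≈1) (*-identityˡ κ)))
        (sum-mono-≤ λ i → *-monoˡ-≤ (0≤t i) (≤κ i)))

    conv-bound′ : ∀ {φ κ} → Linear φ → (∀ i → κ ≤ φ (X i)) → ∀ y → conv X y → κ ≤ φ y
    conv-bound′ {φ} {κ} lin κ≤ y (t , 0≤t , sum≈1 , t≋y) = ≤-congʳ (trans (sym (φ-combination lin t X)) (φ-cong lin t≋y))
      (≤-congˡ (trans (sym (*-distribʳ-sum κ t)) (trans (*-congʳ sum≈1) (*-identityˡ κ)))
        (sum-mono-≤ λ i → *-monoˡ-≤ (0≤t i) (κ≤ i)))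

    module _ (spanning : AffinelySpanning X) where

      constant⇒zero : ∀ {φ κ} → Linear φ → (∀ i → φ (X i) ≈ κ) → ∀ y → φ y ≈ 0#
      constant⇒zero {φ} {κ} lin φX≈κ y = trans (φ≈κ y) (trans (sym (φ≈κ (λ _ → 0#))) (φ-0 lin))
        where
        φ≈κ : ∀ y → φ y ≈ κ
        φ≈κ y with spanning y
        ... | t , sum≈1 , t≋y = begin
          φ y                          ≈⟨ φ-cong lin t≋y ⟨
          φ (combination t X)          ≈⟨ φ-combination lin t X ⟩
          sum (λ i → t i * φ (X i))    ≈⟨ sum-cong-≋ (λ i → *-congˡ (φX≈κ i)) ⟩
          sum (λ i → t i * κ)          ≈⟨ *-distribʳ-sum κ t ⟨
          sum t * κ                    ≈⟨ *-congʳ sum≈1 ⟩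
          1# * κ                       ≈⟨ *-identityˡ κ ⟩
          κ                            ∎
          where open ≈-Reasoning

      constant-direction⇒zero : ∀ {u κ} → (∀ i → ⟨ u , X i ⟩ ≈ κ) → IsZero u
      constant-direction⇒zero {u} uX≈κ k = trans (sym (sum-unit-* k u))
        (trans (⟨,⟩-comm (unit k) u) (constant⇒zero ⟨ u ,⟩-linear uX≈κ (unit k)))

      -- Both hyperplanes get the normal `u`. Were they equal, `u` would be constant on `X`, which
      -- is impossible for a nonzero `u` when `X` spans.
      antipodal-in-direction : ∀ {u} → ¬ IsZero u → ∀ {i j} →
        (∀ k → ⟨ u , X k ⟩ ≤ ⟨ u , X i ⟩) → (∀ k → ⟨ u , X j ⟩ ≤ ⟨ u , X k ⟩) → Antipodal X i j
      antipodal-in-direction {u} u≉0 {i} {j} ≤i j≤ =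
        (λ Xi≋Xj → ui≉uj (⟨,⟩-congʳ Xi≋Xj)) ,
        record { normal = u ; offset = ⟨ u , X i ⟩ ; normal≉0 = u≉0 } ,
        record { normal = u ; offset = ⟨ u , X j ⟩ ; normal≉0 = u≉0 } ,
        (λ same → ui≉uj (Equivalence.to (same (X i)) refl)) ,
        (1# , λ k → sym (*-identityˡ (u k))) ,
        ((X i , ∈conv i , refl) , inj₁ (conv-bound ⟨ u ,⟩-linear ≤i)) ,
        ((X j , ∈conv j , refl) , inj₂ (conv-bound′ ⟨ u ,⟩-linear j≤)) ,
        refl , refl
        where
        ui≉uj : ¬ ⟨ u , X i ⟩ ≈ ⟨ u , X j ⟩
        ui≉uj ui≈uj = u≉0 (constant-direction⇒zero λ k →
          antisym (≤i k) (≤-congˡ (sym ui≈uj) (j≤ k)))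

  -- Balls are given by squared distances; this extracts bounds on coordinates without square roots.
  square-bound : ∀ {x ε} → 0# ≤ ε → x * x ≤ ε * ε → x ≤ ε
  square-bound {x} {ε} 0≤ε x²≤ε² = ≮⇒≥ λ ε<x → <⇒≱
    (*-pos (x<y⇒0<y-x ε<x) (<-resp-≈ refl (+-comm x ε) (+-pos-nonNeg (≤-<-trans 0≤ε ε<x) 0≤ε)))
    (≤-congˡ (solve 2 (λ x ε → x :* x :- ε :* ε := (x :- ε) :* (ε :+ x)) refl x ε)
      (≤-congʳ (-‿inverseʳ (ε * ε)) (+-monoˡ-≤ (- (ε * ε)) x²≤ε²)))

  -- The remaining weight `1# - sum θ` goes to `X p`, whose displacement is zero.
  displacement∈conv : ∀ {d n} (X : Vector (Point d) n) p θ y → (∀ i → 0# ≤ θ i) → sum θ ≤ 1# →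
                      (∀ c → combination θ (λ i k → X i k - X p k) c ≈ y c - X p c) → conv X y
  displacement∈conv {d} {n} X p θ y θ-nonNeg θ-sum θ-combination = t , t-nonNeg , t-sum , t-combination
    where
    t : Vector Carrier n
    t i = θ i + (1# - sum θ) * unit p i
    t-nonNeg : ∀ i → 0# ≤ t i
    t-nonNeg i = +-nonNeg (θ-nonNeg i) (*-nonNeg (x≤y⇒0≤y-x θ-sum) (unit-nonNeg p i))
    t-sum : sum t ≈ 1#
    t-sum = begin
      sum t                                               ≈⟨ ∑-distrib-+ θ (λ i → (1# - sum θ) * unit p i) ⟩
      sum θ + sum (λ i → (1# - sum θ) * unit p i)         ≈⟨ +-congˡ (*-distribˡ-sum (1# - sum θ) (unit p)) ⟨
      sum θ + (1# - sum θ) * sum (unit p)                 ≈⟨ +-congˡ (*-congˡ (sum-unit p)) ⟩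
      sum θ + (1# - sum θ) * 1#                           ≈⟨ solve 1 (λ s → s :+ (:1 :- s) :* :1 := :1) refl (sum θ) ⟩
      1#                                                  ∎
      where open ≈-Reasoning
    t-combination : ∀ c → combination t X c ≈ y c
    t-combination c = begin
      sum (λ i → t i * X i c)
        ≈⟨ sum-cong-≋ (λ i → solve 5 (λ θ s e x p → (θ :+ (:1 :- s) :* e) :* x := (θ :* (x :- p) :+ p :* θ) :+ (:1 :- s) :* (e :* x)) refl
             (θ i) (sum θ) (unit p i) (X i c) (X p c)) ⟩
      sum (λ i → (θ i * (X i c - X p c) + X p c * θ i) + (1# - sum θ) * (unit p i * X i c))
        ≈⟨ ∑-distrib-+ (λ i → θ i * (X i c - X p c) + X p c * θ i) (λ i → (1# - sum θ) * (unit p i * X i c)) ⟩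
      sum (λ i → θ i * (X i c - X p c) + X p c * θ i) + sum (λ i → (1# - sum θ) * (unit p i * X i c))
        ≈⟨ +-cong (∑-distrib-+ (λ i → θ i * (X i c - X p c)) (λ i → X p c * θ i)) (sym (*-distribˡ-sum (1# - sum θ) (λ i → unit p i * X i c))) ⟩
      (combination θ (λ i k → X i k - X p k) c + sum (λ i → X p c * θ i)) + (1# - sum θ) * sum (λ i → unit p i * X i c)
        ≈⟨ +-cong (+-cong (θ-combination c) (sym (*-distribˡ-sum (X p c) θ))) (*-congˡ (sum-unit-* p (λ i → X i c))) ⟩
      ((y c - X p c) + X p c * sum θ) + (1# - sum θ) * X p c
        ≈⟨ solve 3 (λ x y s → ((y :- x) :+ x :* s) :+ (:1 :- s) :* x := y) refl (X p c) (y c) (sum θ) ⟩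
      y c ∎
      where open ≈-Reasoning

  -- If no hyperplane supports at X p, then by Farkas the directions X i - X p
  -- generate every ± unit vector as a cone, so X p is an interior point.
  boundary⇒support : ∀ {d n} (X : Vector (Point d) n) p → bd (conv X) (X p) →
                     ∃[ u ] ¬ IsZero u × ∀ i → ⟨ u , X i ⟩ ≤ ⟨ u , X p ⟩
  boundary⇒support {d} {n} X p p∈bd = decide em
    where
    D : Fin n → Point d
    D i k = X i k - X p k
    Generated : Point d → Set
    Generated w = ∃[ ρ ] (∀ i → 0# ≤ ρ i) × ∀ c → combination ρ D c ≈ w c
    Supported : Set
    Supported = ∃[ u ] ¬ IsZero u × ∀ i → ⟨ u , X i ⟩ ≤ ⟨ u , X p ⟩
    module _ (unsupported : ¬ Supported) where
      generates : ∀ w → Generated w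
      generates w = fromAlternatives (farkas D w)
        where
        fromAlternatives : (∃[ u ] 0# < ⟨ w , u ⟩ × ∀ i → ⟨ D i , u ⟩ ≤ 0#) ⊎ Generated w → Generated w
        fromAlternatives (inj₂ ρ) = ρ
        fromAlternatives (inj₁ (u , 0<wu , au≤0)) = ⊥-elim (unsupported (u ,
          (λ u≈0 → >⇒≉ 0<wu (sum-zero λ k → trans (*-congˡ (u≈0 k)) (zeroʳ (w k)))) ,
          λ i → 0≤y-x⇒x≤y (≤-congʳ (begin
            - ⟨ D i , u ⟩                         ≈⟨ -‿cong (trans (⟨,⟩-comm (D i) u) (φ-sub ⟨ u ,⟩-linear (X i) (X p))) ⟩
            - (⟨ u , X i ⟩ - ⟨ u , X p ⟩)         ≈⟨ solve 2 (λ x y → :- (x :- y) := y :- x) refl ⟨ u , X i ⟩ ⟨ u , X p ⟩ ⟩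
            ⟨ u , X p ⟩ - ⟨ u , X i ⟩             ∎) (x≤0⇒0≤-x (au≤0 i)))))
          where open ≈-Reasoning
      ρ⁺ ρ⁻ : Fin d → Vector Carrier n
      ρ⁺ k = proj₁ (generates (unit k))
      ρ⁻ k = proj₁ (generates (λ c → - unit k c))
      R : Vector Carrier d
      R k = sum (ρ⁺ k) + sum (ρ⁻ k)
      R-nonNeg⁺ : ∀ k → 0# ≤ sum (ρ⁺ k)
      R-nonNeg⁺ k = sum-nonNeg (proj₁ (proj₂ (generates (unit k))))
      R-nonNeg⁻ : ∀ k → 0# ≤ sum (ρ⁻ k)
      R-nonNeg⁻ k = sum-nonNeg (proj₁ (proj₂ (generates (λ c → - unit k c))))
      -- `ε` is the reciprocal of 1 plus the total weight of all the generating combinations, so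
      -- moving by at most `ε` along every axis costs total weight at most 1.
      inv = posInverse (+-pos-nonNeg 0<1 (sum-nonNeg λ k → +-nonNeg (R-nonNeg⁺ k) (R-nonNeg⁻ k)))
      ε = proj₁ inv
      0<ε : 0# < ε
      0<ε = proj₁ (proj₂ inv)

      scaled : ∀ δ (ρ : Vector Carrier n) c → combination (λ i → δ * ρ i) D c ≈ δ * combination ρ D c
      scaled δ ρ c = trans (sum-cong-≋ λ i → *-assoc δ (ρ i) (D i c)) (sym (*-distribˡ-sum δ (λ i → ρ i * D i c)))

      Axis : Fin d → Carrier → Set
      Axis k δ = ∃[ σ ] (∀ i → 0# ≤ σ i) × sum σ ≤ ε * R k × ∀ c → combination σ D c ≈ δ * unit k c

      axis : ∀ k δ → δ * δ ≤ ε * ε → Axis k δ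
      axis k δ δ²≤ε² = cases (total 0# δ)
        where
        δ≤ε : δ ≤ ε
        δ≤ε = square-bound (proj₁ 0<ε) δ²≤ε²
        -δ≤ε : - δ ≤ ε
        -δ≤ε = square-bound (proj₁ 0<ε) (≤-congˡ (solve 1 (λ x → x :* x := (:- x) :* (:- x)) refl δ) δ²≤ε²)
        cases : 0# ≤ δ ⊎ δ ≤ 0# → Axis k δ
        cases (inj₁ 0≤δ) = (λ i → δ * ρ⁺ k i) ,
          (λ i → *-nonNeg 0≤δ (proj₁ (proj₂ (generates (unit k))) i)) ,
          ≤-congˡ (*-distribˡ-sum δ (ρ⁺ k)) (0≤y-x⇒x≤y (≤-congʳ
            (solve 4 (λ δ ε r s → (ε :- δ) :* r :+ ε :* s := ε :* (r :+ s) :- δ :* r) refl δ ε (sum (ρ⁺ k)) (sum (ρ⁻ k)))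
            (+-nonNeg (*-nonNeg (x≤y⇒0≤y-x δ≤ε) (R-nonNeg⁺ k)) (*-nonNeg (proj₁ 0<ε) (R-nonNeg⁻ k))))) ,
          λ c → trans (scaled δ (ρ⁺ k) c) (*-congˡ (proj₂ (proj₂ (generates (unit k))) c))
        cases (inj₂ δ≤0) = (λ i → - δ * ρ⁻ k i) ,
          (λ i → *-nonNeg (x≤0⇒0≤-x δ≤0) (proj₁ (proj₂ (generates (λ c → - unit k c))) i)) ,
          ≤-congˡ (*-distribˡ-sum (- δ) (ρ⁻ k)) (0≤y-x⇒x≤y (≤-congʳ
            (solve 4 (λ δ ε r s → (ε :- δ) :* s :+ ε :* r := ε :* (r :+ s) :- δ :* s) refl (- δ) ε (sum (ρ⁺ k)) (sum (ρ⁻ k)))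
            (+-nonNeg (*-nonNeg (x≤y⇒0≤y-x -δ≤ε) (R-nonNeg⁻ k)) (*-nonNeg (proj₁ 0<ε) (R-nonNeg⁺ k))))) ,
          λ c → trans (scaled (- δ) (ρ⁻ k) c) (trans (*-congˡ (proj₂ (proj₂ (generates (λ c → - unit k c))) c))
            (solve 2 (λ x y → (:- x) :* (:- y) := x :* y) refl δ (unit k c)))

      interior : ∀ y → Ball (X p) ε y → conv X y
      interior y (dist≤ , _) = displacement∈conv X p θ y θ-nonNeg θ-sum
        λ c → trans (θ-combination c) (solve 2 (λ x y → :- (x :- y) := y :- x) refl (X p c) (y c))
        where
        δ : Point d
        δ k = X p k - y k
        axes : ∀ k → Axis k (- δ k)
        axes k = axis k (- δ k) (≤-congˡ (solve 1 (λ x → x :* x := (:- x) :* (:- x)) refl (δ k))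
          (≤-trans (term≤sum (λ c → x*x-nonNeg (δ c)) k) dist≤))
        θ : Vector Carrier n
        θ i = sum (λ k → proj₁ (axes k) i)
        θ-nonNeg : ∀ i → 0# ≤ θ i
        θ-nonNeg i = sum-nonNeg λ k → proj₁ (proj₂ (axes k)) i
        θ-sum : sum θ ≤ 1#
        θ-sum = ≤-congˡ (∑-comm (λ k i → proj₁ (axes k) i))
          (≤-trans (sum-mono-≤ λ k → proj₁ (proj₂ (proj₂ (axes k))))
          (≤-congˡ (*-distribˡ-sum ε R) (≤-congʳ (proj₂ (proj₂ inv)) (0≤y-x⇒x≤y (≤-congʳ
            (solve 2 (λ ε r → ε := (:1 :+ r) :* ε :- ε :* r) refl ε (sum R)) (proj₁ 0<ε))))))
        θ-combination : ∀ c → combination θ D c ≈ - δ c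
        θ-combination c = begin
          sum (λ i → θ i * D i c)                                   ≈⟨ sum-cong-≋ (λ i → *-distribʳ-sum (D i c) (λ k → proj₁ (axes k) i)) ⟩
          sum (λ i → sum (λ k → proj₁ (axes k) i * D i c))          ≈⟨ ∑-comm (λ i k → proj₁ (axes k) i * D i c) ⟩
          sum (λ k → combination (proj₁ (axes k)) D c)              ≈⟨ sum-cong-≋ (λ k → proj₂ (proj₂ (proj₂ (axes k))) c) ⟩
          sum (λ k → - δ k * unit k c)                              ≈⟨ sum-cong-≋ (λ k → trans (*-comm (- δ k) (unit k c)) (*-congʳ (reflexive (unit-sym k c)))) ⟩
          sum (λ k → unit c k * - δ k)                              ≈⟨ sum-unit-* c (λ k → - δ k) ⟩
          - δ c                                                     ∎
          where open ≈-Reasoning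

      absurd : ⊥
      absurd = refute (proj₂ (p∈bd ε 0<ε))
        where
        refute : (∃[ y ] Ball (X p) ε y × ¬ conv X y) → ⊥
        refute (y , y∈Ball , y∉conv) = y∉conv (interior y y∈Ball)

    decide : Dec Supported → Supported
    decide (yes s) = s
    decide (no ¬s) = ⊥-elim (absurd ¬s)

-- Alternating forms and the comparison of maximal potentials.

module SkewForms (ℝ : RealNumbers) (em : ExcludedMiddle 0ℓ) where
  open ConvexGeometry ℝ em public

  record SkewForm {d} (ω : Point d → Point d → Carrier) : Set where
    field
      linearʳ : ∀ x → Linear (ω x)
      skew    : ∀ x y → ω x y ≈ - ω y x

    linearˡ : ∀ y → Linear (λ x → ω x y)
    linearˡ y = record
      { φ-cong = λ {x} {x′} x≋x′ → trans (skew x y) (trans (-‿cong (φ-cong (linearʳ y) x≋x′)) (sym (skew x′ y)))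
      ; φ-+    = λ x x′ → trans (skew _ y) (trans (-‿cong (φ-+ (linearʳ y) x x′))
                   (trans (solve 2 (λ u v → :- (u :+ v) := :- u :+ :- v) refl (ω y x) (ω y x′)) (sym (+-cong (skew x y) (skew x′ y)))))
      ; φ-*    = λ c x → trans (skew _ y) (trans (-‿cong (φ-* (linearʳ y) c x))
                   (trans (solve 2 (λ c u → :- (c :* u) := c :* (:- u)) refl c (ω y x)) (*-congˡ (sym (skew x y)))))
      }

    alternating : ∀ x → ω x x ≈ 0#
    alternating x = *-cancel-0 (>⇒≉ (+-pos-nonNeg 0<1 (proj₁ 0<1))) (begin
      (1# + 1#) * ω x x     ≈⟨ solve 1 (λ w → (:1 :+ :1) :* w := w :+ w) refl (ω x x) ⟩
      ω x x + ω x x         ≈⟨ +-congˡ (skew x x) ⟩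
      ω x x - ω x x         ≈⟨ -‿inverseʳ (ω x x) ⟩
      0#                    ∎)
      where open ≈-Reasoning

  sum-linear : ∀ {n} c (f g : Vector Carrier n) → sum (λ i → c * f i + g i) ≈ c * sum f + sum g
  sum-linear c f g = trans (∑-distrib-+ (λ i → c * f i) g) (+-congʳ (sym (*-distribˡ-sum c f)))

  module _ {d n} {X : Vector (Point d) n} (spanning : AffinelySpanning X)
           (supported : ∀ p → ∃[ u ] ¬ IsZero u × ∀ i → ⟨ u , X i ⟩ ≤ ⟨ u , X p ⟩)
           {ω : Point d → Point d → Carrier} (skewForm : SkewForm ω)
           (f : Vector Carrier n)
           (compatible : ∀ i j → Antipodal X i j → ω (X j) (X i) ≈ f i - f j) where

    open SkewForm skewForm

    -- Points T inside conv X are represented by N T, where N is the sum of the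
    -- unnormalised weights, so that no division occurs.
    potential : Point d → Carrier → Fin n → Carrier
    potential T N i = N * f i - ω T (X i)

    module _ (τ σ : Vector Carrier n) (1≤τ : ∀ i → 1# ≤ τ i) (1≤σ : ∀ i → 1# ≤ σ i)
             (N : Carrier) (sum-τ : sum τ ≈ N) (sum-σ : sum σ ≈ N)
             (p q : Fin n) where

      private
        T S w : Point d
        T = combination τ X
        S = combination σ X
        w k = N * X p k - S k
        -- Rows of the linear program that maximises ⟨ w , u ⟩ over the normal
        -- cone of X p, with the width of conv X seen from T / N bounded.
        A B : Fin n → Point d
        A i k = X i k - X p k
        B j k = T k - N * X j k
        -- The dual feasible point. Its total weight is `N * N` and it combines the `X j` to
        -- `N * (T - X p) + S`, so in the combination of the `B j` the point `T` cancels and `N * w`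
        -- is left. The bound `1≤τ` leaves room for subtracting `unit p`.
        lam : Vector Carrier n
        lam j = N * (τ j - unit p j) + σ j

        0≤1 : 0# ≤ 1#
        0≤1 = proj₁ 0<1
        0<N : 0# < N
        0<N = <-≤-trans 0<1 (≤-congʳ sum-τ (≤-trans (1≤τ p) (term≤sum (λ i → ≤-trans 0≤1 (1≤τ i)) p)))

        lam-nonNeg : ∀ j → 0# ≤ lam j
        lam-nonNeg j = +-nonNeg (*-nonNeg (proj₁ 0<N) (x≤y⇒0≤y-x (≤-trans (unit-≤1 p j) (1≤τ j)))) (≤-trans 0≤1 (1≤σ j))

        module _ {φ : Point d → Carrier} (lin : Linear φ) where
          φA : ∀ i → φ (A i) ≈ φ (X i) - φ (X p)
          φA i = φ-sub lin (X i) (X p)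
          φB : ∀ j → φ (B j) ≈ φ T - N * φ (X j)
          φB j = trans (φ-sub lin T (λ k → N * X j k)) (+-congˡ (-‿cong (φ-* lin N (X j))))
          φw : φ w ≈ N * φ (X p) - φ S
          φw = trans (φ-sub lin (λ k → N * X p k) S) (+-congʳ (φ-* lin N (X p)))

          sum-lamB : sum (λ j → lam j * φ (B j)) ≈ N * φ w
          sum-lamB = begin
            sum (λ j → lam j * φ (B j))
              ≈⟨ sum-cong-≋ (λ j → trans (*-congˡ (φB j))
                   (solve 6 (λ N t τ e σ x → (N :* (τ :- e) :+ σ) :* (t :- N :* x) :=
                     (N :* t) :* τ :+ ((:- (N :* t)) :* e :+ (t :* σ :+ ((:- (N :* N)) :* (τ :* x) :+ ((N :* N) :* (e :* x) :+ (:- N) :* (σ :* x))))))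
                     refl N (φ T) (τ j) (unit p j) (σ j) (x j))) ⟩
            sum (λ j → (N * φ T) * τ j + (- (N * φ T) * unit p j + (φ T * σ j + (- (N * N) * (τ j * x j) + (N * N * (unit p j * x j) + - N * (σ j * x j))))))
              ≈⟨ trans (sum-linear (N * φ T) τ _) (+-congˡ (trans (sum-linear (- (N * φ T)) (unit p) _) (+-congˡ (trans (sum-linear (φ T) σ _)
                   (+-congˡ (trans (sum-linear (- (N * N)) (λ j → τ j * x j) _) (+-congˡ (trans (sum-linear (N * N) (λ j → unit p j * x j) _)
                   (+-congˡ (sym (*-distribˡ-sum (- N) (λ j → σ j * x j)))))))))))) ⟩
            (N * φ T) * sum τ + (- (N * φ T) * sum (unit p) + (φ T * sum σ + (- (N * N) * sum (λ j → τ j * x j) + (N * N * sum (λ j → unit p j * x j) + - N * sum (λ j → σ j * x j)))))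
              ≈⟨ +-cong (*-congˡ sum-τ) (+-cong (*-congˡ (sum-unit p)) (+-cong (*-congˡ sum-σ) (+-cong (*-congˡ (sym (φ-combination lin τ X)))
                   (+-cong (*-congˡ (sum-unit-* p x)) (*-congˡ (sym (φ-combination lin σ X))))))) ⟩
            (N * φ T) * N + (- (N * φ T) * 1# + (φ T * N + (- (N * N) * φ T + (N * N * x p + - N * φ S))))
              ≈⟨ solve 4 (λ N t x s → (N :* t) :* N :+ ((:- (N :* t)) :* :1 :+ (t :* N :+ ((:- (N :* N)) :* t :+ (N :* N :* x :+ (:- N) :* s)))) := N :* (N :* x :- s))
                   refl N (φ T) (x p) (φ S) ⟩
            N * (N * x p - φ S)
              ≈⟨ *-congˡ φw ⟨
            N * φ w ∎
            where
            open ≈-Reasoning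
            x : Vector Carrier n
            x j = φ (X j)

        rows : Fin (n ℕ.+ n) → Point d
        rows = A ++ B
        zeros ones : Vector Carrier n
        zeros _ = 0#
        ones _ = 1#
        bounds μ : Vector Carrier (n ℕ.+ n)
        bounds = zeros ++ ones
        μ = zeros ++ lam

        combination-split : ∀ {φ} → Linear φ → ∀ ν → φ (combination ν rows) ≈
          sum (λ i → ν (i ↑ˡ n) * φ (A i)) + sum (λ j → ν (n ↑ʳ j) * φ (B j))
        combination-split {φ} lin ν = trans (φ-combination lin ν rows) (trans (sum-split n (λ i → ν i * φ (rows i)))
          (+-cong (sum-cong-≋ λ i → *-congˡ (reflexive (≡.cong φ (lookup-++ˡ A B i))))
                  (sum-cong-≋ λ j → *-congˡ (reflexive (≡.cong φ (lookup-++ʳ A B j))))))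

        Optimum : Set
        Optimum = ∃[ u ] ∃[ ν ] (∀ i → ⟨ rows i , u ⟩ ≤ bounds i) × (∀ i → 0# ≤ ν i) ×
          (∀ c → combination ν rows c ≈ combination μ rows c) × (∀ i → 0# < ν i → ⟨ rows i , u ⟩ ≈ bounds i)

        optimum : Optimum
        optimum = complementary-slackness rows bounds μ (λ _ → 0#)
          (++-elim {n} {n} (λ i → 0# ≤ μ i)
            (λ i → ≤-reflexive (reflexive (≡.sym (lookup-++ˡ zeros lam i))))
            (λ j → ≡.subst (0# ≤_) (≡.sym (lookup-++ʳ zeros lam j)) (lam-nonNeg j)))
          (λ i → ≤-congˡ (sym (sum-zero λ k → zeroʳ (rows i k)))
            (++-elim {n} {n} (λ i → 0# ≤ bounds i)
              (λ i → ≤-reflexive (reflexive (≡.sym (lookup-++ˡ zeros ones i))))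
              (λ j → ≡.subst (0# ≤_) (≡.sym (lookup-++ʳ zeros ones j)) 0≤1) i))

        module Contradiction (u : Point d) (νA νB : Vector Carrier n)
          (Au≤0 : ∀ i → ⟨ A i , u ⟩ ≤ 0#) (Bu≤1 : ∀ j → ⟨ B j , u ⟩ ≤ 1#)
          (0≤νA : ∀ i → 0# ≤ νA i) (0≤νB : ∀ j → 0# ≤ νB j)
          (identity : ∀ {φ} → Linear φ → sum (λ i → νA i * φ (A i)) + sum (λ j → νB j * φ (B j)) ≈ N * φ w)
          (tightA : ∀ i → 0# < νA i → ⟨ A i , u ⟩ ≈ 0#) (tightB : ∀ j → 0# < νB j → ⟨ B j , u ⟩ ≈ 1#)
          (p-max : ∀ i → potential T N i ≤ potential T N p) (q-max : ∀ i → potential S N i ≤ potential S N q)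
          (gap : 0# < N * potential T N p - N * potential S N q + ω T S) where

          κ : Carrier
          κ = N * potential T N p - N * potential S N q + ω T S

          -- Otherwise `identity` would place `N * w` in the cone of the `A i`, where the supporting
          -- functional at `X p` is nonpositive. It is positive at `w`, because `S` gives weight at
          -- least 1 to every point and the functional is not constant on `X`. A tight row of `B`
          -- then has value 1, so `u` is not zero.
          someB : ∃[ j ] 0# < νB j
          someB = decide em
            where
            s = proj₁ (supported p)
            ψ = ⟨ s ,_⟩
            ψ-lin = ⟨ s ,⟩-linear
            ψ≤ : ∀ i → ψ (X i) ≤ ψ (X p)
            ψ≤ = proj₂ (proj₂ (supported p))
            ψw : ψ w ≈ sum (λ i → σ i * (ψ (X p) - ψ (X i)))
            ψw = begin
              ψ w                                                            ≈⟨ φw ψ-lin ⟩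
              N * ψ (X p) - ψ S                                              ≈⟨ +-cong (*-congʳ (sym sum-σ)) (-‿cong (φ-combination ψ-lin σ X)) ⟩
              sum σ * ψ (X p) - sum (λ i → σ i * ψ (X i))                    ≈⟨ +-congʳ (*-distribʳ-sum (ψ (X p)) σ) ⟩
              sum (λ i → σ i * ψ (X p)) - sum (λ i → σ i * ψ (X i))          ≈⟨ sum-sub (λ i → σ i * ψ (X p)) (λ i → σ i * ψ (X i)) ⟨
              sum (λ i → σ i * ψ (X p) - σ i * ψ (X i))
                ≈⟨ sum-cong-≋ (λ i → solve 3 (λ s x y → s :* x :- s :* y := s :* (x :- y)) refl (σ i) (ψ (X p)) (ψ (X i))) ⟩
              sum (λ i → σ i * (ψ (X p) - ψ (X i)))                          ∎
              where open ≈-Reasoning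
            0<ψw : 0# < ψ w
            0<ψw = ≰⇒> λ ψw≤0 → proj₁ (proj₂ (supported p)) (constant-direction⇒zero spanning {κ = ψ (X p)} λ i →
              sym (x-y≈0⇒x≈y (*-cancel-0 (>⇒≉ (<-≤-trans 0<1 (1≤σ i)))
                (sum-nonNeg-≤0 (λ i → *-nonNeg (≤-trans 0≤1 (1≤σ i)) (x≤y⇒0≤y-x (ψ≤ i))) (≤-congˡ ψw ψw≤0) i))))
            decide : Dec (∃[ j ] 0# < νB j) → ∃[ j ] 0# < νB j
            decide (yes j) = j
            decide (no ¬j) = ⊥-elim (<⇒≱ (*-pos 0<N 0<ψw) (≤-congˡ (identity ψ-lin)
              (≤-congʳ (+-identityʳ 0#) (+-mono-≤
                (sum-nonPos λ i → *-nonPos (0≤νA i) (≤-congˡ (sym (φA ψ-lin i)) (0≤y-x⇒x≤y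
                  (≤-congʳ (solve 2 (λ x y → y :- x := :0 :- (x :- y)) refl (ψ (X i)) (ψ (X p))) (x≤y⇒0≤y-x (ψ≤ i))))))
                (≤-reflexive (sum-zero λ j → trans (*-congʳ (antisym (≮⇒≥ λ 0<νB → ¬j (j , 0<νB)) (0≤νB j))) (zeroˡ (ψ (B j)))))))))

          u≉0 : ¬ IsZero u
          u≉0 u≈0 = 0≉1 (trans (sym (sum-zero λ k → trans (*-congˡ (u≈0 k)) (zeroʳ _))) (tightB (proj₁ someB) (proj₂ someB)))

          ψ : Point d → Carrier
          ψ = ⟨ u ,_⟩
          ψA : ∀ i → ⟨ A i , u ⟩ ≈ ψ (X i) - ψ (X p)
          ψA i = trans (⟨,⟩-comm (A i) u) (φA ⟨ u ,⟩-linear i)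
          ψB : ∀ j → ⟨ B j , u ⟩ ≈ ψ T - N * ψ (X j)
          ψB j = trans (⟨,⟩-comm (B j) u) (φB ⟨ u ,⟩-linear j)

          top-p : ∀ k → ψ (X k) ≤ ψ (X p)
          top-p k = 0≤y-x⇒x≤y (≤-congʳ (trans (-‿cong (ψA k)) (solve 2 (λ x y → :- (x :- y) := y :- x) refl (ψ (X k)) (ψ (X p)))) (x≤0⇒0≤-x (Au≤0 k)))
          top : ∀ i → 0# < νA i → ∀ k → ψ (X k) ≤ ψ (X i)
          top i 0<νA k = ≤-congʳ (sym (x-y≈0⇒x≈y (trans (sym (ψA i)) (tightA i 0<νA)))) (top-p k)
          -- The value of row `B j` decreases as `ψ (X j)` grows, and a tight row attains the
          -- largest permitted value.
          bottom : ∀ j → 0# < νB j → ∀ k → ψ (X j) ≤ ψ (X k)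
          bottom j 0<νB k = *-cancelˡ-≤ 0<N (0≤y-x⇒x≤y (≤-congʳ
            (trans (+-cong (ψB j) (-‿cong (ψB k))) (solve 3 (λ t x y → (t :- x) :- (t :- y) := y :- x) refl (ψ T) (N * ψ (X j)) (N * ψ (X k))))
            (x≤y⇒0≤y-x (≤-congʳ (sym (tightB j 0<νB)) (Bu≤1 k)))))

          antipodal-p : ∀ j → 0# < νB j → ω (X j) (X p) ≈ f p - f j
          antipodal-p j 0<νB = compatible p j (antipodal-in-direction spanning u≉0 top-p (bottom j 0<νB))
          antipodal : ∀ i j → 0# < νA i → 0# < νB j → ω (X j) (X i) ≈ f i - f j
          antipodal i j 0<νA 0<νB = compatible i j (antipodal-in-direction spanning u≉0 (top i 0<νA) (bottom j 0<νB))

          ωB : ∀ j y → ω (B j) y ≈ ω T y - N * ω (X j) y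
          ωB j y = φB (linearˡ y) j

          -- Both `X i` and `X p` are antipodal to `X j`, so `f j` cancels and the difference of the
          -- potentials of `T` at `p` and `i` remains.
          ωBA : ∀ i j → 0# < νA i → 0# < νB j → 0# ≤ ω (B j) (A i)
          ωBA i j 0<νA 0<νB = ≤-congʳ (begin
            potential T N p - potential T N i
              ≈⟨ solve 6 (λ N fp fi fj tp ti → (N :* fp :- tp) :- (N :* fi :- ti) := (ti :- tp) :- N :* ((fi :- fj) :- (fp :- fj)))
                   refl N (f p) (f i) (f j) (ω T (X p)) (ω T (X i)) ⟩
            (ω T (X i) - ω T (X p)) - N * ((f i - f j) - (f p - f j))
              ≈⟨ +-congˡ (-‿cong (*-congˡ (+-cong (antipodal i j 0<νA 0<νB) (-‿cong (antipodal-p j 0<νB))))) ⟨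
            (ω T (X i) - ω T (X p)) - N * (ω (X j) (X i) - ω (X j) (X p))
              ≈⟨ +-cong (φA (linearʳ T) i) (-‿cong (*-congˡ (φA (linearʳ (X j)) i))) ⟨
            ω T (A i) - N * ω (X j) (A i)
              ≈⟨ ωB j (A i) ⟨
            ω (B j) (A i) ∎) (x≤y⇒0≤y-x (p-max i))
            where open ≈-Reasoning

          -- The antipodal pair of `X p` and `X j` makes the left side equal to `- κ` with `j` in
          -- place of `q`; the maximality of `q` does the rest.
          ωBw : ∀ j → 0# < νB j → ω (B j) w ≤ - κ
          ωBw j 0<νB = ≤-congˡ (begin
            - (N * potential T N p - N * potential S N j + ω T S)
              ≈⟨ solve 7 (λ N fp fj tp sj ts sp → :- (N :* (N :* fp :- tp) :- N :* (N :* fj :- sj) :+ ts) :=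
                   (N :* tp :- ts) :- N :* (N :* (fp :- fj) :- (:- sj)))
                   refl N (f p) (f j) (ω T (X p)) (ω S (X j)) (ω T S) 0# ⟩
            (N * ω T (X p) - ω T S) - N * (N * (f p - f j) - (- ω S (X j)))
              ≈⟨ +-congˡ (-‿cong (*-congˡ (+-cong (*-congˡ (antipodal-p j 0<νB)) (-‿cong (skew (X j) S))))) ⟨
            (N * ω T (X p) - ω T S) - N * (N * ω (X j) (X p) - ω (X j) S)
              ≈⟨ +-cong (φw (linearʳ T)) (-‿cong (*-congˡ (φw (linearʳ (X j))))) ⟨
            ω T w - N * ω (X j) w
              ≈⟨ ωB j w ⟨
            ω (B j) w ∎)
            (neg-antimono-≤ (+-monoˡ-≤ (ω T S) (+-mono-≤ ≤-refl (neg-antimono-≤ (*-monoˡ-≤ (proj₁ 0<N) (q-max j))))))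
            where open ≈-Reasoning

          Z : Point d
          Z = combination νB B
          ωZ : ∀ y → ω Z y ≈ sum (λ j → νB j * ω (B j) y)
          ωZ y = φ-combination (linearˡ y) νB B

          Λ : Carrier
          Λ = sum νB
          0<Λ : 0# < Λ
          0<Λ = <-≤-trans (proj₂ someB) (term≤sum 0≤νB (proj₁ someB))

          ωZw≤ : ω Z w ≤ Λ * - κ
          ωZw≤ = 0≤y-x⇒x≤y (≤-congʳ (begin
            sum (λ j → νB j * (- κ - ω (B j) w))
              ≈⟨ sum-cong-≋ (λ j → solve 3 (λ v k b → v :* (k :- b) := v :* k :- v :* b) refl (νB j) (- κ) (ω (B j) w)) ⟩
            sum (λ j → νB j * - κ - νB j * ω (B j) w)
              ≈⟨ sum-sub (λ j → νB j * - κ) (λ j → νB j * ω (B j) w) ⟩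
            sum (λ j → νB j * - κ) - sum (λ j → νB j * ω (B j) w)
              ≈⟨ +-cong (*-distribʳ-sum (- κ) νB) (-‿cong (ωZ w)) ⟨
            Λ * - κ - ω Z w ∎)
            (weighted-nonNeg 0≤νB λ j 0<νB → x≤y⇒0≤y-x (ωBw j 0<νB)))
            where open ≈-Reasoning

          absurd : ⊥
          absurd = <⇒≱ (*-pos 0<N (*-pos 0<Λ gap)) (0≤y-x⇒x≤y (≤-congʳ
            (solve 3 (λ N L k → N :* (L :* (:- k)) := :0 :- N :* (L :* k)) refl N Λ κ)
            (≤-trans
              (weighted-nonNeg 0≤νA λ i 0<νA → ≤-congʳ (sym (ωZ (A i))) (weighted-nonNeg 0≤νB λ j 0<νB → ωBA i j 0<νA 0<νB))
              (≤-congˡ (begin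
                -- The part with the `νB j` is `ω Z Z`, which vanishes; the form is therefore never
                -- evaluated between two bottom points.
                N * ω Z w                                                              ≈⟨ identity (linearʳ Z) ⟨
                sum (λ i → νA i * ω Z (A i)) + sum (λ j → νB j * ω Z (B j))            ≈⟨ +-congˡ (φ-combination (linearʳ Z) νB B) ⟨
                sum (λ i → νA i * ω Z (A i)) + ω Z Z                                   ≈⟨ +-congˡ (alternating Z) ⟩
                sum (λ i → νA i * ω Z (A i)) + 0#                                      ≈⟨ +-identityʳ _ ⟩
                sum (λ i → νA i * ω Z (A i))                                           ∎)
                (*-monoˡ-≤ (proj₁ 0<N) ωZw≤)))))
            where open ≈-Reasoning

      -- The inequality M T + ω(T, S) ≤ M S for the points `T` / `N` and `S` / `N`, multiplied by
      -- `N * N`.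
      potential-comparison : (∀ i → potential T N i ≤ potential T N p) → (∀ i → potential S N i ≤ potential S N q) →
                             N * potential T N p + ω T S ≤ N * potential S N q
      potential-comparison p-max q-max = ≮⇒≥ λ Nq<Np → contradiction optimum
        (<-resp-≈ refl (solve 3 (λ x w y → (x :+ w) :- y := x :- y :+ w) refl (N * potential T N p) (ω T S) (N * potential S N q)) (x<y⇒0<y-x Nq<Np))
        where
        contradiction : Optimum → 0# < N * potential T N p - N * potential S N q + ω T S → ⊥
        contradiction (u , ν , rows≤ , 0≤ν , ν-combination , tight) gap =
          Contradiction.absurd u (λ i → ν (i ↑ˡ n)) (λ j → ν (n ↑ʳ j))
            (λ i → ≡.subst₂ (λ a b → ⟨ a , u ⟩ ≤ b) (lookup-++ˡ A B i) (lookup-++ˡ zeros ones i) (rows≤ (i ↑ˡ n)))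
            (λ j → ≡.subst₂ (λ a b → ⟨ a , u ⟩ ≤ b) (lookup-++ʳ A B j) (lookup-++ʳ zeros ones j) (rows≤ (n ↑ʳ j)))
            (λ i → 0≤ν (i ↑ˡ n)) (λ j → 0≤ν (n ↑ʳ j)) identity
            (λ i 0<ν → ≡.subst₂ (λ a b → ⟨ a , u ⟩ ≈ b) (lookup-++ˡ A B i) (lookup-++ˡ zeros ones i) (tight (i ↑ˡ n) 0<ν))
            (λ j 0<ν → ≡.subst₂ (λ a b → ⟨ a , u ⟩ ≈ b) (lookup-++ʳ A B j) (lookup-++ʳ zeros ones j) (tight (n ↑ʳ j) 0<ν))
            p-max q-max gap
          where
          identity : ∀ {φ} → Linear φ → sum (λ i → ν (i ↑ˡ n) * φ (A i)) + sum (λ j → ν (n ↑ʳ j) * φ (B j)) ≈ N * φ w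
          identity {φ} lin = begin
            sum (λ i → ν (i ↑ˡ n) * φ (A i)) + sum (λ j → ν (n ↑ʳ j) * φ (B j))     ≈⟨ combination-split lin ν ⟨
            φ (combination ν rows)                                                 ≈⟨ φ-cong lin ν-combination ⟩
            φ (combination μ rows)                                                 ≈⟨ combination-split lin μ ⟩
            sum (λ i → μ (i ↑ˡ n) * φ (A i)) + sum (λ j → μ (n ↑ʳ j) * φ (B j))
              ≈⟨ +-cong (sum-zero λ i → trans (*-congʳ (reflexive (lookup-++ˡ zeros lam i))) (zeroˡ (φ (A i))))
                        (sum-cong-≋ λ j → *-congʳ (reflexive (lookup-++ʳ zeros lam j))) ⟩
            0# + sum (λ j → lam j * φ (B j))                                       ≈⟨ +-identityˡ _ ⟩
            sum (λ j → lam j * φ (B j))                                            ≈⟨ sum-lamB lin ⟩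
            N * φ w                                                                ∎
            where open ≈-Reasoning

-- Vanishing of the alternating form.

module Connectivity (ℝ : RealNumbers) (em : ExcludedMiddle 0ℓ) where
  open SkewForms ℝ em public

  maximiser : ∀ {n} → Fin n → (v : Vector Carrier n) → ∃[ i ] ∀ j → v j ≤ v i
  maximiser i v = fromArgmax (argmax (λ _ → ⊤) v)
    where
    fromArgmax : (∀ j → ¬ ⊤) ⊎ (∃[ k ] ⊤ × ∀ j → ⊤ → v j ≤ v k) → ∃[ k ] ∀ j → v j ≤ v k
    fromArgmax (inj₁ none) = ⊥-elim (none i tt)
    fromArgmax (inj₂ (k , _ , max)) = k , λ j → max j tt

  module _ {d n} {X : Vector (Point d) n} (spanning : AffinelySpanning X)
           (supported : ∀ p → ∃[ u ] ¬ IsZero u × ∀ i → ⟨ u , X i ⟩ ≤ ⟨ u , X p ⟩) (o : Fin n) where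

    module _ {ω : Point d → Point d → Carrier} (skewForm : SkewForm ω) (f : Vector Carrier n)
             (compatible : ∀ i j → Antipodal X i j → ω (X j) (X i) ≈ f i - f j) where

      open SkewForm skewForm

      private
        2# N : Carrier
        2# = 1# + 1#
        N = sum {n} (λ _ → 2#)
        -- The base weight is 2 because `τ i` takes one unit away from `o`, and all weights have to
        -- stay at least 1.
        τ₀ : Vector Carrier n
        τ₀ _ = 2#
        τ : Fin n → Vector Carrier n
        τ i k = 2# + (unit i k - unit o k)
        a′ : Fin n → Point d
        a′ i c = X i c - X o c
        T₀ : Point d
        T₀ = combination τ₀ X
        T : Fin n → Point d
        T i = combination (τ i) X
        1≤2 : 1# ≤ 2#
        1≤2 = ≤-congˡ (+-identityʳ 1#) (+-mono-≤ ≤-refl (proj₁ 0<1))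
        1≤τ : ∀ i k → 1# ≤ τ i k
        1≤τ i k = 0≤y-x⇒x≤y (≤-congʳ (solve 2 (λ x y → x :+ (:1 :- y) := (:1 :+ :1) :+ (x :- y) :- :1) refl (unit i k) (unit o k))
          (+-nonNeg (unit-nonNeg i k) (x≤y⇒0≤y-x (unit-≤1 o k))))
        sum-τ : ∀ i → sum (τ i) ≈ N
        sum-τ i = trans (∑-distrib-+ τ₀ (λ k → unit i k - unit o k)) (trans (+-congˡ (trans (sum-sub (unit i) (unit o))
          (x≈y⇒x-y≈0 (trans (sum-unit i) (sym (sum-unit o)))))) (+-identityʳ N))
        T-shift : ∀ i c → T i c ≈ T₀ c + a′ i c
        T-shift i c = begin
          sum (λ k → (2# + (unit i k - unit o k)) * X k c)
            ≈⟨ sum-cong-≋ (λ k → solve 4 (λ t e e′ x → (t :+ (e :- e′)) :* x := t :* x :+ (e :* x :- e′ :* x)) refl 2# (unit i k) (unit o k) (X k c)) ⟩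
          sum (λ k → 2# * X k c + (unit i k * X k c - unit o k * X k c))
            ≈⟨ ∑-distrib-+ (λ k → 2# * X k c) (λ k → unit i k * X k c - unit o k * X k c) ⟩
          T₀ c + sum (λ k → unit i k * X k c - unit o k * X k c)
            ≈⟨ +-congˡ (sum-sub (λ k → unit i k * X k c) (λ k → unit o k * X k c)) ⟩
          T₀ c + (sum (λ k → unit i k * X k c) - sum (λ k → unit o k * X k c))
            ≈⟨ +-congˡ (+-cong (sum-unit-* i (λ k → X k c)) (-‿cong (sum-unit-* o (λ k → X k c)))) ⟩
          T₀ c + a′ i c ∎
          where open ≈-Reasoning

        ω-shiftʳ : ∀ x i → ω x (T i) ≈ ω x T₀ + ω x (a′ i)
        ω-shiftʳ x i = trans (φ-cong (linearʳ x) (T-shift i)) (φ-+ (linearʳ x) T₀ (a′ i))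
        ω-shiftˡ : ∀ i y → ω (T i) y ≈ ω T₀ y + ω (a′ i) y
        ω-shiftˡ i y = trans (φ-cong (linearˡ y) (T-shift i)) (φ-+ (linearˡ y) T₀ (a′ i))

        -- A cyclic sum of ω around a triangle is invariant under translation, so it depends only on
        -- the two edges at `T₀`.
        cyclic : ∀ i j → ω T₀ (T i) + ω (T i) (T j) + ω (T j) T₀ ≈ ω (a′ i) (a′ j)
        cyclic i j = begin
          ω T₀ (T i) + ω (T i) (T j) + ω (T j) T₀
            ≈⟨ +-cong (+-cong (ω-shiftʳ T₀ i) (trans (ω-shiftˡ i (T j)) (+-cong (ω-shiftʳ T₀ j) (ω-shiftʳ (a′ i) j)))) (ω-shiftˡ j T₀) ⟩
          (ω T₀ T₀ + ω T₀ (a′ i)) + ((ω T₀ T₀ + ω T₀ (a′ j)) + (ω (a′ i) T₀ + ω (a′ i) (a′ j))) + (ω T₀ T₀ + ω (a′ j) T₀)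
            ≈⟨ +-cong (+-congˡ (+-congˡ (+-congʳ (skew (a′ i) T₀)))) (+-congˡ (skew (a′ j) T₀)) ⟩
          (ω T₀ T₀ + ω T₀ (a′ i)) + ((ω T₀ T₀ + ω T₀ (a′ j)) + (- ω T₀ (a′ i) + ω (a′ i) (a′ j))) + (ω T₀ T₀ - ω T₀ (a′ j))
            ≈⟨ solve 4 (λ t x y z → (t :+ x) :+ ((t :+ y) :+ (:- x :+ z)) :+ (t :- y) := (t :+ t :+ t) :+ z) refl
                 (ω T₀ T₀) (ω T₀ (a′ i)) (ω T₀ (a′ j)) (ω (a′ i) (a′ j)) ⟩
          (ω T₀ T₀ + ω T₀ T₀ + ω T₀ T₀) + ω (a′ i) (a′ j)
            ≈⟨ +-congʳ (trans (+-cong (+-cong (alternating T₀) (alternating T₀)) (alternating T₀)) (trans (+-identityʳ _) (+-identityʳ _))) ⟩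
          0# + ω (a′ i) (a′ j)
            ≈⟨ +-identityˡ _ ⟩
          ω (a′ i) (a′ j) ∎
          where open ≈-Reasoning

        g : Point d → Vector Carrier n
        g Y = potential spanning supported skewForm f compatible Y N
        best : Point d → Fin n
        best Y = proj₁ (maximiser o (g Y))
        G : Point d → Carrier
        G Y = N * g Y (best Y)

        step : ∀ (σ ρ : Vector Carrier n) → (∀ k → 1# ≤ σ k) → (∀ k → 1# ≤ ρ k) → sum σ ≈ N → sum ρ ≈ N →
               G (combination σ X) + ω (combination σ X) (combination ρ X) ≤ G (combination ρ X)
        step σ ρ 1≤σ 1≤ρ sum-σ sum-ρ = potential-comparison spanning supported skewForm f compatible σ ρ 1≤σ 1≤ρ N sum-σ sum-ρ
          (best (combination σ X)) (best (combination ρ X))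
          (proj₂ (maximiser o (g (combination σ X)))) (proj₂ (maximiser o (g (combination ρ X))))

        a′a′≤0 : ∀ i j → ω (a′ i) (a′ j) ≤ 0#
        a′a′≤0 i j = ≤-congˡ (cyclic i j) (0≤y-x⇒x≤y (≤-congʳ
          (solve 6 (λ x y z p q r → (y :- (x :+ p)) :+ ((z :- (y :+ q)) :+ (x :- (z :+ r))) := :0 :- (p :+ q :+ r)) refl
             (G T₀) (G (T i)) (G (T j)) (ω T₀ (T i)) (ω (T i) (T j)) (ω (T j) T₀))
          (+-nonNeg (x≤y⇒0≤y-x (step τ₀ (τ i) (λ _ → 1≤2) (1≤τ i) refl (sum-τ i)))
          (+-nonNeg (x≤y⇒0≤y-x (step (τ i) (τ j) (1≤τ i) (1≤τ j) (sum-τ i) (sum-τ j)))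
                    (x≤y⇒0≤y-x (step (τ j) τ₀ (1≤τ j) (λ _ → 1≤2) (sum-τ j) refl))))))

        a′a′≈0 : ∀ i j → ω (a′ i) (a′ j) ≈ 0#
        a′a′≈0 i j = antisym (a′a′≤0 i j) (≤-congʳ (sym (skew (a′ i) (a′ j))) (x≤0⇒0≤-x (a′a′≤0 j i)))

        a′≈0 : ∀ i y → ω (a′ i) y ≈ 0#
        a′≈0 i = constant⇒zero spanning (linearʳ (a′ i)) λ j →
          x-y≈0⇒x≈y (trans (sym (φ-sub (linearʳ (a′ i)) (X j) (X o))) (a′a′≈0 i j))

      -- The form vanishes on pairs of differences `X i - X o`; affine spanning extends this to all
      -- vectors, one argument at a time.
      form-vanishes : ∀ x y → ω x y ≈ 0#
      form-vanishes x y = constant⇒zero spanning (linearˡ y)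
        (λ i → x-y≈0⇒x≈y (trans (sym (φ-sub (linearˡ y) (X i) (X o))) (a′≈0 i y))) x

-- Connectedness of antipodality.

module Continuity (ℝ : RealNumbers) (em : ExcludedMiddle 0ℓ) where
  open Connectivity ℝ em public

  -- Continuity in the form used later: each strict inequality survives small changes, and for
  -- finitely many of them the least tolerance serves.
  uniform-ε : ∀ {n} (P : Fin n → Set) (G H : Vector Carrier n) → (∀ i → P i → 0# < G i) →
              ∃[ ε ] 0# < ε × ∀ i → P i → ∀ δ → - ε ≤ δ → δ ≤ ε → 0# < G i + δ * H i
  uniform-ε {zero}  P G H 0<G = 1# , 0<1 , λ ()
  uniform-ε {suc n} P G H 0<G = minimum (head-ε em) (uniform-ε (P ∘ suc) (G ∘ suc) (H ∘ suc) (λ i → 0<G (suc i)))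
    where
    Good : (ε : Carrier) → Fin (suc n) → Set
    Good ε i = P i → ∀ δ → - ε ≤ δ → δ ≤ ε → 0# < G i + δ * H i
    -- With ε = g / (1 + ∣h∣), the value g + δ h is at least ε.
    lemma : ∀ g h → 0# < g → 0# ≤ h → ∃[ ε ] 0# < ε × ∀ δ → δ ≤ ε → ε ≤ g - δ * h
    lemma g h 0<g 0≤h = g * c⁻¹ , *-pos 0<g (proj₁ (proj₂ inv)) , λ δ δ≤ε → 0≤y-x⇒x≤y (≤-congʳ (begin
        (g * c⁻¹ - δ) * h                              ≈⟨ solve 4 (λ g k d h → (g :* k :- d) :* h := (g :* ((:1 :+ h) :* k) :- d :* h) :- g :* k) refl g c⁻¹ δ h ⟩
        (g * ((1# + h) * c⁻¹) - δ * h) - g * c⁻¹       ≈⟨ +-congʳ (+-congʳ (trans (*-congˡ (proj₂ (proj₂ inv))) (*-identityʳ g))) ⟩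
        (g - δ * h) - g * c⁻¹                          ∎) (*-nonNeg (x≤y⇒0≤y-x δ≤ε) 0≤h))
      where
      open ≈-Reasoning
      inv = posInverse (+-pos-nonNeg 0<1 0≤h)
      c⁻¹ = proj₁ inv
    head-ε : Dec (P zero) → ∃[ ε ] 0# < ε × Good ε zero
    head-ε (no ¬p) = 1# , 0<1 , λ p → ⊥-elim (¬p p)
    head-ε (yes p) = by-sign (total 0# (H zero))
      where
      by-sign : 0# ≤ H zero ⊎ H zero ≤ 0# → ∃[ ε ] 0# < ε × Good ε zero
      by-sign (inj₁ 0≤h) = ε , 0<ε , λ _ δ -ε≤δ _ → <-≤-trans 0<ε (≤-congʳ
            (solve 3 (λ g d h → g :- (:- d) :* h := g :+ d :* h) refl (G zero) δ (H zero))
            (bound (- δ) (≤-congʳ (solve 1 (λ x → :- (:- x) := x) refl ε) (neg-antimono-≤ -ε≤δ))))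
        where
        ε = proj₁ (lemma (G zero) (H zero) (0<G zero p) 0≤h)
        0<ε = proj₁ (proj₂ (lemma (G zero) (H zero) (0<G zero p) 0≤h))
        bound = proj₂ (proj₂ (lemma (G zero) (H zero) (0<G zero p) 0≤h))
      by-sign (inj₂ h≤0) = ε , 0<ε , λ _ δ _ δ≤ε → <-≤-trans 0<ε (≤-congʳ
            (solve 3 (λ g d h → g :- d :* (:- h) := g :+ d :* h) refl (G zero) δ (H zero)) (bound δ δ≤ε))
        where
        ε = proj₁ (lemma (G zero) (- H zero) (0<G zero p) (x≤0⇒0≤-x h≤0))
        0<ε = proj₁ (proj₂ (lemma (G zero) (- H zero) (0<G zero p) (x≤0⇒0≤-x h≤0)))
        bound = proj₂ (proj₂ (lemma (G zero) (- H zero) (0<G zero p) (x≤0⇒0≤-x h≤0)))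
    shrink : ∀ {ε ε′ i} → ε ≤ ε′ → Good ε′ i → Good ε i
    shrink ε≤ε′ good p δ l u = good p δ (≤-trans (neg-antimono-≤ ε≤ε′) l) (≤-trans u ε≤ε′)
    minimum : (∃[ ε ] 0# < ε × Good ε zero) → (∃[ ε ] 0# < ε × ∀ i → Good ε (suc i)) → ∃[ ε ] 0# < ε × ∀ i → Good ε i
    minimum (ε , 0<ε , good) (ε′ , 0<ε′ , good′) = choose (total ε ε′)
      where
      choose : ε ≤ ε′ ⊎ ε′ ≤ ε → ∃[ ε ] 0# < ε × ∀ i → Good ε i
      choose (inj₁ ε≤ε′) = ε  , 0<ε  , λ { zero → good ; (suc i) → shrink {i = suc i} ε≤ε′ (good′ i) }
      choose (inj₂ ε′≤ε) = ε′ , 0<ε′ , λ { zero → shrink {i = zero} ε′≤ε good ; (suc i) → good′ i }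

  module _ {d n} {X : Vector (Point d) n} (spanning : AffinelySpanning X)
           (supported : ∀ p → ∃[ u ] ¬ IsZero u × ∀ i → ⟨ u , X i ⟩ ≤ ⟨ u , X p ⟩)
           (C : Fin n → Set) (closed : ∀ i j → Antipodal X i j → C i → C j)
           (closed′ : ∀ i j → Antipodal X i j → C j → C i) where

    private
      Top : Point d → Fin n → Set
      Top u i = ∀ k → ⟨ u , X k ⟩ ≤ ⟨ u , X i ⟩

      -- Any bottom point for `u` is antipodal to both `X i` and `X j`, so it carries membership in
      -- `C` from one to the other.
      top-class : ∀ {u} → ¬ IsZero u → ∀ {i j} → Top u i → Top u j → C i → C j
      top-class {u} u≉0 {i} {j} ti tj ci =
        closed′ j k (antipodal-in-direction spanning u≉0 tj bottom) (closed i k (antipodal-in-direction spanning u≉0 ti bottom) ci)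
        where
        k = proj₁ (maximiser i (λ l → - ⟨ u , X l ⟩))
        bottom : ∀ l → ⟨ u , X k ⟩ ≤ ⟨ u , X l ⟩
        bottom l = 0≤y-x⇒x≤y (≤-congʳ (solve 2 (λ x y → :- x :- (:- y) := y :- x) refl ⟨ u , X k ⟩ ⟨ u , X l ⟩)
          (x≤y⇒0≤y-x (proj₂ (maximiser i (λ l → - ⟨ u , X l ⟩)) l)))

      module Segment (p q : Fin n) (cp : C p) (¬cq : ¬ C q) where
        u₀ u₁ : Point d
        u₀ = proj₁ (supported p)
        u₁ = proj₁ (supported q)
        u₀≉0 : ¬ IsZero u₀
        u₀≉0 = proj₁ (proj₂ (supported p))
        u₁≉0 : ¬ IsZero u₁
        u₁≉0 = proj₁ (proj₂ (supported q))
        v : Point d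
        v k = u₁ k - u₀ k
        u : Carrier → Point d
        u s k = u₀ k + s * v k

        ⟨u,⟩ : ∀ s x → ⟨ u s , x ⟩ ≈ ⟨ u₀ , x ⟩ + s * ⟨ v , x ⟩
        ⟨u,⟩ s x = begin
          sum (λ k → (u₀ k + s * v k) * x k)               ≈⟨ sum-cong-≋ (λ k → solve 4 (λ u s v x → (u :+ s :* v) :* x := s :* (v :* x) :+ u :* x) refl (u₀ k) s (v k) (x k)) ⟩
          sum (λ k → s * (v k * x k) + u₀ k * x k)         ≈⟨ sum-linear s (λ k → v k * x k) (λ k → u₀ k * x k) ⟩
          s * ⟨ v , x ⟩ + ⟨ u₀ , x ⟩                       ≈⟨ +-comm _ _ ⟩
          ⟨ u₀ , x ⟩ + s * ⟨ v , x ⟩                       ∎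
          where open ≈-Reasoning

        ⟨u₁,⟩ : ∀ x → ⟨ u₁ , x ⟩ ≈ ⟨ u₀ , x ⟩ + ⟨ v , x ⟩
        ⟨u₁,⟩ x = trans (⟨,⟩-congˡ λ k → solve 2 (λ u v → v := u :+ :1 :* (v :- u)) refl (u₀ k) (u₁ k))
          (trans (⟨u,⟩ 1# x) (+-congˡ (*-identityˡ _)))

        -- Where u vanishes, u₁ is a negative multiple of u₀, so that X p is a
        -- bottom point for u₁.
        nonzero : ∀ s → 0# ≤ s → s ≤ 1# → ¬ IsZero (u s)
        nonzero s 0≤s s≤1 us≈0 = ¬cq (closed′ q p (antipodal-in-direction spanning u₁≉0 (proj₂ (proj₂ (supported q))) bottom) cp)
          where
          s≉0 : ¬ s ≈ 0#
          s≉0 s≈0 = u₀≉0 λ k → trans (sym (trans (+-congˡ (trans (*-congʳ s≈0) (zeroˡ (v k)))) (+-identityʳ (u₀ k)))) (us≈0 k)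
          u₁-value : ∀ x → s * ⟨ u₁ , x ⟩ ≈ (1# - s) * - ⟨ u₀ , x ⟩
          u₁-value x = begin
            s * ⟨ u₁ , x ⟩                                            ≈⟨ *-congˡ (⟨u₁,⟩ x) ⟩
            s * (⟨ u₀ , x ⟩ + ⟨ v , x ⟩)                              ≈⟨ solve 3 (λ s u v → s :* (u :+ v) := (u :+ s :* v) :+ (:1 :- s) :* (:- u)) refl s ⟨ u₀ , x ⟩ ⟨ v , x ⟩ ⟩
            (⟨ u₀ , x ⟩ + s * ⟨ v , x ⟩) + (1# - s) * - ⟨ u₀ , x ⟩    ≈⟨ +-congʳ (trans (sym (⟨u,⟩ s x)) (sum-zero λ k → trans (*-congʳ (us≈0 k)) (zeroˡ (x k)))) ⟩
            0# + (1# - s) * - ⟨ u₀ , x ⟩                              ≈⟨ +-identityˡ _ ⟩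
            (1# - s) * - ⟨ u₀ , x ⟩                                   ∎
            where open ≈-Reasoning
          bottom : ∀ k → ⟨ u₁ , X p ⟩ ≤ ⟨ u₁ , X k ⟩
          bottom k = *-cancelˡ-≤ (0≤s , λ 0≈s → s≉0 (sym 0≈s)) (≤-congˡ (sym (u₁-value (X p))) (≤-congʳ (sym (u₁-value (X k)))
            (*-monoˡ-≤ (x≤y⇒0≤y-x s≤1) (neg-antimono-≤ (proj₂ (proj₂ (supported p)) k)))))

        -- It suffices to ask for one top point in `C`: where `u s` is nonzero, `top-class` then
        -- puts all top points in `C`.
        Reached : Carrier → Set
        Reached s = 0# ≤ s × s ≤ 1# × ∃[ i ] C i × Top (u s) i

        Stable : Carrier → (Fin n → Set) → Set
        Stable s D = ∃[ ε ] 0# < ε × ∀ δ → - ε ≤ δ → δ ≤ ε → ∀ i → D i → ¬ Top (u (s + δ)) i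

        -- A fixed top point `j` for `u s` beats every index in `D` by a positive gap, and these
        -- finitely many gaps vary linearly with the parameter.
        stable : ∀ s (D : Fin n → Set) → (∀ i → D i → ¬ Top (u s) i) → Stable s D
        stable s D ¬top = conclude (uniform-ε D gap drift 0<gap)
          where
          j = proj₁ (maximiser p (λ k → ⟨ u s , X k ⟩))
          j-top = proj₂ (maximiser p (λ k → ⟨ u s , X k ⟩))
          gap drift : Vector Carrier n
          gap i = ⟨ u s , X j ⟩ - ⟨ u s , X i ⟩
          drift i = ⟨ v , X j ⟩ - ⟨ v , X i ⟩
          0<gap : ∀ i → D i → 0# < gap i
          0<gap i di = x<y⇒0<y-x (≰⇒> λ j≤i → ¬top i di λ k → ≤-trans (j-top k) j≤i)
          conclude : (∃[ ε ] 0# < ε × ∀ i → D i → ∀ δ → - ε ≤ δ → δ ≤ ε → 0# < gap i + δ * drift i) → Stable s D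
          conclude (ε , 0<ε , bound) = ε , 0<ε , λ δ l r i di top → <⇒≱ (bound i di δ l r)
            (≤-congˡ (begin
              ⟨ u (s + δ) , X j ⟩ - ⟨ u (s + δ) , X i ⟩
                ≈⟨ +-cong (⟨u,⟩ (s + δ) (X j)) (-‿cong (⟨u,⟩ (s + δ) (X i))) ⟩
              (⟨ u₀ , X j ⟩ + (s + δ) * ⟨ v , X j ⟩) - (⟨ u₀ , X i ⟩ + (s + δ) * ⟨ v , X i ⟩)
                ≈⟨ solve 6 (λ s d a b a′ b′ → (a :+ (s :+ d) :* b) :- (a′ :+ (s :+ d) :* b′) := (a :+ s :* b) :- (a′ :+ s :* b′) :+ d :* (b :- b′)) refl
                     s δ ⟨ u₀ , X j ⟩ ⟨ v , X j ⟩ ⟨ u₀ , X i ⟩ ⟨ v , X i ⟩ ⟩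
              (⟨ u₀ , X j ⟩ + s * ⟨ v , X j ⟩) - (⟨ u₀ , X i ⟩ + s * ⟨ v , X i ⟩) + δ * drift i
                ≈⟨ +-congʳ (+-cong (⟨u,⟩ s (X j)) (-‿cong (⟨u,⟩ s (X i)))) ⟨
              gap i + δ * drift i ∎)
            (0≤y-x⇒x≤y (≤-congʳ (solve 2 (λ x y → y :- x := :0 :- (x :- y)) refl ⟨ u (s + δ) , X j ⟩ ⟨ u (s + δ) , X i ⟩) (x≤y⇒0≤y-x (top j)))))
            where open ≈-Reasoning

        reached₀ : Reached 0#
        reached₀ = ≤-refl , proj₁ 0<1 , p , cp , λ k →
          ≤-congˡ (⟨u₀,⟩ (X k)) (≤-congʳ (⟨u₀,⟩ (X p)) (proj₂ (proj₂ (supported p)) k))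
          where
          ⟨u₀,⟩ : ∀ x → ⟨ u₀ , x ⟩ ≈ ⟨ u 0# , x ⟩
          ⟨u₀,⟩ x = ⟨,⟩-congˡ λ k → solve 2 (λ u v → u := u :+ :0 :* v) refl (u₀ k) (v k)

        least-upper-bound : ∃[ s ] (∀ t → Reached t → t ≤ s) × (∀ b → (∀ t → Reached t → t ≤ b) → s ≤ b)
        least-upper-bound = supremum Reached (0# , reached₀) (1# , λ s reached → proj₁ (proj₂ reached))
        s* : Carrier
        s* = proj₁ least-upper-bound
        s*-upper : ∀ s → Reached s → s ≤ s*
        s*-upper = proj₁ (proj₂ least-upper-bound)
        s*-least : ∀ b → (∀ s → Reached s → s ≤ b) → s* ≤ b
        s*-least = proj₂ (proj₂ least-upper-bound)
        0≤s* : 0# ≤ s*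
        0≤s* = s*-upper 0# reached₀
        s*≤1 : s* ≤ 1#
        s*≤1 = s*-least 1# λ s reached → proj₁ (proj₂ reached)

        top-respects : ∀ {s s′ i} → s ≈ s′ → Top (u s) i → Top (u s′) i
        top-respects {s} {s′} {i} s≈s′ top k = ≤-congˡ (shift (X k)) (≤-congʳ (shift (X i)) (top k))
          where
          shift : ∀ x → ⟨ u s , x ⟩ ≈ ⟨ u s′ , x ⟩
          shift x = ⟨,⟩-congˡ {u = u s} {u s′} {x} λ k → +-congˡ (*-congʳ s≈s′)

        -- If `C` had no top point at `s*`, it would have none on an interval just below either, and
        -- `s* - ε` would be a smaller upper bound.
        reached* : ∃[ i ] C i × Top (u s*) i
        reached* = decide em
          where
          decide : Dec (∃[ i ] C i × Top (u s*) i) → ∃[ i ] C i × Top (u s*) i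
          decide (yes r) = r
          decide (no ¬r) = contra (stable s* C (λ i ci top → ¬r (i , ci , top)))
            where
            contra : Stable s* C → ∃[ i ] C i × Top (u s*) i
            contra (ε , 0<ε , none) = ⊥-elim (<⇒≱ 0<ε (0≤y-x⇒x≤y (≤-congʳ
              (solve 2 (λ s e → (s :- e) :- s := :0 :- e) refl s* ε) (x≤y⇒0≤y-x (s*-least (s* - ε) below)))))
              where
              below : ∀ s → Reached s → s ≤ s* - ε
              below s reached@(_ , _ , i , ci , top) = ≮⇒≥ λ s*-ε<s → none (s - s*)
                (0≤y-x⇒x≤y (≤-congʳ (solve 3 (λ s t e → s :- (t :- e) := (s :- t) :- (:- e)) refl s s* ε) (x≤y⇒0≤y-x (proj₁ s*-ε<s))))
                (0≤y-x⇒x≤y (≤-congʳ (solve 3 (λ s t e → e :+ (t :- s) := e :- (s :- t)) refl s s* ε)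
                  (+-nonNeg (proj₁ 0<ε) (x≤y⇒0≤y-x (s*-upper s reached)))))
                i ci (top-respects (solve 2 (λ s t → s := t :+ (s :- t)) refl s s*) top)

        s*<1 : s* < 1#
        s*<1 = s*≤1 , λ s*≈1 → ¬cq (top-class (nonzero 1# (proj₁ 0<1) ≤-refl)
          (top-respects s*≈1 (proj₂ (proj₂ reached*)))
          (λ k → ≤-congˡ (at-1 (X k)) (≤-congʳ (at-1 (X q)) (proj₂ (proj₂ (supported q)) k)))
          (proj₁ (proj₂ reached*)))
          where
          at-1 : ∀ x → ⟨ u₁ , x ⟩ ≈ ⟨ u 1# , x ⟩
          at-1 x = trans (⟨u₁,⟩ x) (trans (+-congˡ (sym (*-identityˡ ⟨ v , x ⟩))) (sym (⟨u,⟩ 1# x)))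

        -- At `s*` every top point lies in `C`. By stability the points outside `C` stay below the
        -- top for a while, so parameters beyond `s*` are reached.
        absurd : ⊥
        absurd = contra (stable s* (λ i → ¬ C i) λ i ¬ci top → ¬ci
          (top-class (nonzero s* 0≤s* s*≤1) (proj₂ (proj₂ reached*)) top (proj₁ (proj₂ reached*))))
          where
          contra : Stable s* (λ i → ¬ C i) → ⊥
          contra (ε , 0<ε , none) = choose (total ε (1# - s*))
            where
            advance : ∀ δ → 0# < δ → δ ≤ ε → δ ≤ 1# - s* → ⊥
            advance δ 0<δ δ≤ε δ≤1-s* = <⇒≱ 0<δ (0≤y-x⇒x≤y (≤-congʳ
              (solve 2 (λ s d → s :- (s :+ d) := :0 :- d) refl s* δ)
              (x≤y⇒0≤y-x (s*-upper (s* + δ) (+-nonNeg 0≤s* (proj₁ 0<δ) , s*+δ≤1 , i , decide em , i-top)))))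
              where
              s*+δ≤1 : s* + δ ≤ 1#
              s*+δ≤1 = 0≤y-x⇒x≤y (≤-congʳ (solve 2 (λ s d → (:1 :- s) :- d := :1 :- (s :+ d)) refl s* δ) (x≤y⇒0≤y-x δ≤1-s*))
              i = proj₁ (maximiser p (λ k → ⟨ u (s* + δ) , X k ⟩))
              i-top = proj₂ (maximiser p (λ k → ⟨ u (s* + δ) , X k ⟩))
              -ε≤δ : - ε ≤ δ
              -ε≤δ = ≤-trans (≤-congʳ (solve 0 (:- :0 := :0) refl) (neg-antimono-≤ (proj₁ 0<ε))) (proj₁ 0<δ)
              decide : Dec (C i) → C i
              decide (yes ci) = ci
              decide (no ¬ci) = ⊥-elim (none δ -ε≤δ δ≤ε i ¬ci i-top)
            -- The advance is the smaller of the tolerance and the distance to the end of the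
            -- segment.
            choose : ε ≤ 1# - s* ⊎ 1# - s* ≤ ε → ⊥
            choose (inj₁ ε≤) = advance ε 0<ε ≤-refl ε≤
            choose (inj₂ ≤ε) = advance (1# - s*) (x<y⇒0<y-x s*<1) ≤ε ≤-refl

    antipodality-connected : ∀ p q → C p → C q
    antipodality-connected p q cp = decide em
      where
      decide : Dec (C q) → C q
      decide (yes cq) = cq
      decide (no ¬cq) = ⊥-elim (Segment.absurd p q cp ¬cq)

-- The dimension d(d-1)/2 of the alternating forms, in the recursive shape in which `minors` splits
-- off the first coordinate.
triangle : ℕ → ℕ
triangle zero    = zero
triangle (suc d) = d ℕ.+ triangle d

-- Alternating forms in coordinates and the rank argument.

module LowerBound (ℝ : RealNumbers) (em : ExcludedMiddle 0ℓ) where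
  open Continuity ℝ em public

  firstMinors : ∀ {d} → Point (suc d) → Point (suc d) → Point d
  firstMinors x y j = x zero * y (suc j) - y zero * x (suc j)

  -- The coordinates of x ∧ y.
  minors : ∀ {d} → Point d → Point d → Vector Carrier (triangle d)
  minors {zero}  x y = λ ()
  minors {suc d} x y = firstMinors x y ++ minors (tail x) (tail y)

  -- The alternating form whose coefficients on the basis bivectors are `r`. In this form ω becomes
  -- a block of unknowns of a linear system.
  form : ∀ {d} → Vector Carrier (triangle d) → Point d → Point d → Carrier
  form {zero}  r x y = 0#
  form {suc d} r x y = ⟨ (λ j → r (j ↑ˡ triangle d)) , firstMinors x y ⟩ + form (λ k → r (d ↑ʳ k)) (tail x) (tail y)

  ⟨++,⟩ : ∀ {m n} (x : Vector Carrier m) (y : Vector Carrier n) (v : Vector Carrier (m ℕ.+ n)) →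
          ⟨ x ++ y , v ⟩ ≈ ⟨ x , (λ i → v (i ↑ˡ n)) ⟩ + ⟨ y , (λ j → v (m ↑ʳ j)) ⟩
  ⟨++,⟩ {m} x y v = trans (sum-split m (λ k → (x ++ y) k * v k))
    (+-cong (sum-cong-≋ λ i → *-congʳ (reflexive (lookup-++ˡ x y i)))
            (sum-cong-≋ λ j → *-congʳ (reflexive (lookup-++ʳ x y j))))

  ⟨minors,⟩ : ∀ {d} (x y : Point d) r → ⟨ minors x y , r ⟩ ≈ form r x y
  ⟨minors,⟩ {zero}  x y r = refl
  ⟨minors,⟩ {suc d} x y r = trans (⟨++,⟩ (firstMinors x y) (minors (tail x) (tail y)) r)
    (+-cong (⟨,⟩-comm (firstMinors x y) (λ j → r (j ↑ˡ triangle d))) (⟨minors,⟩ (tail x) (tail y) (λ k → r (d ↑ʳ k))))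

  form-linearʳ : ∀ {d} r (x : Point d) → Linear (form r x)
  form-linearʳ {zero} r x = record
    { φ-cong = λ _ → refl ; φ-+ = λ _ _ → sym (+-identityʳ 0#) ; φ-* = λ c _ → sym (zeroʳ c) }
  form-linearʳ {suc d} r x = record
    { φ-cong = λ y≋z → +-cong (φ-cong first λ j → +-cong (*-congˡ (y≋z (suc j))) (-‿cong (*-congʳ (y≋z zero))))
                              (φ-cong rest (y≋z ∘ suc))
    ; φ-+ = λ y z → trans (+-cong
        (trans (φ-cong first λ j → solve 6 (λ x0 xj y0 yj z0 zj → x0 :* (yj :+ zj) :- (y0 :+ z0) :* xj := (x0 :* yj :- y0 :* xj) :+ (x0 :* zj :- z0 :* xj)) refl
                  (x zero) (x (suc j)) (y zero) (y (suc j)) (z zero) (z (suc j)))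
               (φ-+ first (firstMinors x y) (firstMinors x z)))
        (φ-+ rest (tail y) (tail z)))
        (solve 4 (λ a b c d → (a :+ b) :+ (c :+ d) := (a :+ c) :+ (b :+ d)) refl
           ⟨ r₀ , firstMinors x y ⟩ ⟨ r₀ , firstMinors x z ⟩ (form r₁ (tail x) (tail y)) (form r₁ (tail x) (tail z)))
    ; φ-* = λ c y → trans (+-cong
        (trans (φ-cong first λ j → solve 5 (λ c x0 xj y0 yj → x0 :* (c :* yj) :- (c :* y0) :* xj := c :* (x0 :* yj :- y0 :* xj)) refl
                  c (x zero) (x (suc j)) (y zero) (y (suc j)))
               (φ-* first c (firstMinors x y)))
        (φ-* rest c (tail y)))
        (sym (distribˡ c _ _))
    }
    where
    r₀ = λ j → r (j ↑ˡ triangle d)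
    r₁ = λ k → r (d ↑ʳ k)
    first = ⟨ r₀ ,⟩-linear
    rest = form-linearʳ r₁ (tail x)

  form-skew : ∀ {d} r (x y : Point d) → form r x y ≈ - form r y x
  form-skew {zero}  r x y = solve 0 (:0 := :- :0) refl
  form-skew {suc d} r x y = trans (+-cong
      (trans (sum-cong-≋ λ j → solve 5 (λ r x0 xj y0 yj → r :* (x0 :* yj :- y0 :* xj) := :- (r :* (y0 :* xj :- x0 :* yj))) refl
                (r (j ↑ˡ triangle d)) (x zero) (x (suc j)) (y zero) (y (suc j)))
             (sum-neg (λ j → r (j ↑ˡ triangle d) * firstMinors y x j)))
      (form-skew (λ k → r (d ↑ʳ k)) (tail x) (tail y)))
    (solve 2 (λ a b → :- a :+ :- b := :- (a :+ b)) refl ⟨ (λ j → r (j ↑ˡ triangle d)) , firstMinors y x ⟩ (form (λ k → r (d ↑ʳ k)) (tail y) (tail x)))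

  form-isSkew : ∀ {d} r → SkewForm (form {d} r)
  form-isSkew r = record { linearʳ = form-linearʳ r ; skew = form-skew r }

  -- The first unit vector paired with the others reads off the first block of `r`; vectors with
  -- first coordinate 0 reduce the rest to one dimension less.
  form-nondegenerate : ∀ {d} r → (∀ (x y : Point d) → form r x y ≈ 0#) → ∀ k → r k ≈ 0#
  form-nondegenerate {suc d} r form≈0 = ++-elim {d} (λ k → r k ≈ 0#)
    (λ i → begin
      r (i ↑ˡ triangle d)                                     ≈⟨ sum-unit-* i r₀ ⟨
      ⟨ unit i , r₀ ⟩                                         ≈⟨ ⟨,⟩-comm (unit i) r₀ ⟩
      ⟨ r₀ , unit i ⟩                                         ≈⟨ ⟨,⟩-congʳ {u = r₀} (λ j → solve 1 (λ e → e := :1 :* e :- :0 :* :0) refl (unit i j)) ⟩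
      ⟨ r₀ , firstMinors (unit zero) (unit (suc i)) ⟩         ≈⟨ +-identityʳ _ ⟨
      ⟨ r₀ , firstMinors (unit zero) (unit (suc i)) ⟩ + 0#    ≈⟨ +-congˡ (φ-0 (SkewForm.linearˡ (form-isSkew r₁) (unit i))) ⟨
      form r (unit zero) (unit (suc i))                       ≈⟨ form≈0 (unit zero) (unit (suc i)) ⟩
      0#                                                      ∎)
    (form-nondegenerate r₁ λ x y → trans (sym (trans (+-congʳ (sum-zero λ j →
        solve 3 (λ r x y → r :* (:0 :* y :- :0 :* x) := :0) refl (r₀ j) (x j) (y j))) (+-identityˡ _)))
      (form≈0 (0# ∷ x) (0# ∷ y)))
    where
    open ≈-Reasoning
    r₀ = λ j → r (j ↑ˡ triangle d)
    r₁ = λ k → r (d ↑ʳ k)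

  -- The one asymmetric ingredient is the factor in `Parallel`. It is invertible because the second
  -- normal is nonzero.
  Antipodal-sym : ∀ {d n} {X : Vector (Point d) n} {i j} → Antipodal X i j → Antipodal X j i
  Antipodal-sym (Xi≉Xj , H , H′ , different , (c , H′≋cH) , supports , supports′ , on , on′) =
    (λ Xj≋Xi → Xi≉Xj λ k → sym (Xj≋Xi k)) , H′ , H ,
    (λ same → different λ x → record
      { to = Equivalence.from (same x) ; from = Equivalence.to (same x) ; to-cong = λ { ≡.refl → ≡.refl } ; from-cong = λ { ≡.refl → ≡.refl } }) ,
    (c⁻¹ , λ k → begin
      normal H k                  ≈⟨ *-identityˡ _ ⟨
      1# * normal H k             ≈⟨ *-congʳ (proj₂ c-inverse) ⟨
      c * c⁻¹ * normal H k        ≈⟨ solve 3 (λ c d x → c :* d :* x := d :* (c :* x)) refl c c⁻¹ (normal H k) ⟩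
      c⁻¹ * (c * normal H k)      ≈⟨ *-congˡ (H′≋cH k) ⟨
      c⁻¹ * normal H′ k           ∎) ,
    supports′ , supports , on′ , on
    where
    open ≈-Reasoning
    c-inverse = inverse c λ c≈0 → normal≉0 H′ λ k → trans (H′≋cH k) (trans (*-congʳ c≈0) (zeroˡ (normal H k)))
    c⁻¹ = proj₁ c-inverse

  module _ {d n} {X : Vector (Point d) n} (spanning : AffinelySpanning X) (convex : InConvexPosition X) (o : Fin n)
           (L : List (Fin n × Fin n)) (complete : ∀ i j → AntipodalPair X (i , j) → (i , j) ∈ L) where

    private
      supported : ∀ p → ∃[ u ] ¬ IsZero u × ∀ i → ⟨ u , X i ⟩ ≤ ⟨ u , X p ⟩
      supported p = boundary⇒support X p (convex p)

      -- The coefficients of the equation `f i - f j - form r (X j) (X i)` = 0 in the unknowns `f`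
      -- and `r`.
      pairRow : Fin n × Fin n → Vector Carrier (n ℕ.+ triangle d)
      pairRow (i , j) = (λ k → unit i k - unit j k) ++ (λ k → - minors (X j) (X i) k)

      rows : Fin (suc (length L)) → Vector Carrier (n ℕ.+ triangle d)
      rows = (unit o ++ (λ _ → 0#)) ∷ (λ e → pairRow (lookup L e))

      module Kernel (v : Vector Carrier (n ℕ.+ triangle d)) (rows≈0 : ∀ e → ⟨ rows e , v ⟩ ≈ 0#) where
        f : Vector Carrier n
        f i = v (i ↑ˡ triangle d)
        r : Vector Carrier (triangle d)
        r k = v (n ↑ʳ k)

        f-o : f o ≈ 0#
        f-o = begin
          f o                                    ≈⟨ sum-unit-* o f ⟨
          ⟨ unit o , f ⟩                         ≈⟨ +-identityʳ _ ⟨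
          ⟨ unit o , f ⟩ + 0#                    ≈⟨ +-congˡ (sum-zero λ k → zeroˡ (r k)) ⟨
          ⟨ unit o , f ⟩ + ⟨ (λ _ → 0#) , r ⟩    ≈⟨ ⟨++,⟩ (unit o) (λ _ → 0#) v ⟨
          ⟨ rows zero , v ⟩                      ≈⟨ rows≈0 zero ⟩
          0#                                     ∎
          where open ≈-Reasoning

        pairRow≈ : ∀ i j → ⟨ pairRow (i , j) , v ⟩ ≈ (f i - f j) - form r (X j) (X i)
        pairRow≈ i j = begin
          ⟨ pairRow (i , j) , v ⟩
            ≈⟨ ⟨++,⟩ (λ k → unit i k - unit j k) (λ k → - minors (X j) (X i) k) v ⟩
          ⟨ (λ k → unit i k - unit j k) , f ⟩ + ⟨ (λ k → - minors (X j) (X i) k) , r ⟩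
            ≈⟨ +-cong (sum-cong-≋ λ k → solve 3 (λ x y z → (x :- y) :* z := x :* z :- y :* z) refl (unit i k) (unit j k) (f k)) (⟨⟩-neg (minors (X j) (X i)) r) ⟩
          sum (λ k → unit i k * f k - unit j k * f k) - ⟨ minors (X j) (X i) , r ⟩
            ≈⟨ +-cong (sum-sub (λ k → unit i k * f k) (λ k → unit j k * f k)) (-‿cong (⟨minors,⟩ (X j) (X i) r)) ⟩
          (⟨ unit i , f ⟩ - ⟨ unit j , f ⟩) - form r (X j) (X i)
            ≈⟨ +-congʳ (+-cong (sum-unit-* i f) (-‿cong (sum-unit-* j f))) ⟩
          (f i - f j) - form r (X j) (X i) ∎
          where open ≈-Reasoning

        compatible< : ∀ i j → AntipodalPair X (i , j) → form r (X j) (X i) ≈ f i - f j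
        compatible< i j antipodal = sym (x-y≈0⇒x≈y (trans (sym (pairRow≈ i j))
          (≡.subst (λ p → ⟨ pairRow p , v ⟩ ≈ 0#) (≡.sym (lookup-index ij∈L)) (rows≈0 (suc (index ij∈L))))))
          where
          ij∈L = complete i j antipodal

        compatible : ∀ i j → Antipodal X i j → form r (X j) (X i) ≈ f i - f j
        compatible i j antipodal with Finₚ.<-cmp i j
        ... | tri< i<j _ _ = compatible< i j (i<j , antipodal)
        ... | tri≈ _ ≡.refl _ = ⊥-elim (proj₁ antipodal λ _ → refl)
        ... | tri> _ _ j<i = begin
          form r (X j) (X i)      ≈⟨ form-skew r (X j) (X i) ⟩
          - form r (X i) (X j)    ≈⟨ -‿cong (compatible< j i (j<i , Antipodal-sym antipodal)) ⟩
          - (f j - f i)           ≈⟨ solve 2 (λ x y → :- (y :- x) := x :- y) refl (f i) (f j) ⟩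
          f i - f j               ∎
          where open ≈-Reasoning

        form≈0 : ∀ x y → form r x y ≈ 0#
        form≈0 = form-vanishes spanning supported o (form-isSkew r) f compatible

        edge-constant : ∀ i j → Antipodal X i j → f i ≈ f j
        edge-constant i j antipodal = x-y≈0⇒x≈y (trans (sym (compatible i j antipodal)) (form≈0 (X j) (X i)))

        v≈0 : ∀ k → v k ≈ 0#
        v≈0 = ++-elim {n} (λ k → v k ≈ 0#)
          -- Connectedness is applied to the zero set of `f`, which contains `o`.
          (λ i → antipodality-connected spanning supported (λ i → f i ≈ 0#)
            (λ i j antipodal fi≈0 → trans (sym (edge-constant i j antipodal)) fi≈0)
            (λ i j antipodal fj≈0 → trans (edge-constant i j antipodal) fj≈0) o i f-o)
          (form-nondegenerate r form≈0)

    antipodal-list-length : n ℕ.+ triangle d ℕ.≤ suc (length L)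
    antipodal-list-length = ℕₚ.≮⇒≥ λ few → contradiction (nontrivial-kernel (suc (length L)) few rows)
      where
      contradiction : (∃[ v ] ¬ (∀ k → v k ≈ 0#) × ∀ e → ⟨ rows e , v ⟩ ≈ 0#) → ⊥
      contradiction (v , v≉0 , rows≈0) = v≉0 (Kernel.v≈0 v rows≈0)

  antipodal-count-lower : ∀ {d n} {X : Vector (Point d) n} → AffinelySpanning X → InConvexPosition X → Fin n →
                          n ℕ.+ triangle d ℕ.≤ suc (a em X)
  antipodal-count-lower {n = n} {X} spanning convex o = antipodal-list-length spanning convex o
    (filter (λ p → em {AntipodalPair X p}) (cartesianProduct (allFin n) (allFin n)))
    λ i j antipodal → ∈-filter⁺ (λ p → em {AntipodalPair X p}) (∈-cartesianProduct⁺ (∈-allFin i) (∈-allFin j)) antipodal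

-- Counting with lists without repetitions.

unique-lookup : ∀ {A : Set} {xs : List A} → Unique xs → ∀ {i j} → i Fin.< j → lookup xs i ≢ lookup xs j
unique-lookup (x∉xs AllPairs.∷ unique) {zero}  {suc j} _         = All.lookup x∉xs (∈-lookup j)
unique-lookup (x∉xs AllPairs.∷ unique) {suc i} {suc j} (s≤s i<j) = unique-lookup unique i<j

-- By the pigeonhole principle, a longer `xs` would have two positions sent to the same position of
-- `ys`, hence two equal entries.
unique-⊆⇒length-≤ : ∀ {A : Set} {xs ys : List A} → Unique xs → (∀ {x} → x ∈ xs → x ∈ ys) → length xs ℕ.≤ length ys
unique-⊆⇒length-≤ {xs = xs} {ys} unique xs⊆ys = ℕₚ.≮⇒≥ λ fewer → collision (Finₚ.pigeonhole fewer position)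
  where
  position : Fin (length xs) → Fin (length ys)
  position i = index (xs⊆ys (∈-lookup {xs = xs} i))
  collision : (∃[ i ] ∃[ j ] i Fin.< j × position i ≡ position j) → ⊥
  collision (i , j , i<j , same) = unique-lookup unique i<j
    (≡.trans (lookup-index (xs⊆ys (∈-lookup {xs = xs} i)))
    (≡.trans (≡.cong (lookup ys) same) (≡.sym (lookup-index (xs⊆ys (∈-lookup {xs = xs} j))))))

increasingPairs : ∀ d → List (Fin d × Fin d)
increasingPairs zero    = []
increasingPairs (suc d) = List.map (λ j → zero , suc j) (allFin d) List.++ List.map (map suc suc) (increasingPairs d)

length-increasingPairs : ∀ d → length (increasingPairs d) ≡ triangle d
length-increasingPairs zero    = ≡.refl
length-increasingPairs (suc d) = ≡.trans (length-++ (List.map (λ j → zero , suc j) (allFin d)))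
  (≡.cong₂ ℕ._+_ (≡.trans (length-map _ (allFin d)) (length-tabulate {n = d} (λ i → i)))
                 (≡.trans (length-map (map suc suc) (increasingPairs d)) (length-increasingPairs d)))

<⇒∈increasingPairs : ∀ {d} (i j : Fin d) → i Fin.< j → (i , j) ∈ increasingPairs d
<⇒∈increasingPairs zero    (suc j) _         = ∈-++⁺ˡ (∈-map⁺ (λ j → zero , suc j) (∈-allFin j))
<⇒∈increasingPairs (suc i) (suc j) (s≤s i<j) = ∈-++⁺ʳ _ (∈-map⁺ (map suc suc) (<⇒∈increasingPairs i j i<j))

-- The extremal configuration.

module Example (ℝ : RealNumbers) (em : ExcludedMiddle 0ℓ) where
  open LowerBound ℝ em public

  support⇒boundary : ∀ {d n} (X : Vector (Point d) n) p u → 0# < ⟨ u , u ⟩ →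
                     (∀ i → ⟨ u , X i ⟩ ≤ ⟨ u , X p ⟩) → bd (conv X) (X p)
  support⇒boundary {d} X p u 0<q u≤ ε 0<ε =
    (X p , <-resp-≈ (sym (sum-zero λ k → solve 1 (λ x → (x :- x) :* (x :- x) := :0) refl (X p k))) refl (*-pos 0<ε 0<ε) , ∈conv p) ,
    (y , near , λ y∈conv → <⇒≱ (*-pos 0<δ 0<q) (0≤y-x⇒x≤y (≤-congʳ
      (trans (+-congˡ (-‿cong ⟨u,y⟩)) (solve 3 (λ x d q → x :- (x :+ d :* q) := :0 :- d :* q) refl ⟨ u , X p ⟩ δ q))
      (x≤y⇒0≤y-x (conv-bound ⟨ u ,⟩-linear u≤ y y∈conv)))))
    where
    q = ⟨ u , u ⟩
    0<1+q : 0# < 1# + q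
    0<1+q = +-pos-nonNeg 0<1 (proj₁ 0<q)
    c = proj₁ (posInverse 0<1+q)
    0<c : 0# < c
    0<c = proj₁ (proj₂ (posInverse 0<1+q))
    [1+q]c≈1 : (1# + q) * c ≈ 1#
    [1+q]c≈1 = proj₂ (proj₂ (posInverse 0<1+q))
    -- The point outside is `X p` moved by δ = ε / (1 + q) along `u`. Its squared distance δ² q is
    -- below ε² since q < (1 + q)², which avoids a square root of q.
    δ = ε * c
    0<δ : 0# < δ
    0<δ = *-pos 0<ε 0<c
    y : Point d
    y k = X p k + δ * u k
    ⟨u,y⟩ : ⟨ u , y ⟩ ≈ ⟨ u , X p ⟩ + δ * q
    ⟨u,y⟩ = trans (φ-+ ⟨ u ,⟩-linear (X p) (λ k → δ * u k)) (+-congˡ (φ-* ⟨ u ,⟩-linear δ u))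
    near : dist² (X p) y < ε * ε
    near = 0<y-x⇒x<y (<-resp-≈ refl (begin
      δ * δ * (1# + q + q * q)
        ≈⟨ solve 3 (λ e c q → (e :* c) :* (e :* c) :* (:1 :+ q :+ q :* q) := e :* e :* (((:1 :+ q) :* c) :* ((:1 :+ q) :* c)) :- (e :* c) :* (e :* c) :* q) refl ε c q ⟩
      ε * ε * (((1# + q) * c) * ((1# + q) * c)) - δ * δ * q
        ≈⟨ +-cong (*-congˡ (trans (*-cong [1+q]c≈1 [1+q]c≈1) (*-identityˡ 1#))) (-‿cong (*-distribˡ-sum (δ * δ) (λ k → u k * u k))) ⟩
      ε * ε * 1# - sum (λ k → δ * δ * (u k * u k))
        ≈⟨ +-cong (*-identityʳ _) (-‿cong (sum-cong-≋ λ k → solve 3 (λ x d u → d :* d :* (u :* u) := (x :- (x :+ d :* u)) :* (x :- (x :+ d :* u))) refl (X p k) δ (u k))) ⟩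
      ε * ε - dist² (X p) y ∎)
      (*-pos (*-pos 0<δ 0<δ) (+-pos-nonNeg 0<1+q (x*x-nonNeg q))))
      where open ≈-Reasoning

  -- A common point forces the offsets into the same ratio `c` as the normals.
  parallel-through-point⇒same : ∀ {d} {H H′ : Hyperplane d} {z} → Parallel H H′ → z on H → z on H′ → ¬ Different H H′
  parallel-through-point⇒same {d} {H} {H′} {z} (c , H′≋cH) z∈H z∈H′ different = different λ x → record
    { to = λ x∈H → begin
        ⟨ normal H′ , x ⟩       ≈⟨ scaled x ⟩
        c * ⟨ normal H , x ⟩    ≈⟨ *-congˡ x∈H ⟩
        c * offset H            ≈⟨ offsets ⟨
        offset H′               ∎
    ; from = λ x∈H′ → x-y≈0⇒x≈y (*-cancel-0 c≉0 (begin
        c * (⟨ normal H , x ⟩ - offset H)       ≈⟨ solve 3 (λ c x y → c :* (x :- y) := c :* x :- c :* y) refl c ⟨ normal H , x ⟩ (offset H) ⟩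
        c * ⟨ normal H , x ⟩ - c * offset H     ≈⟨ +-cong (trans (sym (scaled x)) x∈H′) (-‿cong (sym offsets)) ⟩
        offset H′ - offset H′                   ≈⟨ -‿inverseʳ _ ⟩
        0#                                      ∎))
    ; to-cong = λ { ≡.refl → ≡.refl } ; from-cong = λ { ≡.refl → ≡.refl } }
    where
    open ≈-Reasoning
    scaled : ∀ x → ⟨ normal H′ , x ⟩ ≈ c * ⟨ normal H , x ⟩
    scaled x = trans (⟨,⟩-congˡ {w = x} H′≋cH) (trans (sum-cong-≋ λ k → *-assoc c (normal H k) (x k)) (sym (*-distribˡ-sum c (λ k → normal H k * x k))))
    offsets : offset H′ ≈ c * offset H
    offsets = trans (sym z∈H′) (trans (scaled z) (*-congˡ z∈H))
    c≉0 : ¬ c ≈ 0#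
    c≉0 c≈0 = normal≉0 H′ λ k → trans (H′≋cH k) (trans (*-congʳ c≈0) (zeroˡ (normal H k)))

  ι : ℕ → Carrier
  ι zero    = 0#
  ι (suc m) = 1# + ι m

  ι-nonNeg : ∀ m → 0# ≤ ι m
  ι-nonNeg zero    = ≤-refl
  ι-nonNeg (suc m) = +-nonNeg (proj₁ 0<1) (ι-nonNeg m)

  ι-mono-≤ : ∀ {l m} → l ℕ.≤ m → ι l ≤ ι m
  ι-mono-≤ {m = m} ℕ.z≤n   = ι-nonNeg m
  ι-mono-≤ (s≤s l≤m) = +-mono-≤ ≤-refl (ι-mono-≤ l≤m)

  ι-mono-< : ∀ {l m} → l ℕ.< m → ι l < ι m
  ι-mono-< {l} l<m = <-≤-trans (0<y-x⇒x<y (<-resp-≈ refl (solve 1 (λ x → :1 := (:1 :+ x) :- x) refl (ι l)) 0<1)) (ι-mono-≤ l<m)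

  ι-injective : ∀ {l m} → ι l ≈ ι m → l ≡ m
  ι-injective {l} {m} ιl≈ιm with ℕₚ.<-cmp l m
  ... | tri< l<m _ _ = ⊥-elim (proj₂ (ι-mono-< l<m) ιl≈ιm)
  ... | tri≈ _ l≡m _ = l≡m
  ... | tri> _ _ m<l = ⊥-elim (proj₂ (ι-mono-< m<l) (sym ιl≈ιm))

  -- A simplex with apex 0 and vertices N e₁ , … , N e_d, with k further
  -- points in the relative interior of the facet opposite to the apex.
  module Simplex (d′ k : ℕ) where

    d : ℕ
    d = suc (suc d′)

    -- The coordinate sum of every `interior j`. Vertices at distance `N` along the axes then lie on
    -- the same hyperplane as these points.
    N : Carrier
    N = 1# + (1# + (ι k + sum {d′} (λ _ → 1#)))

    1≤N : 1# ≤ N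
    1≤N = ≤-congˡ (+-identityʳ 1#) (+-mono-≤ ≤-refl (+-nonNeg (proj₁ 0<1) (+-nonNeg (ι-nonNeg k) (sum-nonNeg {d′} λ _ → proj₁ 0<1))))
    0<N : 0# < N
    0<N = <-≤-trans 0<1 1≤N
    N⁻¹ = proj₁ (posInverse 0<N)

    vertex : Fin d → Point d
    vertex i c = N * unit i c

    -- The first two coordinates trade `j` against `k - j`: the sum is fixed, the points are
    -- distinct, and every coordinate is at least 1. Two coordinates are available because 2 ≤ `d`.
    interior : Fin k → Point d
    interior j = (1# + ι (Fin.toℕ j)) ∷ (1# + (ι k - ι (Fin.toℕ j))) ∷ λ _ → 1#

    facet : Fin (d ℕ.+ k) → Point d
    facet = vertex ++ interior

    X : Vector (Point d) (suc (d ℕ.+ k))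
    X = (λ _ → 0#) ∷ facet

    1≤interior : ∀ j c → 1# ≤ interior j c
    1≤interior j zero          = ≤-congˡ (+-identityʳ 1#) (+-mono-≤ ≤-refl (ι-nonNeg (Fin.toℕ j)))
    1≤interior j (suc zero)    = ≤-congˡ (+-identityʳ 1#) (+-mono-≤ ≤-refl (x≤y⇒0≤y-x (ι-mono-≤ (ℕₚ.<⇒≤ (Finₚ.toℕ<n j)))))
    1≤interior j (suc (suc c)) = ≤-refl

    ones : Point d
    ones _ = 1#

    height : ∀ x → ⟨ ones , x ⟩ ≈ sum x
    height x = sum-cong-≋ λ c → *-identityˡ (x c)

    sum-vertex : ∀ i → sum (vertex i) ≈ N
    sum-vertex i = trans (sym (*-distribˡ-sum N (unit i))) (trans (*-congˡ (sum-unit i)) (*-identityʳ N))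

    sum-interior : ∀ j → sum (interior j) ≈ N
    sum-interior j = solve 3 (λ j k s → (:1 :+ j) :+ ((:1 :+ (k :- j)) :+ s) := :1 :+ (:1 :+ (k :+ s))) refl (ι (Fin.toℕ j)) (ι k) (sum {d′} (λ _ → 1#))

    sum-facet : ∀ i → sum (facet i) ≈ N
    sum-facet = ++-elim {d} {k} (λ i → sum (facet i) ≈ N)
      (λ i → ≡.subst (λ x → sum x ≈ N) (≡.sym (lookup-++ˡ vertex interior i)) (sum-vertex i))
      (λ j → ≡.subst (λ x → sum x ≈ N) (≡.sym (lookup-++ʳ vertex interior j)) (sum-interior j))

    vertex-zero : ∀ i → ∃[ c ] vertex i c ≈ 0#
    vertex-zero zero    = suc zero , zeroʳ N
    vertex-zero (suc i) = zero , zeroʳ N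

    vertex≉interior : ∀ i j → ¬ (∀ c → vertex i c ≈ interior j c)
    vertex≉interior i j same = <⇒≱ 0<1 (≤-congʳ (trans (sym (same c)) (proj₂ (vertex-zero i))) (1≤interior j c))
      where c = proj₁ (vertex-zero i)

    vertex-injective : ∀ i j → (∀ c → vertex i c ≈ vertex j c) → i ≡ j
    vertex-injective i j same with i Finₚ.≟ j
    ... | yes i≡j = i≡j
    ... | no  i≢j = ⊥-elim (>⇒≉ 0<N (begin
      N               ≈⟨ *-identityʳ N ⟨
      N * 1#          ≡⟨ ≡.cong (N *_) (unit-diag j) ⟨
      vertex j j      ≈⟨ same j ⟨
      vertex i j      ≡⟨ ≡.cong (N *_) (unit-off i≢j) ⟩
      N * 0#          ≈⟨ zeroʳ N ⟩
      0#              ∎))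
      where open ≈-Reasoning

    interior-injective : ∀ i j → (∀ c → interior i c ≈ interior j c) → i ≡ j
    interior-injective i j same = Finₚ.toℕ-injective (ι-injective (x-y≈0⇒x≈y (trans
      (solve 2 (λ x y → x :- y := (:1 :+ x) :- (:1 :+ y)) refl (ι (Fin.toℕ i)) (ι (Fin.toℕ j))) (x≈y⇒x-y≈0 (same zero)))))

    facet-injective : ∀ i j → (∀ c → facet i c ≈ facet j c) → i ≡ j
    facet-injective = ++-elim {d} {k} (λ i → ∀ j → (∀ c → facet i c ≈ facet j c) → i ≡ j)
      (λ i → ++-elim {d} {k} (λ j → (∀ c → facet (i ↑ˡ k) c ≈ facet j c) → i ↑ˡ k ≡ j)
        (λ j same → ≡.cong (_↑ˡ k) (vertex-injective i j (≡.subst₂ (λ x y → ∀ c → x c ≈ y c) (lookup-++ˡ vertex interior i) (lookup-++ˡ vertex interior j) same)))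
        (λ j same → ⊥-elim (vertex≉interior i j (≡.subst₂ (λ x y → ∀ c → x c ≈ y c) (lookup-++ˡ vertex interior i) (lookup-++ʳ vertex interior j) same))))
      (λ i → ++-elim {d} {k} (λ j → (∀ c → facet (d ↑ʳ i) c ≈ facet j c) → d ↑ʳ i ≡ j)
        (λ j same → ⊥-elim (vertex≉interior j i λ c → sym (≡.subst₂ (λ x y → ∀ c → x c ≈ y c) (lookup-++ʳ vertex interior i) (lookup-++ˡ vertex interior j) same c)))
        (λ j same → ≡.cong (d ↑ʳ_) (interior-injective i j (≡.subst₂ (λ x y → ∀ c → x c ≈ y c) (lookup-++ʳ vertex interior i) (lookup-++ʳ vertex interior j) same))))

    X-injective : ∀ {i j} → (∀ c → X i c ≈ X j c) → i ≡ j
    X-injective {zero}  {zero}  _    = ≡.refl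
    X-injective {zero}  {suc j} same = ⊥-elim (>⇒≉ 0<N (trans (sym (sum-facet j)) (sum-zero λ c → sym (same c))))
    X-injective {suc i} {zero}  same = ⊥-elim (>⇒≉ 0<N (trans (sym (sum-facet i)) (sum-zero same)))
    X-injective {suc i} {suc j} same = ≡.cong suc (facet-injective i j same)

    X-spanning : AffinelySpanning X
    -- Vertex `i` gets weight `y i` / `N`, the interior points get 0, and the apex, being the
    -- origin, absorbs the rest.
    X-spanning y = ((1# - sum t) ∷ t) , solve 1 (λ s → (:1 :- s) :+ s := :1) refl (sum t) , λ c → begin
      (1# - sum t) * 0# + sum (λ i → t i * facet i c)     ≈⟨ trans (+-congʳ (zeroʳ _)) (+-identityˡ _) ⟩
      sum (λ i → t i * facet i c)                         ≈⟨ sum-split d (λ i → t i * facet i c) ⟩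
      sum (λ i → t (i ↑ˡ k) * facet (i ↑ˡ k) c) + sum (λ j → t (d ↑ʳ j) * facet (d ↑ʳ j) c)
        ≈⟨ +-cong (sum-cong-≋ λ i → *-cong (reflexive (lookup-++ˡ scaled zeros i)) (reflexive (≡.cong (λ x → x c) (lookup-++ˡ vertex interior i))))
                  (sum-zero λ j → trans (*-congʳ (reflexive (lookup-++ʳ scaled zeros j))) (zeroˡ _)) ⟩
      sum (λ i → y i * N⁻¹ * (N * unit i c)) + 0#         ≈⟨ +-identityʳ _ ⟩
      sum (λ i → y i * N⁻¹ * (N * unit i c))
        ≈⟨ sum-cong-≋ (λ i → trans (solve 4 (λ y m n e → y :* m :* (n :* e) := (n :* m) :* (e :* y)) refl (y i) N⁻¹ N (unit i c))
             (trans (*-congʳ (proj₂ (proj₂ (posInverse 0<N)))) (trans (*-identityˡ _) (*-congʳ (reflexive (unit-sym i c)))))) ⟩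
      sum (λ i → unit c i * y i)                          ≈⟨ sum-unit-* c y ⟩
      y c                                                 ∎
      where
      open ≈-Reasoning
      scaled : Vector Carrier d
      scaled i = y i * N⁻¹
      zeros : Vector Carrier k
      zeros _ = 0#
      t : Vector Carrier (d ℕ.+ k)
      t = scaled ++ zeros

    height-X : ∀ i → 0# ≤ ⟨ ones , X i ⟩ × ⟨ ones , X i ⟩ ≤ N
    height-X zero    = ≤-reflexive (sym (φ-0 ⟨ ones ,⟩-linear)) , ≤-congˡ (sym (φ-0 ⟨ ones ,⟩-linear)) (proj₁ 0<N)
    height-X (suc i) = ≤-congʳ (sym height-i) (proj₁ 0<N) , ≤-reflexive height-i
      where
      height-i : ⟨ ones , X (suc i) ⟩ ≈ N
      height-i = trans (height (X (suc i))) (sum-facet i)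

    0<sum-squares : ∀ (u : Point d) → u zero * u zero ≈ 1# → 0# < ⟨ u , u ⟩
    0<sum-squares u u₀²≈1 = <-≤-trans (<-resp-≈ refl (sym u₀²≈1) 0<1) (term≤sum (λ c → x*x-nonNeg (u c)) zero)

    X-convex : InConvexPosition X
    X-convex zero = support⇒boundary X zero (λ _ → - 1#) (0<sum-squares (λ _ → - 1#) (solve 0 ((:- :1) :* (:- :1) := :1) refl))
      λ i → ≤-congˡ (sym (⟨⟩-neg ones (X i))) (≤-congʳ (sym (⟨⟩-neg ones (X zero)))
        (neg-antimono-≤ (≤-congˡ (sym (φ-0 ⟨ ones ,⟩-linear)) (proj₁ (height-X i)))))
    X-convex (suc j) = support⇒boundary X (suc j) ones (0<sum-squares ones (*-identityˡ 1#))
      λ i → ≤-congʳ (sym (trans (height (X (suc j))) (sum-facet j))) (proj₂ (height-X i))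

    -- An interior point is a combination of the vertices with positive
    -- coefficients, so all of them lie on H.
    supports-interior : ∀ j (H : Hyperplane d) → Supports H (conv X) → interior j on H → ∀ i → facet i on H
    supports-interior j H (_ , side) p∈H i = begin
      ⟨ u , facet i ⟩                                ≈⟨ x-y≈0⇒x≈y (*-cancel-0 (>⇒≉ 0<N) (begin
          N * (⟨ u , facet i ⟩ - o)                        ≈⟨ solve 3 (λ n x o → n :* (x :- o) := n :* x :- o :* n) refl N ⟨ u , facet i ⟩ o ⟩
          N * ⟨ u , facet i ⟩ - o * N                      ≈⟨ x≈y⇒x-y≈0 (trans (scaledSum (facet i)) (*-congˡ (sum-facet i))) ⟩
          0#                                               ∎)) ⟩
      o                                              ∎
      where
      open ≈-Reasoning
      u = normal H
      o = offset H
      p = interior j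
      X-vertex : ∀ c → X (suc (c ↑ˡ k)) ≡ vertex c
      X-vertex c = lookup-++ˡ vertex interior c
      ⟨u,vertex⟩ : ∀ c → ⟨ u , X (suc (c ↑ˡ k)) ⟩ ≈ N * u c
      ⟨u,vertex⟩ c = trans (reflexive (≡.cong ⟨ u ,_⟩ (X-vertex c))) (trans (φ-* ⟨ u ,⟩-linear N (unit c))
        (*-congˡ (trans (⟨,⟩-comm u (unit c)) (sum-unit-* c u))))
      -- `N * u c` is the value of the normal at vertex `c`. The slacks of the vertices, weighted by
      -- the coordinates of the interior point, cancel because that point lies on `H`; the sign `s`
      -- treats both sides of `H` at once.
      balance : ∀ s → sum (λ c → p c * (s * (o - N * u c))) ≈ 0#
      balance s = begin
        sum (λ c → p c * (s * (o - N * u c)))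
          ≈⟨ sum-cong-≋ (λ c → solve 5 (λ p s o n u → p :* (s :* (o :- n :* u)) := (s :* o) :* p :+ (:- (s :* n)) :* (u :* p)) refl (p c) s o N (u c)) ⟩
        sum (λ c → s * o * p c + - (s * N) * (u c * p c))
          ≈⟨ sum-linear (s * o) p (λ c → - (s * N) * (u c * p c)) ⟩
        s * o * sum p + sum (λ c → - (s * N) * (u c * p c))
          ≈⟨ +-cong (*-congˡ (sum-interior j)) (sym (*-distribˡ-sum (- (s * N)) (λ c → u c * p c))) ⟩
        s * o * N + - (s * N) * ⟨ u , p ⟩
          ≈⟨ +-congˡ (*-congˡ p∈H) ⟩
        s * o * N + - (s * N) * o
          ≈⟨ solve 3 (λ s o n → s :* o :* n :+ (:- (s :* n)) :* o := :0) refl s o N ⟩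
        0# ∎
      tight-with-sign : ∀ s → ¬ s ≈ 0# → (∀ c → 0# ≤ s * (o - N * u c)) → ∀ c → o ≈ N * u c
      tight-with-sign s s≉0 0≤ c = x-y≈0⇒x≈y (*-cancel-0 s≉0 (*-cancel-0 (>⇒≉ (<-≤-trans 0<1 (1≤interior j c)))
        (sum-nonNeg-≤0 (λ c → *-nonNeg (≤-trans (proj₁ 0<1) (1≤interior j c)) (0≤ c)) (≤-reflexive (balance s)) c)))
      tight : (∀ y → conv X y → ⟨ u , y ⟩ ≤ o) ⊎ (∀ y → conv X y → o ≤ ⟨ u , y ⟩) → ∀ c → o ≈ N * u c
      tight (inj₁ below) = tight-with-sign 1# (λ 1≈0 → 0≉1 (sym 1≈0)) λ c → ≤-congʳ (sym (*-identityˡ _))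
        (x≤y⇒0≤y-x (≤-congˡ (⟨u,vertex⟩ c) (below (X (suc (c ↑ˡ k))) (∈conv {X = X} (suc (c ↑ˡ k))))))
      tight (inj₂ above) = tight-with-sign (- 1#) (λ -1≈0 → 0≉1 (trans (solve 0 (:0 := :- :0) refl) (trans (-‿cong (sym -1≈0)) (solve 0 (:- (:- :1) := :1) refl)))) λ c →
        ≤-congʳ (solve 2 (λ x y → y :- x := (:- :1) :* (x :- y)) refl o (N * u c))
        (x≤y⇒0≤y-x (≤-congʳ (⟨u,vertex⟩ c) (above (X (suc (c ↑ˡ k))) (∈conv {X = X} (suc (c ↑ˡ k))))))
      scaledSum : ∀ x → N * ⟨ u , x ⟩ ≈ o * sum x
      scaledSum x = begin
        N * ⟨ u , x ⟩                    ≈⟨ *-distribˡ-sum N (λ c → u c * x c) ⟩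
        sum (λ c → N * (u c * x c))      ≈⟨ sum-cong-≋ (λ c → trans (sym (*-assoc N (u c) (x c))) (*-congʳ (sym (tight side c)))) ⟩
        sum (λ c → o * x c)              ≈⟨ *-distribˡ-sum o x ⟨
        o * sum x                        ∎

    -- The hyperplane through the interior point contains the whole facet, hence also `facet i`. It
    -- thus meets its parallel partner and coincides with it.
    not-antipodal : ∀ i j → ¬ Antipodal X (suc i) (suc (d ↑ʳ j))
    not-antipodal i j (_ , H , H′ , different , parallel , _ , supports , i∈H , j∈H′) =
      parallel-through-point⇒same {H = H} {H′} {z = facet i} parallel i∈H
        (supports-interior j H′ supports (≡.subst (_on H′) (lookup-++ʳ vertex interior j) j∈H′) i) different

    candidates : List (Fin (suc (d ℕ.+ k)) × Fin (suc (d ℕ.+ k)))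
    candidates = List.map (λ j → zero , suc j) (allFin (d ℕ.+ k)) List.++
                 List.map (map (λ i → suc (i ↑ˡ k)) (λ j → suc (j ↑ˡ k))) (increasingPairs d)

    antipodal⇒candidate : ∀ i j → AntipodalPair X (i , j) → (i , j) ∈ candidates
    antipodal⇒candidate zero    (suc j) _ = ∈-++⁺ˡ (∈-map⁺ (λ j → zero , suc j) (∈-allFin j))
    antipodal⇒candidate (suc i) (suc j) (s≤s i<j , antipodal) = ++-elim {d} {k}
      (λ j → i Fin.< j → Antipodal X (suc i) (suc j) → (suc i , suc j) ∈ candidates)
      (λ j i<j _ → ++-elim {d} {k} (λ i → i Fin.< j ↑ˡ k → (suc i , suc (j ↑ˡ k)) ∈ candidates)
        (λ i i<j → ∈-++⁺ʳ (List.map (λ j → zero , suc j) (allFin (d ℕ.+ k))) (∈-map⁺ (map (λ i → suc (i ↑ˡ k)) (λ j → suc (j ↑ˡ k))) (<⇒∈increasingPairs i j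
          (≡.subst₂ ℕ._<_ (Finₚ.toℕ-↑ˡ i k) (Finₚ.toℕ-↑ˡ j k) i<j))))
        -- Interior points are numbered after the vertices, so none of them precedes a vertex.
        (λ i i<j → ⊥-elim (ℕₚ.<⇒≱ (ℕₚ.<-≤-trans (≡.subst₂ ℕ._<_ (Finₚ.toℕ-↑ʳ d i) (Finₚ.toℕ-↑ˡ j k) i<j) (ℕₚ.<⇒≤ (Finₚ.toℕ<n j)))
          (ℕₚ.m≤m+n d (Fin.toℕ i))))
        i i<j)
      (λ j _ antipodal → ⊥-elim (not-antipodal i j antipodal))
      j i<j antipodal

    antipodal-count-upper : a em X ℕ.≤ d ℕ.+ k ℕ.+ triangle d
    antipodal-count-upper = ℕₚ.≤-trans (unique-⊆⇒length-≤
        (Uniqueₚ.filter⁺ P? (Uniqueₚ.cartesianProduct⁺ (Uniqueₚ.allFin⁺ _) (Uniqueₚ.allFin⁺ _)))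
        λ {p} p∈ → antipodal⇒candidate (proj₁ p) (proj₂ p) (proj₂ (∈-filter⁻ P? {xs = cartesianProduct (allFin _) (allFin _)} p∈)))
      (ℕₚ.≤-reflexive (≡.trans (length-++ (List.map (λ j → zero , suc j) (allFin (d ℕ.+ k))))
        (≡.cong₂ ℕ._+_ (≡.trans (length-map _ (allFin (d ℕ.+ k))) (length-tabulate {n = d ℕ.+ k} (λ i → i)))
                       (≡.trans (length-map _ (increasingPairs d)) (length-increasingPairs d)))))
      where
      P? = λ p → em {AntipodalPair X p}

-- The closed form d(d-1)/2 and the conclusion.

triangle-double : ∀ d → triangle d ℕ.* 2 ≡ d ℕ.* (d ℕ.∸ 1)
triangle-double zero          = ≡.refl
triangle-double (suc zero)    = ≡.refl
triangle-double (suc (suc d)) = begin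
  (suc d ℕ.+ triangle (suc d)) ℕ.* 2            ≡⟨ ℕₚ.*-distribʳ-+ 2 (suc d) (triangle (suc d)) ⟩
  suc d ℕ.* 2 ℕ.+ triangle (suc d) ℕ.* 2        ≡⟨ ≡.cong (suc d ℕ.* 2 ℕ.+_) (triangle-double (suc d)) ⟩
  suc d ℕ.* 2 ℕ.+ suc d ℕ.* d                   ≡⟨ ℕₚ.*-distribˡ-+ (suc d) 2 d ⟨
  suc d ℕ.* suc (suc d)                         ≡⟨ ℕₚ.*-comm (suc d) (suc (suc d)) ⟩
  suc (suc d) ℕ.* suc d                         ∎
  where open ≡.≡-Reasoning

triangle-closed-form : ∀ d → d ℕ.* (d ℕ.∸ 1) ℕ./ 2 ≡ triangle d
triangle-closed-form d = ≡.trans (≡.cong (ℕ._/ 2) (≡.sym (triangle-double d))) (m*n/n≡m (triangle d) 2)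

open import Data.Nat using (_+_; _*_; _∸_; _≤_; _/_)

theorem1p2 : (ℝ : RealNumbers) (em : ExcludedMiddle 0ℓ) (d n : ℕ) →
    2 ≤ d → d + 1 ≤ n →
    IsMinimum (Geometry.AntipodalCounts ℝ em d n)
    (n + d * (d ∸ 1) / 2 ∸ 1)
theorem1p2 ℝ em d@(suc (suc d′)) n (s≤s (s≤s ℕ.z≤n)) d+1≤n rewrite triangle-closed-form d = minimum (n ∸ (d + 1))
  (≡.trans (≡.cong (_+ (n ∸ (d + 1))) (ℕₚ.+-comm 1 d)) (ℕₚ.m+[n∸m]≡n d+1≤n))
  where
  open Example ℝ em using (module Simplex; antipodal-count-lower; AntipodalCounts; a)
  -- Here `k` counts the points beyond a simplex. Once `n` is `suc (d + k)`, the `∸ 1` of the claim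
  -- computes away, in step with the `suc` of the lower bound.
  minimum : ∀ k → suc (d + k) ≡ n → IsMinimum (AntipodalCounts em d n) (n + triangle d ∸ 1)
  minimum k ≡.refl =
    (X , X-injective , X-spanning , X-convex ,
      ℕₚ.≤-antisym antipodal-count-upper (ℕ.s≤s⁻¹ (antipodal-count-lower X-spanning X-convex zero))) ,
    λ { _ (Y , _ , spanning , convex , ≡.refl) → ℕ.s≤s⁻¹ (antipodal-count-lower spanning convex zero) }
    where open Simplex d′ k using (X; X-injective; X-spanning; X-convex; antipodal-count-upper)
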